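{- For every integer $n\ge 1$, the following identity of polynomials in $t$ and $z$ holds: \[\sum_{k=0}^{n-1}\left(\sum_{P\in \mathsf{stLD}(n)^{\bullet k}}t^{\mathsf{area}(P)}(-1)^{\mathsf{dinv}(P)}\right)z^k=\sum_{\sigma\in\mathfrak S_n}t^{\mathsf{inv}_3(\sigma)}z^{\mathsf{monot}(\sigma)},\] where $\mathsf{stLD}(n)^{\bullet k}$ is the set of standardly labelled Dyck paths of size $n$ with $k$ decorated contractible valleys.
   Context: Dyck paths. A Dyck path of size $n$ is a lattice path from $(0,0)$ to $(n,n)$ with unit north and east steps staying weakly above the line $x=y$. A standardly labelled Dyck path is a pair $(\pi,w)$ with $\pi$ a Dyck path of size $n$ and $w=w_1\cdots w_n$ a permutation of $\{1,\dots,n\}$, where $w_i$ labels the $i$-th vertical (north) step of $\pi$, such that the labels of vertical steps lying in the same column are increasing from bottom to top. The area word $a=a_1\cdots a_n$ of $\pi$: $a_i$ is the number of whole unit squares between the $i$-th vertical step and the line $x=y$ (in the row of that step). The $i$-th vertical step ($2\le i\le n$) is a contractible valley of $(\pi,w)$ if either $a_{i-1}>a_i$, or $a_{i-1}=a_i$ and $w_{i-1}<w_i$. The set $\mathsf{stLD}(n)^{\bullet k}$ consists of the triples $P=(\pi,w,dv)$ with $(\pi,w)$ a standardly labelled Dyck path of size $n$ and $dv$ a $k$-element subset of (the indices of) its contractible valleys (the decorated valleys). Statistics on paths. $\mathsf{area}(P)=\sum_{i=1}^n a_i$. A pair $(i,j)$ with $1\le i<j\le n$ is a primary diagonal inversion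 if $a_i=a_j$, $w_i<w_j$ and $i\notin dv$; it is a secondary diagonal inversion if $a_i=a_j+1$, $w_i>w_j$ and $i\notin dv$. $\mathsf{dinv}(P)$ is the total number of primary and secondary diagonal inversions minus the number $|dv|$ of decorated valleys. Statistics on permutations. For $\sigma\in\mathfrak S_n$ put $\sigma_0=0$. For $i\in\{2,\dots,n\}$, $\sigma_i$ is a double ascent if $\sigma_{i-2}<\sigma_{i-1}<\sigma_i$; a double descent if $\sigma_{i-2}>\sigma_{i-1}>\sigma_i$; a peak if $\sigma_{i-2}<\sigma_{i-1}>\sigma_i$; a valley if $\sigma_{i-2}>\sigma_{i-1}<\sigma_i$. $\mathsf{monot}(\sigma)$ is the number of $i\in\{2,\dots,n\}$ such that $\sigma_i$ is a double ascent or a double descent. A pair $(i,j)$ with $1\le i<j\le n$ is a $3$-inversion of $\sigma$ if one of the following holds: $\sigma_j$ is a double ascent and $\sigma_{j-1}<\sigma_i<\sigma_j$; $\sigma_j$ is a double descent and $\sigma_{j-1}>\sigma_i>\sigma_j$; $\sigma_j$ is a peak and $\sigma_i>\sigma_j$; $\sigma_j$ is a valley and $\sigma_i<\sigma_j$. $\mathsf{inv}_3(\sigma)$ is the number of $3$-inversions of $\sigma$. -}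

module Defs where

open import Data.Bool.Base using (true; false)
open import Data.Fin.Base as Fin using (Fin; zero; suc; toℕ; pred)
import Data.Fin.Properties as Fin
open import Data.Fin.Subset using (Subset; _∈_; _∉_; ∣_∣)
open import Data.Fin.Subset.Properties using (_∈?_)
open import Data.Integer.Base as ℤ using (ℤ; 0ℤ; 1ℤ; -1ℤ)
open import Data.List.Base as List
  using (List; []; _∷_; _++_; length; filter; allFin; cartesianProduct; cartesianProductWith)
open import Data.Nat.Base as ℕ using (ℕ; zero; suc; _+_; _∸_; _≤_; _<_; _>_)
import Data.Nat.Properties as ℕ
open import Data.Product.Base using (_×_; _,_)
open import Data.Sum.Base using (_⊎_)
open import Data.Vec.Base as Vec using (Vec; []; _∷_; _∷ʳ_; lookup)
open import Data.Vec.Relation.Unary.AllPairs using (allPairs?)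
open import Relation.Binary.PropositionalEquality.Core using (_≡_)
open import Relation.Nullary.Decidable using (Dec; yes; no; ¬?; _×-dec_; _⊎-dec_; _→-dec_)
open import Relation.Unary using (Decidable)

------------------------------------------------------------------------
-- Polynomials in t and z over ℤ

-- A polynomial is a finite formal sum of terms; (c , a , b) stands for
-- c tᵃ zᵇ.  Exponent pairs may repeat, so equality is _≈_ below, not _≡_.
Poly : Set
Poly = List (ℤ × ℕ × ℕ)

coeff : Poly → ℕ → ℕ → ℤ
coeff []                 a b = 0ℤ
coeff ((c , a′ , b′) ∷ p) a b with a′ ℕ.≟ a | b′ ℕ.≟ b
... | yes _ | yes _ = c ℤ.+ coeff p a b
... | _     | _     = coeff p a b

infix 4 _≈_
_≈_ : Poly → Poly → Set
p ≈ q = ∀ a b → coeff p a b ≡ coeff q a b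

infixl 7 _·_
_·_ : Poly → Poly → Poly
_·_ = cartesianProductWith λ (c , a , b) (c′ , a′ , b′) → c ℤ.* c′ , a + a′ , b + b′

const : ℤ → Poly
const c = (c , 0 , 0) ∷ []

t^_ z^_ : ℕ → Poly
t^ a = (1ℤ , a , 0) ∷ []
z^ b = (1ℤ , 0 , b) ∷ []

∑ : ∀ {A : Set} → List A → (A → Poly) → Poly
∑ xs f = List.concatMap f xs

-- The exponent may be a negative integer; only its parity matters.
[-1]^_ : ℤ → ℤ
[-1]^ d = -1ℤ ℤ.^ ℤ.∣ d ∣

------------------------------------------------------------------------
-- Enumeration and counting

count : ∀ {A : Set} {P : A → Set} → Decidable P → List A → ℕ
count P? xs = length (filter P? xs)

allVecs : ∀ {A : Set} → List A → ∀ n → List (Vec A n)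
allVecs xs zero    = [] ∷ []
allVecs xs (suc n) = cartesianProductWith _∷_ xs (allVecs xs n)

allSubsets : ∀ n → List (Subset n)
allSubsets = allVecs (false ∷ true ∷ [])

pairs : ∀ n → List (Fin n × Fin n)
pairs n = cartesianProduct (allFin n) (allFin n)

-- Words over Fin n; the letter l stands for the value suc (toℕ l) ∈ {1,…,n}.
Word : ℕ → Set
Word n = Vec (Fin n) n

permutations : ∀ n → List (Word n)
permutations n = filter (allPairs? λ i j → ¬? (i Fin.≟ j)) (allVecs (allFin n) n)

------------------------------------------------------------------------
-- Dyck paths

-- Lattice paths from (0,0) to (x,y) staying weakly above the diagonal.
-- The last step is outermost.  North steps preserve x ≤ y.
data Path : ℕ → ℕ → Set where
  start : Path 0 0
  north : ∀ {x y} → Path x y → Path x (suc y)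
  east  : ∀ {x y} → suc x ≤ y → Path x y → Path (suc x) y

Dyck : ℕ → Set
Dyck n = Path n n

easts : ∀ {x y} → Dec (suc x ≤ y) → List (Path x y) → List (Path (suc x) y)
easts (yes x<y) πs = List.map (east x<y) πs
easts (no  _)   πs = []

paths : ∀ x y → List (Path x y)
paths zero    zero    = start ∷ []
paths zero    (suc y) = List.map north (paths zero y)
paths (suc x) zero    = []
paths (suc x) (suc y) = List.map north (paths (suc x) y) ++
                        easts (suc x ℕ.≤? suc y) (paths x (suc y))

-- Vertical steps are indexed from bottom to top by Fin y.

columns : ∀ {x y} → Path x y → Vec ℕ y
columns start             = []
columns (north {x = x} π) = columns π ∷ʳ x
columns (east _ π)        = columns π

-- A north step from (x,y) to (x,y+1) has y ∸ x whole squares between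
-- it and the diagonal.
areaWord : ∀ {x y} → Path x y → Vec ℕ y
areaWord start                     = []
areaWord (north {x = x} {y = y} π) = areaWord π ∷ʳ (y ∸ x)
areaWord (east _ π)                = areaWord π

------------------------------------------------------------------------
-- Decorated standardly labelled Dyck paths

Triple : ℕ → Set
Triple n = Dyck n × Word n × Subset n

module _ {n : ℕ} (π : Dyck n) (w : Word n) where

  private
    a : Fin n → ℕ
    a = lookup (areaWord π)

  ColumnIncreasing : Set
  ColumnIncreasing = ∀ i j → i Fin.< j → lookup (columns π) i ≡ lookup (columns π) j →
                     lookup w i Fin.< lookup w j

  columnIncreasing? : Dec ColumnIncreasing
  columnIncreasing? = Fin.all? λ i → Fin.all? λ j →
    (i Fin.<? j) →-dec ((lookup (columns π) i ℕ.≟ lookup (columns π) j) →-dec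
    (lookup w i Fin.<? lookup w j))

  -- Indices are 0-based, so the first vertical step is excluded by 1 ≤ toℕ i.
  ContractibleValley : Fin n → Set
  ContractibleValley i = 1 ≤ toℕ i ×
    (a (pred i) > a i ⊎ (a (pred i) ≡ a i × lookup w (pred i) Fin.< lookup w i))

  contractibleValley? : Decidable ContractibleValley
  contractibleValley? i = (1 ℕ.≤? toℕ i) ×-dec
    ((a i ℕ.<? a (pred i)) ⊎-dec
     ((a (pred i) ℕ.≟ a i) ×-dec (lookup w (pred i) Fin.<? lookup w i)))

IsStLD : ∀ {n} → ℕ → Triple n → Set
IsStLD k (π , w , dv) =
  ColumnIncreasing π w × (∀ i → i ∈ dv → ContractibleValley π w i) × ∣ dv ∣ ≡ k

isStLD? : ∀ {n} k → Decidable (IsStLD {n} k)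
isStLD? k (π , w , dv) =
  columnIncreasing? π w ×-dec
  Fin.all? (λ i → (i ∈? dv) →-dec contractibleValley? π w i) ×-dec
  (∣ dv ∣ ℕ.≟ k)

stLD : ∀ n → ℕ → List (Triple n)
stLD n k = filter (isStLD? k)
  (cartesianProduct (paths n n) (cartesianProduct (permutations n) (allSubsets n)))

area : ∀ {n} → Triple n → ℕ
area (π , _ , _) = Vec.sum (areaWord π)

module _ {n : ℕ} (π : Dyck n) (w : Word n) (dv : Subset n) where

  private
    a : Fin n → ℕ
    a = lookup (areaWord π)

  PrimaryInv SecondaryInv : Fin n × Fin n → Set
  PrimaryInv   (i , j) = i Fin.< j × a i ≡ a j       × lookup w i Fin.< lookup w j × i ∉ dv
  SecondaryInv (i , j) = i Fin.< j × a i ≡ suc (a j) × lookup w i Fin.> lookup w j × i ∉ dv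

  primaryInv? : Decidable PrimaryInv
  primaryInv? (i , j) = (i Fin.<? j) ×-dec (a i ℕ.≟ a j) ×-dec
    (lookup w i Fin.<? lookup w j) ×-dec ¬? (i ∈? dv)

  secondaryInv? : Decidable SecondaryInv
  secondaryInv? (i , j) = (i Fin.<? j) ×-dec (a i ℕ.≟ suc (a j)) ×-dec
    (lookup w j Fin.<? lookup w i) ×-dec ¬? (i ∈? dv)

dinv : ∀ {n} → Triple n → ℤ
dinv {n} (π , w , dv) =
  (count (primaryInv? π w dv) (pairs n) + count (secondaryInv? π w dv) (pairs n)) ℤ.⊖ ∣ dv ∣

------------------------------------------------------------------------
-- Statistics on permutations

module _ {n : ℕ} (σ : Word n) where

  -- σ₀ σ₁ … σₙ with σ₀ = 0, so that positions 0,…,n are Fin (suc n).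
  extended : Vec ℕ (suc n)
  extended = 0 ∷ Vec.map (λ l → suc (toℕ l)) σ

  private
    s : Fin (suc n) → ℕ
    s = lookup extended

    -- σ_{i-1} and σ_{i-2}; only meaningful under the guard 2 ≤ toℕ i below,
    -- since pred zero = zero.
    s₁ s₂ : Fin (suc n) → ℕ
    s₁ i = s (pred i)
    s₂ i = s (pred (pred i))

  DoubleAscent DoubleDescent Peak Valley : Fin (suc n) → Set
  DoubleAscent  i = 2 ≤ toℕ i × s₂ i < s₁ i × s₁ i < s i
  DoubleDescent i = 2 ≤ toℕ i × s₂ i > s₁ i × s₁ i > s i
  Peak          i = 2 ≤ toℕ i × s₂ i < s₁ i × s₁ i > s i
  Valley        i = 2 ≤ toℕ i × s₂ i > s₁ i × s₁ i < s i

  doubleAscent? : Decidable DoubleAscent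
  doubleAscent? i = (2 ℕ.≤? toℕ i) ×-dec (s₂ i ℕ.<? s₁ i) ×-dec (s₁ i ℕ.<? s i)

  doubleDescent? : Decidable DoubleDescent
  doubleDescent? i = (2 ℕ.≤? toℕ i) ×-dec (s₁ i ℕ.<? s₂ i) ×-dec (s i ℕ.<? s₁ i)

  peak? : Decidable Peak
  peak? i = (2 ℕ.≤? toℕ i) ×-dec (s₂ i ℕ.<? s₁ i) ×-dec (s i ℕ.<? s₁ i)

  valley? : Decidable Valley
  valley? i = (2 ℕ.≤? toℕ i) ×-dec (s₁ i ℕ.<? s₂ i) ×-dec (s₁ i ℕ.<? s i)

  monot : ℕ
  monot = count (λ i → doubleAscent? i ⊎-dec doubleDescent? i) (allFin (suc n))

  ThreeInv : Fin (suc n) × Fin (suc n) → Set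
  ThreeInv (i , j) = 1 ≤ toℕ i × i Fin.< j ×
    (  (DoubleAscent j  × s₁ j < s i × s i < s j)
    ⊎ (DoubleDescent j × s₁ j > s i × s i > s j)
    ⊎ (Peak j          × s i > s j)
    ⊎ (Valley j        × s i < s j))

  threeInv? : Decidable ThreeInv
  threeInv? (i , j) = (1 ℕ.≤? toℕ i) ×-dec (i Fin.<? j) ×-dec
    (  (doubleAscent? j ×-dec (s₁ j ℕ.<? s i) ×-dec (s i ℕ.<? s j))
    ⊎-dec (doubleDescent? j ×-dec (s i ℕ.<? s₁ j) ×-dec (s j ℕ.<? s i))
    ⊎-dec (peak? j ×-dec (s j ℕ.<? s i))
    ⊎-dec (valley? j ×-dec (s i ℕ.<? s j)))

  inv₃ : ℕ
  inv₃ = count threeInv? (pairs (suc n))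

{-# OPTIONS --safe #-}
module Submission where

-- Insert the letters of a decorated labelled path one at a time, in the order
-- of the key (level, then decreasing label), where a decorated letter counts
-- as one level higher.  Each letter may be put exactly behind the undecorated
-- letters that precede it by less than one period (one level) in this order,
-- and consecutive choices change dinv by one.  Hence the signed sum over all
-- insertions is 1 if at every step the number of such letters is odd, and 0
-- otherwise.  The surviving orders are those in which each undecorated letter
-- lies within one period of the previous undecorated letter but more than one
-- period after the one before; the cyclic positions of the unused letters then
-- split into an allowed arc R₁ and its complement R₂, and only the sizes of
-- these arcs matter for the remaining choices.  Reading a permutation from
-- right to left, the unused letters split in the same way into those below and
-- those above the current letter, and the two recursions (Ψ) coincide.

-- Why a decorated letter counts one level higher: with this key every earlier letter may stand
-- behind the latest one, and deleting the latest letter leaves only admissible adjacencies. So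
-- every valid word arises from exactly one order of insertion, and area and number of decorations,
-- which depend only on the set of letters, are constant for each order. Why the insertions add up
-- to 0 or 1: moving the letter from one allowed gap to the next takes it past a single letter with
-- which its inversion status changes, so the signs alternate. The summand `-|dv|` of `dinv` makes
-- the sum +1 and not -1 when the letter is decorated and the number of gaps is odd. Survival of an
-- order is thus a parity condition at each step, and no sign-reversing involution on paths has to
-- be constructed. On the permutation side σ₀ = 0 forces the direction in which the reading ends;
-- for this reason the recursion is first refined by a direction there, and the two directions are
-- added afterwards.

open import Defs
open import Algebra.Structures using (IsCommutativeMonoid)
open import Data.Bool.Base using (Bool; true; false; not; if_then_else_)
import Data.Bool.Properties as Bool
open import Data.Empty using (⊥; ⊥-elim)
open import Data.Fin.Base as Fin using (Fin; zero; suc; toℕ; inject₁; fromℕ)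
import Data.Fin.Properties as Fin
open import Data.Fin.Relation.Unary.Top using (view; ‵fromℕ; ‵inject₁)
open import Data.Fin.Subset using (Subset; ∣_∣)
import Data.Fin.Subset.Properties as Subset
open import Data.Integer.Base as ℤ using (ℤ; 0ℤ; 1ℤ; -1ℤ)
import Data.Integer.Properties as ℤ
open import Data.Integer.Tactic.RingSolver using (solve-∀)
open import Data.List.Base as List using (List; []; _∷_; _++_; _∷ʳ_; _ʳ++_; map; concatMap; filter; length; reverse; deduplicate; cartesianProduct; allFin; tabulate; upTo; downFrom; applyUpTo; applyDownFrom)
import Data.List.Properties as List
import Data.List.Membership.DecPropositional as DecMembership
open import Data.List.Membership.Propositional using (_∈_; _∉_)
import Data.List.Membership.Propositional.Properties as ∈
open import Data.List.Membership.Propositional.Properties.WithK using (unique∧set⇒bag)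
open import Data.List.Relation.Binary.BagAndSetEquality using (∼bag⇒↭)
open import Data.List.Relation.Binary.Permutation.Propositional as ↭ using (_↭_)
import Data.List.Relation.Binary.Permutation.Propositional.Properties as ↭
import Data.List.Relation.Binary.Permutation.Setoid.Properties as ↭ₛ
open import Data.List.Relation.Unary.All as All using (All; []; _∷_)
import Data.List.Relation.Unary.All.Properties as All
open import Data.List.Relation.Unary.AllPairs as AllPairs using (AllPairs; []; _∷_)
import Data.List.Relation.Unary.AllPairs.Properties as AllPairs
open import Data.List.Relation.Unary.Any using (here; there)
open import Data.List.Relation.Unary.Linked as Linked using (Linked; []; [-]; _∷_)
import Data.List.Relation.Unary.Unique.DecPropositional.Properties as DecUnique
open import Data.List.Relation.Unary.Unique.Propositional using (Unique)
import Data.List.Relation.Unary.Unique.Propositional.Properties as Unique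
open import Data.Nat.Base as ℕ using (ℕ; zero; suc; _+_; _∸_; _≤_; _<_; _>_; s≤s; z≤n)
import Data.Nat.Properties as ℕ
open import Data.Nat.Tactic.RingSolver using () renaming (solve-∀ to ℕ-solve-∀)
open import Data.Product.Base using (_×_; _,_; proj₁; proj₂; ∃)
open import Data.Sum.Base using (_⊎_; inj₁; inj₂)
open import Data.Vec.Base as Vec using (Vec; []; _∷_; lookup)
import Data.Vec.Properties as Vec
import Data.Vec.Relation.Unary.AllPairs as Vec
import Data.Vec.Relation.Unary.AllPairs.Properties as VecAllPairs
import Data.Vec.Relation.Unary.Unique.Propositional.Properties as VecUnique
open import Function.Base using (_∘_; id; case_of_)
open import Function.Bundles using (mk⇔)
open import Relation.Binary.Definitions using (tri<; tri≈; tri>; DecidableEquality)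
open import Relation.Binary.PropositionalEquality
open import Relation.Nullary.Decidable using (Dec; yes; no; ¬?; map′; _×-dec_; _⊎-dec_)
open import Relation.Nullary.Negation using (¬_; contradiction)
open import Relation.Unary using (Decidable)

private variable
  A B C : Set

-- Finite sums and lists

module Sum {M : Set} {_∙_ : M → M → M} {ε : M} (cm : IsCommutativeMonoid _≡_ _∙_ ε) where
  open IsCommutativeMonoid cm using (identityˡ; assoc; comm)

  Σ[_] : List A → (A → M) → M
  Σ[ [] ]     f = ε
  Σ[ x ∷ xs ] f = f x ∙ Σ[ xs ] f

  Σ-cong : ∀ (xs : List A) {f g : A → M} → (∀ {x} → x ∈ xs → f x ≡ g x) → Σ[ xs ] f ≡ Σ[ xs ] g
  Σ-cong []       f≗g = refl
  Σ-cong (x ∷ xs) f≗g = cong₂ _∙_ (f≗g (here refl)) (Σ-cong xs (f≗g ∘ there))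

  Σ-ε : ∀ (xs : List A) → Σ[ xs ] (λ _ → ε) ≡ ε
  Σ-ε []       = refl
  Σ-ε (x ∷ xs) = trans (identityˡ _) (Σ-ε xs)

  Σ-++ : ∀ (xs ys : List A) {f : A → M} → Σ[ xs ++ ys ] f ≡ Σ[ xs ] f ∙ Σ[ ys ] f
  Σ-++ []       ys     = sym (identityˡ _)
  Σ-++ (x ∷ xs) ys {f} = trans (cong (f x ∙_) (Σ-++ xs ys)) (sym (assoc _ _ _))

  Σ-map : ∀ (h : A → B) xs {f : B → M} → Σ[ map h xs ] f ≡ Σ[ xs ] (f ∘ h)
  Σ-map h []           = refl
  Σ-map h (x ∷ xs) {f} = cong (f (h x) ∙_) (Σ-map h xs)

  Σ-concatMap : ∀ (h : A → List B) xs {f : B → M} → Σ[ concatMap h xs ] f ≡ Σ[ xs ] (λ x → Σ[ h x ] f)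
  Σ-concatMap h []           = refl
  Σ-concatMap h (x ∷ xs) {f} = trans (Σ-++ (h x) _) (cong (Σ[ h x ] f ∙_) (Σ-concatMap h xs))

  Σ-cartesianProduct : ∀ (xs : List A) (ys : List B) {f : A × B → M} →
    Σ[ cartesianProduct xs ys ] f ≡ Σ[ xs ] (λ x → Σ[ ys ] (λ y → f (x , y)))
  Σ-cartesianProduct []       ys     = refl
  Σ-cartesianProduct (x ∷ xs) ys {f} =
    trans (Σ-++ (map (x ,_) ys) _) (cong₂ _∙_ (Σ-map (x ,_) ys) (Σ-cartesianProduct xs ys))

  private
    interchange : ∀ a b c d → (a ∙ b) ∙ (c ∙ d) ≡ (a ∙ c) ∙ (b ∙ d)
    interchange a b c d = begin
      (a ∙ b) ∙ (c ∙ d) ≡⟨ assoc a b _ ⟩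
      a ∙ (b ∙ (c ∙ d)) ≡⟨ cong (a ∙_) (assoc b c d) ⟨
      a ∙ ((b ∙ c) ∙ d) ≡⟨ cong (λ x → a ∙ (x ∙ d)) (comm b c) ⟩
      a ∙ ((c ∙ b) ∙ d) ≡⟨ cong (a ∙_) (assoc c b d) ⟩
      a ∙ (c ∙ (b ∙ d)) ≡⟨ assoc a c _ ⟨
      (a ∙ c) ∙ (b ∙ d) ∎
      where open ≡-Reasoning

  Σ-∙ : ∀ (xs : List A) (f g : A → M) → Σ[ xs ] (λ x → f x ∙ g x) ≡ Σ[ xs ] f ∙ Σ[ xs ] g
  Σ-∙ []       f g = sym (identityˡ ε)
  Σ-∙ (x ∷ xs) f g = trans (cong ((f x ∙ g x) ∙_) (Σ-∙ xs f g)) (interchange _ _ _ _)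

  Σ-↭ : ∀ {xs ys : List A} (f : A → M) → xs ↭ ys → Σ[ xs ] f ≡ Σ[ ys ] f
  Σ-↭ f ↭.refl         = refl
  Σ-↭ f (↭.prep x p)   = cong (f x ∙_) (Σ-↭ f p)
  Σ-↭ f (↭.swap x y p) = trans (sym (assoc _ _ _))
    (trans (cong₂ _∙_ (comm (f x) (f y)) (Σ-↭ f p)) (assoc _ _ _))
  Σ-↭ f (↭.trans p q)  = trans (Σ-↭ f p) (Σ-↭ f q)

  Σ-filter : ∀ {P : A → Set} (P? : Decidable P) xs {f : A → M} →
             (∀ {x} → x ∈ xs → ¬ P x → f x ≡ ε) → Σ[ filter P? xs ] f ≡ Σ[ xs ] f
  Σ-filter P? []       vanish = refl
  Σ-filter P? (x ∷ xs) {f} vanish with P? x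
  ... | yes _  = cong (f x ∙_) (Σ-filter P? xs (vanish ∘ there))
  ... | no ¬px = trans (Σ-filter P? xs (vanish ∘ there))
                   (sym (trans (cong (_∙ Σ[ xs ] f) (vanish (here refl) ¬px)) (identityˡ _)))

  Σ-allFin-suc : ∀ n (f : Fin (suc n) → M) → Σ[ allFin (suc n) ] f ≡ f zero ∙ Σ[ allFin n ] (f ∘ suc)
  Σ-allFin-suc n f = cong (f zero ∙_)
    (trans (cong (λ is → Σ[ is ] f) (sym (List.map-tabulate id suc))) (Σ-map suc (allFin n)))

  Σ-tabulate : ∀ {n} (h : Fin n → A) (f : A → M) → Σ[ tabulate h ] f ≡ Σ[ allFin n ] (f ∘ h)
  Σ-tabulate {n = n} h f = trans (cong (λ xs → Σ[ xs ] f) (sym (List.map-tabulate id h))) (Σ-map h (allFin n))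

  -- Duplicate-free lists with the same members are permutations of each other, so two enumerations
  -- can be exchanged by proving soundness and completeness, without an explicit bijection.
  Σ-sameElements : ∀ {xs ys : List A} (f : A → M) → Unique xs → Unique ys →
                   (∀ {x} → x ∈ xs → x ∈ ys) → (∀ {x} → x ∈ ys → x ∈ xs) →
                   Σ[ xs ] f ≡ Σ[ ys ] f
  Σ-sameElements f uxs uys xs⊆ys ys⊆xs =
    Σ-↭ f (∼bag⇒↭ (unique∧set⇒bag uxs uys (mk⇔ xs⊆ys ys⊆xs)))

open Sum ℤ.+-0-isCommutativeMonoid
module ℕΣ = Sum ℕ.+-0-isCommutativeMonoid
module Π = Sum ℤ.*-1-isCommutativeMonoid

Σ-*ˡ : ∀ c (xs : List A) (f : A → ℤ) → Σ[ xs ] (λ x → c ℤ.* f x) ≡ c ℤ.* Σ[ xs ] f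
Σ-*ˡ c []       f = sym (ℤ.*-zeroʳ c)
Σ-*ˡ c (x ∷ xs) f = trans (cong (ℤ._+_ (c ℤ.* f x)) (Σ-*ˡ c xs f)) (sym (ℤ.*-distribˡ-+ c (f x) _))

Σ-*ʳ : ∀ c (xs : List A) (f : A → ℤ) → Σ[ xs ] (λ x → f x ℤ.* c) ≡ Σ[ xs ] f ℤ.* c
Σ-*ʳ c []       f = refl
Σ-*ʳ c (x ∷ xs) f = trans (cong (ℤ._+_ (f x ℤ.* c)) (Σ-*ʳ c xs f)) (sym (ℤ.*-distribʳ-+ c (f x) _))

∈-concatMap⁺ : ∀ (f : A → List B) {x xs y} → x ∈ xs → y ∈ f x → y ∈ concatMap f xs
∈-concatMap⁺ f x∈xs y∈fx = ∈.∈-concat⁺′ y∈fx (∈.∈-map⁺ f x∈xs)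

∈-concatMap⁻ : ∀ (f : A → List B) xs {y} → y ∈ concatMap f xs → ∃ λ x → x ∈ xs × y ∈ f x
∈-concatMap⁻ f xs y∈ with ∈.∈-concat⁻′ (map f xs) y∈
... | _ , y∈fx , fx∈ with ∈.∈-map⁻ f fx∈
... | x , x∈xs , refl = x , x∈xs , y∈fx

Unique-concatMap : ∀ (f : A → List B) {xs} → Unique xs → (∀ {x} → x ∈ xs → Unique (f x)) →
  (∀ {x x′ y} → x ∈ xs → x′ ∈ xs → y ∈ f x → y ∈ f x′ → x ≡ x′) → Unique (concatMap f xs)
Unique-concatMap f []         u d = []
Unique-concatMap f (x∉ ∷ uxs) u d =
  Unique.++⁺ (u (here refl))
    (Unique-concatMap f uxs (u ∘ there) (λ p q → d (there p) (there q)))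
    λ (y∈fx , y∈rest) → case ∈-concatMap⁻ f _ y∈rest of λ
      (x′ , x′∈ , y∈fx′) → All.lookup x∉ x′∈ (d (here refl) (there x′∈) y∈fx y∈fx′)

Unique-resp-↭ : ∀ {xs ys : List A} → xs ↭ ys → Unique xs → Unique ys
Unique-resp-↭ p = ↭ₛ.Unique-resp-↭ (setoid _) (↭.↭⇒↭ₛ p)

unique-⊆-length⇒↭ : ∀ {xs ys : List A} → Unique xs → (∀ {x} → x ∈ xs → x ∈ ys) →
                    length xs ≡ length ys → xs ↭ ys
unique-⊆-length⇒↭ {ys = []} [] xs⊆ys eq = ↭.refl
unique-⊆-length⇒↭ {xs = x ∷ xs} {ys} (x∉ ∷ u) xs⊆ys eq with ∈.∈-∃++ (xs⊆ys (here refl))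
... | as , bs , refl = ↭.trans (↭.prep x (unique-⊆-length⇒↭ u xs⊆ eq′)) (↭.↭-sym (↭.shift x as bs))
  where
  xs⊆ : ∀ {y} → y ∈ xs → y ∈ as ++ bs
  xs⊆ y∈ with ↭.∈-resp-↭ (↭.shift x as bs) (xs⊆ys (there y∈))
  ... | here refl = contradiction refl (All.lookup x∉ y∈)
  ... | there y∈′ = y∈′
  eq′ : length xs ≡ length (as ++ bs)
  eq′ = ℕ.suc-injective (trans eq (↭.↭-length (↭.shift x as bs)))

-- Cells and the insertion of the latest cell

⟦_⟧ : Dec A → ℤ
⟦ yes _ ⟧ = 1ℤ
⟦ no  _ ⟧ = 0ℤ

ε[_] : Dec A → ℤ
ε[ yes _ ] = -1ℤ
ε[ no  _ ] = 1ℤ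

-- The height is the level plus one, to make room for a sentinel at level −1
-- in front of every path.
record Cell : Set where
  constructor cell
  field
    height    : ℕ
    label     : ℕ
    decorated : Bool
open Cell

sentinel : Cell
sentinel = cell 0 0 false

-- A decorated letter of level ℓ may stand behind exactly the same letters as an undecorated letter
-- of level ℓ + 1 with the same label (compare the cases of `Follows`). The key of a decorated
-- letter is the height of that substitute.
key : Cell → ℕ
key (cell h _ false) = h
key (cell h _ true)  = suc h

infix 4 _≺_
_≺_ : Cell → Cell → Set
p ≺ e = key p < key e ⊎ (key p ≡ key e × label e < label p)

Follows : Cell → Cell → Set
Follows p q = height q < height p
            ⊎ (height q ≡ height p × (decorated q ≡ false ⊎ label p < label q))
            ⊎ (height q ≡ suc (height p) × decorated q ≡ false × label p < label q)

follows? : ∀ p q → Dec (Follows p q)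
follows? p q = (height q ℕ.<? height p)
  ⊎-dec ((height q ℕ.≟ height p) ×-dec ((decorated q Bool.≟ false) ⊎-dec (label p ℕ.<? label q)))
  ⊎-dec ((height q ℕ.≟ suc (height p)) ×-dec (decorated q Bool.≟ false) ×-dec (label p ℕ.<? label q))

-- p is undecorated and precedes e by less than one period; once inserted, e can
-- stand exactly behind such p.
Special : Cell → Cell → Set
Special p e = decorated p ≡ false ×
  ((height p ≡ key e × label e < label p) ⊎ (suc (height p) ≡ key e × label p < label e))

special? : ∀ p e → Dec (Special p e)
special? p e = (decorated p Bool.≟ false) ×-dec
  (((height p ℕ.≟ key e) ×-dec (label e ℕ.<? label p)) ⊎-dec
   ((suc (height p) ℕ.≟ key e) ×-dec (label p ℕ.<? label e)))

Inverted : Cell → Cell → Set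
Inverted p q = decorated p ≡ false ×
  ((height p ≡ height q × label p < label q) ⊎ (height p ≡ suc (height q) × label q < label p))

inverted? : ∀ p q → Dec (Inverted p q)
inverted? p q = (decorated p Bool.≟ false) ×-dec
  (((height p ℕ.≟ height q) ×-dec (label p ℕ.<? label q)) ⊎-dec
   ((height p ℕ.≟ suc (height q)) ×-dec (label q ℕ.<? label p)))

height≤key : ∀ p → height p ≤ key p
height≤key (cell h x false) = ℕ.≤-refl
height≤key (cell h x true)  = ℕ.n≤1+n h

-- Guarantees that only the letter in front of a gap decides whether the latest letter fits into it.
≺⇒follows : ∀ {q e} → q ≺ e → Follows e q
≺⇒follows {cell h x false} {cell k y false} (inj₁ h<k) = inj₁ h<k
≺⇒follows {cell h x false} {cell k y false} (inj₂ (refl , _)) = inj₂ (inj₁ (refl , inj₁ refl))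
≺⇒follows {cell h x true} {cell k y false} (inj₁ h<k) = inj₁ (ℕ.<-trans (ℕ.n<1+n h) h<k)
≺⇒follows {cell h x true} {cell k y false} (inj₂ (refl , _)) = inj₁ (ℕ.n<1+n h)
≺⇒follows {cell h x false} {cell k y true} (inj₁ (s≤s h≤k)) with ℕ.m≤n⇒m<n∨m≡n h≤k
... | inj₁ h<k  = inj₁ h<k
... | inj₂ refl = inj₂ (inj₁ (refl , inj₁ refl))
≺⇒follows {cell h x false} {cell k y true} (inj₂ (refl , y<x)) = inj₂ (inj₂ (refl , refl , y<x))
≺⇒follows {cell h x true} {cell k y true} (inj₁ (s≤s h<k)) = inj₁ h<k
≺⇒follows {cell h x true} {cell k y true} (inj₂ (refl , y<x)) = inj₂ (inj₁ (refl , inj₂ y<x))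

special⇒follows : ∀ {p e} → Special p e → Follows p e
special⇒follows {cell h x _} {cell k y false} (refl , inj₁ (refl , _))   = inj₂ (inj₁ (refl , inj₁ refl))
special⇒follows {cell h x _} {cell k y false} (refl , inj₂ (refl , x<y)) = inj₂ (inj₂ (refl , refl , x<y))
special⇒follows {cell h x _} {cell k y true}  (refl , inj₁ (refl , _))   = inj₁ (ℕ.n<1+n k)
special⇒follows {cell h x _} {cell k y true}  (refl , inj₂ (refl , x<y)) = inj₂ (inj₁ (refl , inj₂ x<y))

-- A decorated `p` that precedes `e` lies too low: its height is one below its key, and with equal
-- keys the labels compare the wrong way. For an undecorated `p`, preceding `e` and being close
-- enough to carry it leaves exactly the window of one period.
follows⇒special : ∀ {p e} → p ≺ e → Follows p e → Special p e
follows⇒special {p} {cell k y false} p≺e (inj₁ k<h) = ⊥-elim (case p≺e of λ where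
  (inj₁ lt)       → ℕ.<-asym k<h (ℕ.≤-<-trans (height≤key p) lt)
  (inj₂ (eq , _)) → ℕ.<-irrefl (sym eq) (ℕ.<-≤-trans k<h (height≤key p)))
follows⇒special {cell h x false} {cell k y false} (inj₁ lt) (inj₂ (inj₁ (refl , _))) = ⊥-elim (ℕ.<-irrefl refl lt)
follows⇒special {cell h x false} {cell k y false} (inj₂ (_ , y<x)) (inj₂ (inj₁ (refl , _))) = refl , inj₁ (refl , y<x)
follows⇒special {cell h x true} {cell k y false} (inj₁ lt) (inj₂ (inj₁ (refl , _))) = ⊥-elim (ℕ.<-asym lt (ℕ.n<1+n h))
follows⇒special {cell h x true} {cell k y false} (inj₂ (eq , _)) (inj₂ (inj₁ (refl , _))) = ⊥-elim (ℕ.1+n≢n eq)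
follows⇒special {cell h x false} {cell k y false} _ (inj₂ (inj₂ (refl , _ , x<y))) = refl , inj₂ (refl , x<y)
follows⇒special {cell h x true} {cell k y false} (inj₁ lt) (inj₂ (inj₂ (refl , _ , x<y))) = ⊥-elim (ℕ.<-irrefl refl lt)
follows⇒special {cell h x true} {cell k y false} (inj₂ (_ , y<x)) (inj₂ (inj₂ (refl , _ , x<y))) = ⊥-elim (ℕ.<-asym x<y y<x)
follows⇒special {cell h x false} {cell k y true} (inj₁ (s≤s h≤k)) (inj₁ k<h) = ⊥-elim (ℕ.<-irrefl refl (ℕ.<-≤-trans k<h h≤k))
follows⇒special {cell h x false} {cell k y true} (inj₂ (refl , y<x)) (inj₁ k<h) = refl , inj₁ (refl , y<x)
follows⇒special {cell h x true} {cell k y true} (inj₁ (s≤s h<k)) (inj₁ k<h) = ⊥-elim (ℕ.<-asym h<k k<h)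
follows⇒special {cell h x true} {cell k y true} (inj₂ (refl , y<x)) (inj₁ k<h) = ⊥-elim (ℕ.<-irrefl refl k<h)
follows⇒special {cell h x false} {cell k y true} _ (inj₂ (inj₁ (refl , inj₂ x<y))) = refl , inj₂ (refl , x<y)
follows⇒special {cell h x true} {cell k y true} (inj₁ lt) (inj₂ (inj₁ (refl , inj₂ x<y))) = ⊥-elim (ℕ.<-irrefl refl lt)
follows⇒special {cell h x true} {cell k y true} (inj₂ (_ , y<x)) (inj₂ (inj₁ (refl , inj₂ x<y))) = ⊥-elim (ℕ.<-asym x<y y<x)

-- Needed to delete the latest letter: inserting `e` can never repair a forbidden adjacency, so all
-- admissible words arise from admissible shorter ones.
special⇒follows-≺ : ∀ {p q e} → Special p e → q ≺ e → Follows p q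
special⇒follows-≺ {cell h x _} {cell j z false} {cell k y d} (refl , inj₁ (refl , _)) (inj₁ lt) = inj₁ lt
special⇒follows-≺ {cell h x _} {cell j z true} {cell k y d} (refl , inj₁ (refl , _)) (inj₁ lt) = inj₁ (ℕ.<-trans (ℕ.n<1+n j) lt)
special⇒follows-≺ {cell h x _} {cell j z false} {cell k y d} (refl , inj₁ (refl , _)) (inj₂ (refl , _)) = inj₂ (inj₁ (refl , inj₁ refl))
special⇒follows-≺ {cell h x _} {cell j z true} {cell k y d} (refl , inj₁ (eq , _)) (inj₂ (eq′ , _)) =
  inj₁ (ℕ.≤-reflexive (trans eq′ (sym eq)))
special⇒follows-≺ {cell h x _} {cell j z d′} {e} (refl , inj₂ (eq , x<y)) (inj₁ lt) rewrite sym eq =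
  case ℕ.m≤n⇒m<n∨m≡n (ℕ.≤-trans (height≤key (cell j z d′)) (ℕ.≤-pred lt)) of λ where
    (inj₁ j<h)  → inj₁ j<h
    (inj₂ refl) → inj₂ (inj₁ (refl , inj₁ (undecorated d′ lt)))
  where
  undecorated : ∀ d → key (cell j z d) < suc j → d ≡ false
  undecorated false _  = refl
  undecorated true  lt = ⊥-elim (ℕ.<-irrefl refl lt)
special⇒follows-≺ {cell h x _} {cell j z false} {e} (refl , inj₂ (eq , x<y)) (inj₂ (refl , y<z)) =
  inj₂ (inj₂ (sym eq , refl , ℕ.<-trans x<y y<z))
special⇒follows-≺ {cell h x _} {cell j z true} {e} (refl , inj₂ (eq , x<y)) (inj₂ (eq′ , y<z)) =
  inj₂ (inj₁ (ℕ.suc-injective (trans eq′ (sym eq)) , inj₂ (ℕ.<-trans x<y y<z)))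

-- For an undecorated `e` inserted last, only inversions with `e` on the left occur (see
-- `≺⇒¬inverted`), and they pair it with the special letters. For a decorated `e` it is the
-- opposite: `Inverted` forbids `e` on the left, and the special letters to its left count.
inverted⇒special : ∀ {p e} → decorated e ≡ false → p ≺ e → Inverted e p → Special p e
inverted⇒special {cell h x false} {cell k y _} refl _ (_ , inj₁ (refl , y<x)) = refl , inj₁ (refl , y<x)
inverted⇒special {cell h x true} {cell k y _} refl (inj₁ lt) (_ , inj₁ (refl , y<x)) = ⊥-elim (ℕ.<-asym lt (ℕ.n<1+n h))
inverted⇒special {cell h x true} {cell k y _} refl (inj₂ (eq , _)) (_ , inj₁ (refl , y<x)) = ⊥-elim (ℕ.1+n≢n eq)
inverted⇒special {cell h x false} {cell k y _} refl _ (_ , inj₂ (refl , x<y)) = refl , inj₂ (refl , x<y)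
inverted⇒special {cell h x true} {cell k y _} refl (inj₁ lt) (_ , inj₂ (refl , x<y)) = ⊥-elim (ℕ.<-irrefl refl lt)
inverted⇒special {cell h x true} {cell k y _} refl (inj₂ (_ , y<x)) (_ , inj₂ (refl , x<y)) = ⊥-elim (ℕ.<-asym x<y y<x)

special⇒inverted : ∀ {p e} → decorated e ≡ false → Special p e → Inverted e p
special⇒inverted {cell _ _ _} {cell _ _ _} refl (_ , inj₁ (eq , y<x)) = refl , inj₁ (sym eq , y<x)
special⇒inverted {cell _ _ _} {cell _ _ _} refl (_ , inj₂ (eq , x<y)) = refl , inj₂ (sym eq , x<y)

≺⇒¬inverted : ∀ {p e} → decorated e ≡ false → p ≺ e → ¬ Inverted p e
≺⇒¬inverted {cell _ _ _} {cell _ _ _} refl (inj₁ lt) (refl , inj₁ (refl , _)) = ℕ.<-irrefl refl lt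
≺⇒¬inverted {cell _ _ _} {cell _ _ _} refl (inj₂ (_ , y<x)) (refl , inj₁ (_ , x<y)) = ℕ.<-asym x<y y<x
≺⇒¬inverted {cell _ _ _} {cell _ _ _} refl (inj₁ lt) (refl , inj₂ (refl , _)) = ℕ.<-asym lt (ℕ.n<1+n _)
≺⇒¬inverted {cell _ _ _} {cell _ _ _} refl (inj₂ (eq , _)) (refl , inj₂ (refl , _)) = ℕ.1+n≢n eq

inverted⇒special-decorated : ∀ {p e} → decorated e ≡ true → Inverted p e → Special p e
inverted⇒special-decorated {cell _ _ _} {cell _ _ _} refl (dp , inj₁ (eq , lt)) = dp , inj₂ (cong suc eq , lt)
inverted⇒special-decorated {cell _ _ _} {cell _ _ _} refl (dp , inj₂ (eq , lt)) = dp , inj₁ (eq , lt)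

special⇒inverted-decorated : ∀ {p e} → decorated e ≡ true → Special p e → Inverted p e
special⇒inverted-decorated {cell _ _ _} {cell _ _ _} refl (dp , inj₂ (eq , lt)) = dp , inj₁ (ℕ.suc-injective eq , lt)
special⇒inverted-decorated {cell _ _ _} {cell _ _ _} refl (dp , inj₁ (eq , lt)) = dp , inj₂ (eq , lt)

ε-cong : (P? : Dec A) (Q? : Dec B) → (A → B) → (B → A) → ε[ P? ] ≡ ε[ Q? ]
ε-cong (yes p) (yes q) f g = refl
ε-cong (yes p) (no ¬q) f g = contradiction (f p) ¬q
ε-cong (no ¬p) (yes q) f g = contradiction (g q) ¬p
ε-cong (no ¬p) (no ¬q) f g = refl

ε-no : (P? : Dec A) → ¬ A → ε[ P? ] ≡ 1ℤ
ε-no (yes p) ¬p = contradiction p ¬p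
ε-no (no _)  ¬p = refl

⟦⟧-yes : (P? : Dec A) → A → ⟦ P? ⟧ ≡ 1ℤ
⟦⟧-yes (yes _) p = refl
⟦⟧-yes (no ¬p) p = contradiction p ¬p

⟦⟧-no : (P? : Dec A) → ¬ A → ⟦ P? ⟧ ≡ 0ℤ
⟦⟧-no (yes p) ¬p = contradiction p ¬p
⟦⟧-no (no _)  ¬p = refl

-- 1 if the number of special cells for e in s is odd, and 0 otherwise.
oddSpecials : Cell → List Cell → ℤ
oddSpecials e []      = 0ℤ
oddSpecials e (p ∷ s) = ⟦ special? p e ⟧ ℤ.+ ε[ special? p e ] ℤ.* oddSpecials e s

oddSpecials-special : ∀ {p e s o} → Special p e → oddSpecials e s ≡ o → oddSpecials e (p ∷ s) ≡ 1ℤ ℤ.+ -1ℤ ℤ.* o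
oddSpecials-special {p} {e} sp refl with special? p e
... | yes _  = refl
... | no ¬sp = contradiction sp ¬sp

oddSpecials-unspecial : ∀ {p e s o} → ¬ Special p e → oddSpecials e s ≡ o → oddSpecials e (p ∷ s) ≡ 0ℤ ℤ.+ 1ℤ ℤ.* o
oddSpecials-unspecial {p} {e} ¬sp refl with special? p e
... | yes sp = contradiction sp ¬sp
... | no _   = refl

decorationSign : Cell → ℤ
decorationSign c = if decorated c then -1ℤ else 1ℤ

admissible : Cell → List Cell → ℤ
admissible p []      = 1ℤ
admissible p (q ∷ _) = ⟦ follows? p q ⟧

-- The sign of `dinv` if all adjacencies are admissible and 0 otherwise, so that insertion sums can
-- run over all gaps.
weight : List Cell → ℤ
weight []      = 1ℤ
weight (p ∷ s) =
  admissible p s ℤ.* (decorationSign p ℤ.* Π.Σ[ s ] (λ q → ε[ inverted? p q ])) ℤ.* weight s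

insertAfter : Cell → List Cell → List (List Cell)
insertAfter e []      = []
insertAfter e (p ∷ s) = (p ∷ e ∷ s) ∷ map (p ∷_) (insertAfter e s)

insertAfter-↭ : ∀ {e} s {s′} → s′ ∈ insertAfter e s → s′ ↭ e ∷ s
insertAfter-↭ (p ∷ s) (here refl) = ↭.swap _ _ ↭.refl
insertAfter-↭ (p ∷ s) (there s′∈) with ∈.map∷⁻ s′∈
... | s″ , s″∈ , refl = ↭.trans (↭.prep p (insertAfter-↭ s s″∈)) (↭.swap _ _ ↭.refl)

insertAfter-admissible : ∀ {e} p s {s′} → s′ ∈ insertAfter e s → admissible p s′ ≡ admissible p s
insertAfter-admissible p (q ∷ s) (here refl) = refl
insertAfter-admissible p (q ∷ s) (there s′∈) with ∈.map∷⁻ s′∈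
... | _ , _ , refl = refl

-- For a parity `o`, `1 - 2o` is the sign `(-1)^o`; in this polynomial form the inductions reduce to
-- ring identities.
Π-special : ∀ e s → Π.Σ[ s ] (λ q → ε[ special? q e ]) ≡ 1ℤ ℤ.- (oddSpecials e s ℤ.+ oddSpecials e s)
Π-special e []      = refl
Π-special e (p ∷ s) with special? p e
... | yes _ rewrite Π-special e s = lemma (oddSpecials e s)
  where
  lemma : ∀ o → -1ℤ ℤ.* (1ℤ ℤ.- (o ℤ.+ o)) ≡ 1ℤ ℤ.- ((1ℤ ℤ.+ -1ℤ ℤ.* o) ℤ.+ (1ℤ ℤ.+ -1ℤ ℤ.* o))
  lemma = solve-∀
... | no _ rewrite Π-special e s = lemma (oddSpecials e s)
  where
  lemma : ∀ o → 1ℤ ℤ.* (1ℤ ℤ.- (o ℤ.+ o)) ≡ 1ℤ ℤ.- ((0ℤ ℤ.+ 1ℤ ℤ.* o) ℤ.+ (0ℤ ℤ.+ 1ℤ ℤ.* o))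
  lemma = solve-∀

inverted-sign-unspecial : ∀ {p e} → p ≺ e → ¬ Special p e → ε[ inverted? p e ] ≡ 1ℤ
inverted-sign-unspecial {p} {e@(cell _ _ false)} p≺e ¬sp = ε-no (inverted? p e) (≺⇒¬inverted {p} {e} refl p≺e)
inverted-sign-unspecial {p} {e@(cell _ _ true)}  p≺e ¬sp = ε-no (inverted? p e) (¬sp ∘ inverted⇒special-decorated {p} {e} refl)

-- The balance at one special letter `p`: the gap directly behind it against all later gaps. For an
-- undecorated `e` the first gap has the sign `(-1)^o = 1 - 2o`. For a decorated `e` both parts
-- carry the inversion of `p` with `e`, and the first also the sign of the decoration. Either way
-- the total is `1 - o`.
inverted-sign-special : ∀ {p e s} → p ≺ e → All (_≺ e) s → Special p e →
  ε[ inverted? p e ] ℤ.* (decorationSign e ℤ.* Π.Σ[ s ] (λ q → ε[ inverted? e q ]) ℤ.+ oddSpecials e s)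
    ≡ 1ℤ ℤ.- oddSpecials e s
inverted-sign-special {p} {e@(cell _ _ false)} {s} p≺e s≺e sp
  rewrite ε-no (inverted? p e) (≺⇒¬inverted {p} {e} refl p≺e)
        | Π.Σ-cong s {λ q → ε[ inverted? e q ]} {λ q → ε[ special? q e ]}
            (λ {q} q∈ → ε-cong (inverted? e q) (special? q e)
              (inverted⇒special {q} {e} refl (All.lookup s≺e q∈)) (special⇒inverted {q} {e} refl))
        | Π-special e s
  = lemma (oddSpecials e s)
  where
  lemma : ∀ o → 1ℤ ℤ.* (1ℤ ℤ.* (1ℤ ℤ.- (o ℤ.+ o)) ℤ.+ o) ≡ 1ℤ ℤ.- o
  lemma = solve-∀
inverted-sign-special {p} {e@(cell _ _ true)} {s} p≺e s≺e sp
  rewrite ε-cong (inverted? p e) (special? p e)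
            (inverted⇒special-decorated {p} {e} refl) (special⇒inverted-decorated {p} {e} refl)
        | Π.Σ-cong s {λ q → ε[ inverted? e q ]} {λ q → 1ℤ} (λ {q} q∈ → ε-no (inverted? e q) (λ ()))
        | Π.Σ-ε s
  with special? p e
... | yes _  = lemma (oddSpecials e s)
  where
  lemma : ∀ o → -1ℤ ℤ.* (-1ℤ ℤ.* 1ℤ ℤ.+ o) ≡ 1ℤ ℤ.- o
  lemma = solve-∀
... | no ¬sp = contradiction sp ¬sp

≺⇒admissible : ∀ {e} s → All (_≺ e) s → admissible e s ≡ 1ℤ
≺⇒admissible         []      _             = refl
≺⇒admissible {e} (q ∷ s) (q≺e ∷ _) = ⟦⟧-yes (follows? e q) (≺⇒follows {q} {e} q≺e)

special⇒admissible : ∀ {p e} s → All (_≺ e) s → Special p e → admissible p s ≡ 1ℤ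
special⇒admissible             []      _         sp = refl
special⇒admissible {p} {e} (q ∷ s) (q≺e ∷ _) sp = ⟦⟧-yes (follows? p q) (special⇒follows-≺ {p} {q} {e} sp q≺e)

-- From one allowed gap to the next, `e` crosses one special letter and one inversion changes, so
-- the signs alternate. Relative to `weight s`, an undecorated `e` has sign +1 in the last gap, and
-- a decorated one in the first, where the decoration cancels the only inversion of `e`. An
-- alternating sum with such an end is 1 for an odd number of gaps and 0 for an even number.
Σ-insertAfter : ∀ {e} s → All (_≺ e) s → Σ[ insertAfter e s ] weight ≡ oddSpecials e s ℤ.* weight s
Σ-insertAfter []          _             = refl
Σ-insertAfter {e} (p ∷ s) (p≺e ∷ s≺e) = begin
  weight (p ∷ e ∷ s) ℤ.+ Σ[ map (p ∷_) (insertAfter e s) ] weight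
    ≡⟨ cong₂ ℤ._+_
         (cong (λ a → f ℤ.* (d ℤ.* (i ℤ.* π)) ℤ.* (a ℤ.* k ℤ.* w)) (≺⇒admissible s s≺e))
         (trans (Σ-map (p ∷_) (insertAfter e s)) (trans
           (Σ-cong (insertAfter e s) (λ {s′} s′∈ → cong₂ (λ a b → a ℤ.* (d ℤ.* b) ℤ.* weight s′)
             (insertAfter-admissible p s s′∈) (Π.Σ-↭ _ (insertAfter-↭ s s′∈))))
           (trans (Σ-*ˡ (a ℤ.* (d ℤ.* (i ℤ.* π))) (insertAfter e s) weight)
                  (cong (a ℤ.* (d ℤ.* (i ℤ.* π)) ℤ.*_) (Σ-insertAfter s s≺e))))) ⟩
  f ℤ.* (d ℤ.* (i ℤ.* π)) ℤ.* (1ℤ ℤ.* k ℤ.* w) ℤ.+ a ℤ.* (d ℤ.* (i ℤ.* π)) ℤ.* (o ℤ.* w)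
    ≡⟨ finish ⟩
  oddSpecials e (p ∷ s) ℤ.* (a ℤ.* (d ℤ.* π) ℤ.* w) ∎
  where
  open ≡-Reasoning
  a d i π k w f o : ℤ
  a = admissible p s
  d = decorationSign p
  i = ε[ inverted? p e ]
  π = Π.Σ[ s ] (λ q → ε[ inverted? p q ])
  k = decorationSign e ℤ.* Π.Σ[ s ] (λ q → ε[ inverted? e q ])
  w = weight s
  f = ⟦ follows? p e ⟧
  o = oddSpecials e s
  finish : f ℤ.* (d ℤ.* (i ℤ.* π)) ℤ.* (1ℤ ℤ.* k ℤ.* w) ℤ.+ a ℤ.* (d ℤ.* (i ℤ.* π)) ℤ.* (o ℤ.* w)
         ≡ oddSpecials e (p ∷ s) ℤ.* (a ℤ.* (d ℤ.* π) ℤ.* w)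
  finish with special? p e
  ... | yes sp rewrite ⟦⟧-yes (follows? p e) (special⇒follows {p} {e} sp) | special⇒admissible {p} {e} s s≺e sp =
    trans (regroup d i π k w o)
      (trans (cong (λ x → x ℤ.* (d ℤ.* π ℤ.* w)) (inverted-sign-special {p} {e} p≺e s≺e sp)) (ungroup d π w o))
    where
    regroup : ∀ d i π k w o → 1ℤ ℤ.* (d ℤ.* (i ℤ.* π)) ℤ.* (1ℤ ℤ.* k ℤ.* w) ℤ.+ 1ℤ ℤ.* (d ℤ.* (i ℤ.* π)) ℤ.* (o ℤ.* w)
            ≡ i ℤ.* (k ℤ.+ o) ℤ.* (d ℤ.* π ℤ.* w)
    regroup = solve-∀
    ungroup : ∀ d π w o → (1ℤ ℤ.- o) ℤ.* (d ℤ.* π ℤ.* w) ≡ (1ℤ ℤ.+ -1ℤ ℤ.* o) ℤ.* (1ℤ ℤ.* (d ℤ.* π) ℤ.* w)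
    ungroup = solve-∀
  ... | no ¬sp rewrite ⟦⟧-no (follows? p e) (¬sp ∘ follows⇒special {p} {e} p≺e) | inverted-sign-unspecial {p} {e} p≺e ¬sp =
    regroup a d π k w o
    where
    regroup : ∀ a d π k w o → 0ℤ ℤ.* (d ℤ.* (1ℤ ℤ.* π)) ℤ.* (1ℤ ℤ.* k ℤ.* w) ℤ.+ a ℤ.* (d ℤ.* (1ℤ ℤ.* π)) ℤ.* (o ℤ.* w)
            ≡ (0ℤ ℤ.+ 1ℤ ℤ.* o) ℤ.* (a ℤ.* (d ℤ.* π) ℤ.* w)
    regroup = solve-∀

-- Words with a given order of insertion

arrangements : List Cell → List (List Cell)
arrangements []      = (sentinel ∷ []) ∷ []
arrangements (e ∷ h) = concatMap (insertAfter e) (arrangements h)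

oddProduct : List Cell → ℤ
oddProduct []      = 1ℤ
oddProduct (e ∷ h) = oddSpecials e (sentinel ∷ h) ℤ.* oddProduct h

infix 4 _≻_
_≻_ : Cell → Cell → Set
p ≻ q = q ≺ p

≺-irrefl : ∀ {p} → ¬ p ≺ p
≺-irrefl (inj₁ lt)       = ℕ.<-irrefl refl lt
≺-irrefl (inj₂ (_ , lt)) = ℕ.<-irrefl refl lt

Proper : Cell → Set
Proper c = 1 ≤ height c

sentinel≺ : ∀ {e} → Proper e → sentinel ≺ e
sentinel≺ {e} 1≤h = inj₁ (ℕ.≤-trans 1≤h (height≤key e))

-- Lets the factor for `e` leave the sum over the arrangements of the earlier letters.
oddSpecials-↭ : ∀ e {s s′} → s ↭ s′ → oddSpecials e s ≡ oddSpecials e s′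
oddSpecials-↭ e ↭.refl         = refl
oddSpecials-↭ e (↭.prep p r)   = cong (λ o → ⟦ special? p e ⟧ ℤ.+ ε[ special? p e ] ℤ.* o) (oddSpecials-↭ e r)
oddSpecials-↭ e (↭.trans r r′) = trans (oddSpecials-↭ e r) (oddSpecials-↭ e r′)
oddSpecials-↭ e (↭.swap {xs = s} p q r) rewrite sym (oddSpecials-↭ e r) with special? p e | special? q e
... | yes _ | yes _ = refl
... | no _  | no _  = refl
... | yes _ | no _  = lemma (oddSpecials e s)
  where
  lemma : ∀ o → 1ℤ ℤ.+ -1ℤ ℤ.* (0ℤ ℤ.+ 1ℤ ℤ.* o) ≡ 0ℤ ℤ.+ 1ℤ ℤ.* (1ℤ ℤ.+ -1ℤ ℤ.* o)
  lemma = solve-∀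
... | no _  | yes _ = lemma (oddSpecials e s)
  where
  lemma : ∀ o → 0ℤ ℤ.+ 1ℤ ℤ.* (1ℤ ℤ.+ -1ℤ ℤ.* o) ≡ 1ℤ ℤ.+ -1ℤ ℤ.* (0ℤ ℤ.+ 1ℤ ℤ.* o)
  lemma = solve-∀

∈-insertAfter : ∀ p as {e bs} → p ∷ as ++ e ∷ bs ∈ insertAfter e (p ∷ as ++ bs)
∈-insertAfter p []       = here refl
∈-insertAfter p (a ∷ as) = there (∈.∈-map⁺ (p ∷_) (∈-insertAfter a as))

∈-arrangements⁻ : ∀ h {s} → s ∈ arrangements h → ∃ λ s₀ → s ≡ sentinel ∷ s₀ × s₀ ↭ h
∈-arrangements⁻ []      (here refl) = [] , refl , ↭.refl
∈-arrangements⁻ (e ∷ h) s∈ with ∈-concatMap⁻ (insertAfter e) (arrangements h) s∈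
... | t , t∈ , s∈t with ∈-arrangements⁻ h t∈
∈-arrangements⁻ (e ∷ h) s∈ | _ , t∈ , here refl | t₀ , refl , t₀↭h = e ∷ t₀ , refl , ↭.prep e t₀↭h
∈-arrangements⁻ (e ∷ h) s∈ | _ , t∈ , there s∈t | t₀ , refl , t₀↭h with ∈.map∷⁻ s∈t
... | s₀ , s₀∈ , refl = s₀ , refl , ↭.trans (insertAfter-↭ t₀ s₀∈) (↭.prep e t₀↭h)

∈-arrangements⁺ : ∀ h {s₀} → s₀ ↭ h → sentinel ∷ s₀ ∈ arrangements h
∈-arrangements⁺ []      {s₀} s₀↭[] with ↭.↭-empty-inv s₀↭[]
... | refl = here refl
∈-arrangements⁺ (e ∷ h) s₀↭h with ∈.∈-∃++ (↭.∈-resp-↭ (↭.↭-sym s₀↭h) (here refl))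
... | as , bs , refl = ∈-concatMap⁺ (insertAfter e)
  (∈-arrangements⁺ h (↭.drop-mid as [] s₀↭h)) (∈-insertAfter sentinel as)

All-arrangements : ∀ {P : Cell → Set} {h s} → P sentinel → All P h → s ∈ arrangements h → All P s
All-arrangements {h = h} ps ph s∈ with ∈-arrangements⁻ h s∈
... | _ , refl , s₀↭h = ps ∷ ↭.All-resp-↭ (↭.↭-sym s₀↭h) ph

Σ-arrangements : ∀ h → All Proper h → AllPairs _≻_ h → Σ[ arrangements h ] weight ≡ oddProduct h
Σ-arrangements []      _        _          = refl
Σ-arrangements (e ∷ h) (pe ∷ ph) (e≻ ∷ sh) = begin
  Σ[ concatMap (insertAfter e) (arrangements h) ] weight
    ≡⟨ Σ-concatMap (insertAfter e) (arrangements h) ⟩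
  Σ[ arrangements h ] (λ s → Σ[ insertAfter e s ] weight)
    ≡⟨ Σ-cong (arrangements h) (λ {s} s∈ → trans
         (Σ-insertAfter s (All-arrangements (sentinel≺ {e} pe) e≻ s∈))
         (cong (ℤ._* weight s) (specials s∈))) ⟩
  Σ[ arrangements h ] (λ s → oddSpecials e (sentinel ∷ h) ℤ.* weight s)
    ≡⟨ Σ-*ˡ (oddSpecials e (sentinel ∷ h)) (arrangements h) weight ⟩
  oddSpecials e (sentinel ∷ h) ℤ.* Σ[ arrangements h ] weight
    ≡⟨ cong (oddSpecials e (sentinel ∷ h) ℤ.*_) (Σ-arrangements h ph sh) ⟩
  oddProduct (e ∷ h) ∎
  where
  open ≡-Reasoning
  specials : ∀ {s} → s ∈ arrangements h → oddSpecials e s ≡ oddSpecials e (sentinel ∷ h)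
  specials s∈ with ∈-arrangements⁻ h s∈
  ... | _ , refl , s₀↭h = oddSpecials-↭ e (↭.prep sentinel s₀↭h)

insertAfter-head : ∀ {e} t {q u} → q ∷ u ∈ insertAfter e t → q ∈ t
insertAfter-head (p ∷ t) (here refl) = here refl
insertAfter-head (p ∷ t) (there u∈) with ∈.map∷⁻ u∈
... | _ , _ , refl = here refl

Unique-insertAfter : ∀ {e} s → e ∉ s → Unique (insertAfter e s)
Unique-insertAfter []      e∉ = []
Unique-insertAfter {e} (p ∷ s) e∉ =
  All.tabulate (λ u∈ → λ where refl → case ∈.map∷⁻ u∈ of λ where
    (_ , v∈ , refl) → e∉ (there (insertAfter-head s v∈)))
  ∷ Unique.map⁺ List.∷-injectiveʳ (Unique-insertAfter s (e∉ ∘ there))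

-- Deleting `e` from `u` recovers the word into which it was inserted.
insertAfter-injective : ∀ {e} s s′ {u} → e ∉ s → e ∉ s′ → u ∈ insertAfter e s → u ∈ insertAfter e s′ → s ≡ s′
insertAfter-injective (p ∷ s) (p′ ∷ s′) e∉s e∉s′ (here refl) (here refl) = refl
insertAfter-injective (p ∷ s) (p′ ∷ s′) e∉s e∉s′ (here refl) (there u∈) with ∈.map∷⁻ u∈
... | _ , v∈ , refl = contradiction (there (insertAfter-head s′ v∈)) e∉s′
insertAfter-injective (p ∷ s) (p′ ∷ s′) e∉s e∉s′ (there u∈) (here refl) with ∈.map∷⁻ u∈
... | _ , v∈ , refl = contradiction (there (insertAfter-head s v∈)) e∉s
insertAfter-injective (p ∷ s) (p′ ∷ s′) e∉s e∉s′ (there u∈) (there u∈′) with ∈.map∷⁻ u∈ | ∈.map∷⁻ u∈′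
... | _ , v∈ , refl | _ , v∈′ , refl = cong (p ∷_) (insertAfter-injective s s′ (e∉s ∘ there) (e∉s′ ∘ there) v∈ v∈′)

Unique-arrangements : ∀ h → All Proper h → AllPairs _≻_ h → Unique (arrangements h)
Unique-arrangements []      _         _         = [] ∷ []
Unique-arrangements (e ∷ h) (pe ∷ ph) (e≻ ∷ sh) =
  Unique-concatMap (insertAfter e) (Unique-arrangements h ph sh)
    (λ s∈ → Unique-insertAfter _ (e∉ s∈))
    (λ s∈ s′∈ → insertAfter-injective _ _ (e∉ s∈) (e∉ s′∈))
  where
  e∉ : ∀ {s} → s ∈ arrangements h → e ∉ s
  e∉ s∈ e∈s = ≺-irrefl {e} (All.lookup (All-arrangements (sentinel≺ {e} pe) e≻ s∈) e∈s)

-- Surviving insertion orders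

splits : List A → List (List A × A × List A)
splits []       = []
splits (x ∷ xs) = ([] , x , xs) ∷ map (λ (as , y , bs) → x ∷ as , y , bs) (splits xs)

∈-splits⁻ : ∀ (xs : List A) {as y bs} → (as , y , bs) ∈ splits xs → xs ≡ as ++ y ∷ bs
∈-splits⁻ (x ∷ xs) (here refl) = refl
∈-splits⁻ (x ∷ xs) (there t∈) with ∈.∈-map⁻ _ t∈
... | _ , t∈′ , refl = cong (x ∷_) (∈-splits⁻ xs t∈′)

∈-splits⁺ : ∀ (as : List A) {y bs} → (as , y , bs) ∈ splits (as ++ y ∷ bs)
∈-splits⁺ []       = here refl
∈-splits⁺ (a ∷ as) = there (∈.∈-map⁺ _ (∈-splits⁺ as))

map-pivot-splits : ∀ (xs : List A) → map (λ (_ , y , _) → y) (splits xs) ≡ xs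
map-pivot-splits []       = refl
map-pivot-splits (x ∷ xs) = cong (x ∷_) (trans (sym (List.map-∘ (splits xs))) (map-pivot-splits xs))

Unique-map-injective : ∀ (f : A → B) {xs x y} → Unique (map f xs) → x ∈ xs → y ∈ xs → f x ≡ f y → x ≡ y
Unique-map-injective f (_ ∷ _)   (here refl) (here refl) _  = refl
Unique-map-injective f (fx∉ ∷ _) (here refl) (there y∈)  eq = contradiction eq (All.lookup fx∉ (∈.∈-map⁺ f y∈))
Unique-map-injective f (fy∉ ∷ _) (there x∈)  (here refl) eq = contradiction (sym eq) (All.lookup fy∉ (∈.∈-map⁺ f x∈))
Unique-map-injective f (_ ∷ u)   (there x∈)  (there y∈)  eq = Unique-map-injective f u x∈ y∈ eq

Unique-splits : ∀ {xs : List A} → Unique xs → Unique (splits xs)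
Unique-splits {xs = xs} u = Unique.map⁻ (subst Unique (sym (map-pivot-splits xs)) u)

splits-injective : ∀ {xs : List A} {s t} → Unique xs → s ∈ splits xs → t ∈ splits xs →
                   proj₁ (proj₂ s) ≡ proj₁ (proj₂ t) → s ≡ t
splits-injective {xs = xs} u =
  Unique-map-injective (λ (_ , y , _) → y) (subst Unique (sym (map-pivot-splits xs)) u)

AllPairs-++⁻ : ∀ {R : A → A → Set} xs {ys} → AllPairs R (xs ++ ys) →
               AllPairs R xs × AllPairs R ys × All (λ x → All (R x) ys) xs
AllPairs-++⁻ []       rs       = [] , rs , []
AllPairs-++⁻ (x ∷ xs) (r ∷ rs) with AllPairs-++⁻ xs rs
... | rs₁ , rs₂ , cross = All.++⁻ˡ xs r ∷ rs₁ , rs₂ , All.++⁻ʳ xs r ∷ cross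

-- Positions and periods

Position : Set
Position = ℕ × ℕ

infix 4 _◁_
_◁_ : Position → Position → Set
(k , x) ◁ (k′ , x′) = k < k′ ⊎ (k ≡ k′ × x′ < x)

position : Cell → Position
position c = key c , label c

shift : Position → Position
shift (k , x) = suc k , x

◁-trans : ∀ {p q r} → p ◁ q → q ◁ r → p ◁ r
◁-trans (inj₁ a)          (inj₁ b)          = inj₁ (ℕ.<-trans a b)
◁-trans (inj₁ a)          (inj₂ (refl , _)) = inj₁ a
◁-trans (inj₂ (refl , _)) (inj₁ b)          = inj₁ b
◁-trans (inj₂ (refl , a)) (inj₂ (refl , b)) = inj₂ (refl , ℕ.<-trans b a)

◁-irrefl : ∀ {p} → ¬ p ◁ p
◁-irrefl (inj₁ a)       = ℕ.<-irrefl refl a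
◁-irrefl (inj₂ (_ , a)) = ℕ.<-irrefl refl a

◁-asym : ∀ {p q} → p ◁ q → ¬ q ◁ p
◁-asym p q = ◁-irrefl (◁-trans p q)

shift-◁ : ∀ {p q} → p ◁ q → shift p ◁ shift q
shift-◁ (inj₁ a)          = inj₁ (s≤s a)
shift-◁ (inj₂ (refl , a)) = inj₂ (refl , a)

-- The pair (ℓ , x) is the place, within the current period, of an unused
-- label x: it can be taken decorated at level ℓ or undecorated at level suc ℓ.
Candidate : Set
Candidate = ℕ × ℕ

decor plain : Candidate → Cell
decor (ℓ , x) = cell (suc ℓ) x true
plain (ℓ , x) = cell (suc (suc ℓ)) x false

-- `decor c` and `plain c` both have this position, by computation.
place : Candidate → Position
place (ℓ , x) = suc (suc ℓ) , x

raise : Candidate → Candidate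
raise (ℓ , x) = suc ℓ , x

-- `R₁` is the arc on which the next letter meets an odd number of special letters. The labels
-- passed over, `X`, come round again one level later, behind `R₂`. A decorated choice changes no
-- parity, so the rest `Y` of the arc stays allowed. An undecorated choice adds a special letter:
-- `Y` becomes even and waits for the next turn, while `R₂` and the raised `X` become the allowed
-- arc.
histories : ℕ → List Cell → List Candidate → List Candidate → List (List Cell)
histories zero    h R₁ R₂ = h ∷ []
histories (suc m) h R₁ R₂ = concatMap
  (λ (X , e , Y) → histories m (decor e ∷ h) Y (R₂ ++ map raise X) ++
                   histories m (plain e ∷ h) (R₂ ++ map raise X) (map raise Y))
  (splits R₁)

record Invariant (h : List Cell) (α β : Position) (R₁ R₂ : List Candidate) : Set where
  field
    α◁β      : α ◁ β
    β◁shiftα : β ◁ shift α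
    R₁>α     : All (λ c → α ◁ place c) R₁
    R₁<β     : All (λ c → place c ◁ β) R₁
    R₂>β     : All (λ c → β ◁ place c) R₂
    R₂<α     : All (λ c → place c ◁ shift α) R₂
    sorted₁  : AllPairs (λ c c′ → place c ◁ place c′) R₁
    sorted₂  : AllPairs (λ c c′ → place c ◁ place c′) R₂
    past     : ∀ {f} → α ◁ position f → All (_≺ f) h
    odd      : ∀ {f} → α ◁ position f → position f ◁ β → oddSpecials f (sentinel ∷ h) ≡ 1ℤ
    even     : ∀ {f} → β ◁ position f → oddSpecials f (sentinel ∷ h) ≡ 0ℤ
    even′    : ∀ {f} → All (_≺ f) h → position f ◁ α → oddSpecials f (sentinel ∷ h) ≡ 0ℤ

special-plain⁺ : ∀ c {f} → place c ◁ position f → position f ◁ shift (place c) → Special (plain c) f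
special-plain⁺ c (inj₂ (eq , lt)) _ = refl , inj₁ (eq , lt)
special-plain⁺ c (inj₁ lt) (inj₂ (eq , lt′)) = refl , inj₂ (sym eq , lt′)
special-plain⁺ c (inj₁ lt) (inj₁ lt′) = ⊥-elim (ℕ.<-irrefl refl (ℕ.<-≤-trans lt (ℕ.≤-pred lt′)))

special-plain⁻ : ∀ c {f} → Special (plain c) f → position f ◁ shift (place c)
special-plain⁻ c (_ , inj₁ (eq , lt)) = inj₁ (s≤s (ℕ.≤-reflexive (sym eq)))
special-plain⁻ c (_ , inj₂ (eq , lt)) = inj₂ (sym eq , lt)

oddSpecials-swap : ∀ c h f → oddSpecials f (sentinel ∷ c ∷ h) ≡ oddSpecials f (c ∷ sentinel ∷ h)
oddSpecials-swap c h f = oddSpecials-↭ f {sentinel ∷ c ∷ h} {c ∷ sentinel ∷ h} (↭.swap _ _ ↭.refl)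

oddSpecials-plain-yes : ∀ c h {f o} → place c ◁ position f → position f ◁ shift (place c) →
  oddSpecials f (sentinel ∷ h) ≡ o → oddSpecials f (sentinel ∷ plain c ∷ h) ≡ 1ℤ ℤ.+ -1ℤ ℤ.* o
oddSpecials-plain-yes c h {f} lt lt′ eq = trans (oddSpecials-swap (plain c) h f)
  (oddSpecials-special {plain c} {f} {sentinel ∷ h} (special-plain⁺ c {f} lt lt′) eq)

oddSpecials-plain-no : ∀ c h {f o} → shift (place c) ◁ position f →
  oddSpecials f (sentinel ∷ h) ≡ o → oddSpecials f (sentinel ∷ plain c ∷ h) ≡ 0ℤ ℤ.+ 1ℤ ℤ.* o
oddSpecials-plain-no c h {f} lt eq = trans (oddSpecials-swap (plain c) h f)
  (oddSpecials-unspecial {plain c} {f} {sentinel ∷ h} (λ sp → ◁-asym lt (special-plain⁻ c {f} sp)) eq)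

oddSpecials-decor : ∀ c h {f o} →
  oddSpecials f (sentinel ∷ h) ≡ o → oddSpecials f (sentinel ∷ decor c ∷ h) ≡ 0ℤ ℤ.+ 1ℤ ℤ.* o
oddSpecials-decor c h {f} eq = trans (oddSpecials-swap (decor c) h f)
  (oddSpecials-unspecial {decor c} {f} {sentinel ∷ h} (λ ()) eq)

module Step {h α β X e Y R₂} (inv : Invariant h α β (X ++ e ∷ Y) R₂) where
  open Invariant inv

  α◁e : α ◁ place e
  α◁e = All.head (All.++⁻ʳ X R₁>α)

  e◁β : place e ◁ β
  e◁β = All.head (All.++⁻ʳ X R₁<β)

  private
    X<e : All (λ c → place c ◁ place e) X
    X<e = All.map All.head (proj₂ (proj₂ (AllPairs-++⁻ X sorted₁)))

    X>α : All (λ c → α ◁ place c) X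
    X>α = All.++⁻ˡ X R₁>α

    e∷Y : AllPairs (λ c c′ → place c ◁ place c′) (e ∷ Y)
    e∷Y = proj₁ (proj₂ (AllPairs-++⁻ X sorted₁))

    shiftα◁shifte : shift α ◁ shift (place e)
    shiftα◁shifte = shift-◁ α◁e

    β◁shifte : β ◁ shift (place e)
    β◁shifte = ◁-trans β◁shiftα shiftα◁shifte

    rest>β : All (λ c → β ◁ place c) (R₂ ++ map raise X)
    rest>β = All.++⁺ R₂>β (All.map⁺ (All.map (◁-trans β◁shiftα ∘ shift-◁) X>α))

    rest<e : All (λ c → place c ◁ shift (place e)) (R₂ ++ map raise X)
    rest<e = All.++⁺ (All.map (λ lt → ◁-trans lt shiftα◁shifte) R₂<α) (All.map⁺ (All.map shift-◁ X<e))

    raise-sorted : ∀ {Z} → AllPairs (λ c c′ → place c ◁ place c′) Z →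
                   AllPairs (λ c c′ → place c ◁ place c′) (map raise Z)
    raise-sorted = AllPairs.map⁺ ∘ AllPairs.map shift-◁

    rest-sorted : AllPairs (λ c c′ → place c ◁ place c′) (R₂ ++ map raise X)
    rest-sorted = AllPairs.++⁺ sorted₂ (raise-sorted (proj₁ (AllPairs-++⁻ X sorted₁)))
      (All.map (λ lt → All.map⁺ (All.map (λ α◁c → ◁-trans lt (shift-◁ α◁c)) X>α)) R₂<α)

  -- A decorated letter is never special, so all parities persist and only the start of the arc
  -- moves up to `e`.
  decorate : Invariant (decor e ∷ h) (place e) β Y (R₂ ++ map raise X)
  decorate = record
    { α◁β      = e◁β
    ; β◁shiftα = β◁shifte
    ; R₁>α     = AllPairs.head e∷Y
    ; R₁<β     = All.tail (All.++⁻ʳ X R₁<β)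
    ; R₂>β     = rest>β
    ; R₂<α     = rest<e
    ; sorted₁  = AllPairs.tail e∷Y
    ; sorted₂  = rest-sorted
    ; past     = λ {f} e◁f → e◁f ∷ past {f} (◁-trans α◁e e◁f)
    ; odd      = λ {f} e◁f f◁β → oddSpecials-decor e h {f} (odd {f} (◁-trans α◁e e◁f) f◁β)
    ; even     = λ {f} β◁f → oddSpecials-decor e h {f} (even {f} β◁f)
    -- Vacuous: a letter later than `e` cannot lie before the new `α`, which is the place of `e`.
    ; even′    = λ { (e≺f ∷ _) f◁e → contradiction e≺f (◁-asym f◁e) }
    }

  -- Between `e` and `β` the new letter joins an odd number of special letters, which becomes even;
  -- beyond `β` it joins an even number until its own period ends at `shift (place e)`. So the new
  -- allowed arc begins at `β`.
  undecorate : Invariant (plain e ∷ h) β (shift (place e)) (R₂ ++ map raise X) (map raise Y)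
  undecorate = record
    { α◁β      = β◁shifte
    ; β◁shiftα = shift-◁ e◁β
    ; R₁>α     = rest>β
    ; R₁<β     = rest<e
    ; R₂>β     = All.map⁺ (All.map shift-◁ (AllPairs.head e∷Y))
    ; R₂<α     = All.map⁺ (All.map shift-◁ (All.tail (All.++⁻ʳ X R₁<β)))
    ; sorted₁  = rest-sorted
    ; sorted₂  = raise-sorted (AllPairs.tail e∷Y)
    ; past     = λ {f} β◁f → ◁-trans e◁β β◁f ∷ past {f} (◁-trans α◁β β◁f)
    ; odd      = λ {f} β◁f f◁e → oddSpecials-plain-yes e h {f} (◁-trans e◁β β◁f) f◁e (even {f} β◁f)
    ; even     = λ {f} e◁f → oddSpecials-plain-no e h {f} e◁f (even {f} (◁-trans β◁shifte e◁f))
    ; even′    = λ { {f} (e≺f ∷ _) f◁β →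
        oddSpecials-plain-yes e h {f} e≺f (◁-trans f◁β β◁shifte) (odd {f} (◁-trans α◁e e≺f) f◁β) }
    }

oddProduct-∷ : ∀ e h {o p} → oddSpecials e (sentinel ∷ h) ≡ o → oddProduct h ≡ p → oddProduct (e ∷ h) ≡ o ℤ.* p
oddProduct-∷ e h refl refl = refl

histories-good : ∀ m h R₁ R₂ {α β hh} → Invariant h α β R₁ R₂ → hh ∈ histories m h R₁ R₂ →
  oddProduct h ≡ 1ℤ → All Proper h → AllPairs _≻_ h →
  oddProduct hh ≡ 1ℤ × All Proper hh × AllPairs _≻_ hh
histories-good zero    h R₁ R₂ inv (here refl) o p s = o , p , s
histories-good (suc m) h R₁ R₂ inv hh∈ o p s with ∈-concatMap⁻ _ (splits R₁) hh∈
... | (X , e , Y) , t∈ , hh∈′ with refl ← ∈-splits⁻ R₁ t∈ = case ∈.∈-++⁻ (histories m _ _ _) hh∈′ of λ where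
    (inj₁ hh∈″) → histories-good m _ _ _ decorate hh∈″
      (oddProduct-∷ (decor e) h (odd {decor e} α◁e e◁β) o) (s≤s z≤n ∷ p) (past {decor e} α◁e ∷ s)
    (inj₂ hh∈″) → histories-good m _ _ _ undecorate hh∈″
      (oddProduct-∷ (plain e) h (odd {plain e} α◁e e◁β) o) (s≤s z≤n ∷ p) (past {plain e} α◁e ∷ s)
  where
  open Invariant inv
  open Step {X = X} {Y = Y} inv

labels : List Cell → List ℕ
labels = map label

candidateLabels : List Candidate → List ℕ
candidateLabels = map proj₂

candidateLabels-raise : ∀ X → candidateLabels (map raise X) ≡ candidateLabels X
candidateLabels-raise X = sym (List.map-∘ X)

private
  decor-labels : ∀ X e Y R₂ → candidateLabels ((X ++ e ∷ Y) ++ R₂) ↭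
                              proj₂ e ∷ candidateLabels (Y ++ R₂ ++ map raise X)
  decor-labels X e Y R₂ = begin
    candidateLabels ((X ++ e ∷ Y) ++ R₂)
      ≡⟨ cong candidateLabels (List.++-assoc X (e ∷ Y) R₂) ⟩
    candidateLabels (X ++ e ∷ Y ++ R₂)
      ↭⟨ ↭.map⁺ proj₂ (↭.++-comm X (e ∷ Y ++ R₂)) ⟩
    candidateLabels (e ∷ (Y ++ R₂) ++ X)
      ≡⟨ cong candidateLabels (cong (e ∷_) (List.++-assoc Y R₂ X)) ⟩
    candidateLabels (e ∷ Y ++ R₂ ++ X)
      ≡⟨ cong (proj₂ e ∷_) (raised X) ⟩
    proj₂ e ∷ candidateLabels (Y ++ R₂ ++ map raise X) ∎
    where
    open ↭.PermutationReasoning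
    raised : ∀ X → candidateLabels (Y ++ R₂ ++ X) ≡ candidateLabels (Y ++ R₂ ++ map raise X)
    raised X rewrite List.map-++ proj₂ Y (R₂ ++ X) | List.map-++ proj₂ Y (R₂ ++ map raise X)
                   | List.map-++ proj₂ R₂ X | List.map-++ proj₂ R₂ (map raise X)
                   | candidateLabels-raise X = refl

  plain-labels : ∀ X e Y R₂ → candidateLabels ((X ++ e ∷ Y) ++ R₂) ↭
                              proj₂ e ∷ candidateLabels ((R₂ ++ map raise X) ++ map raise Y)
  plain-labels X e Y R₂ = ↭.trans (decor-labels X e Y R₂) (↭.prep (proj₂ e) (begin
    candidateLabels (Y ++ R₂ ++ map raise X)
      ↭⟨ ↭.map⁺ proj₂ (↭.++-comm Y (R₂ ++ map raise X)) ⟩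
    candidateLabels ((R₂ ++ map raise X) ++ Y)
      ≡⟨ List.map-++ proj₂ (R₂ ++ map raise X) Y ⟩
    candidateLabels (R₂ ++ map raise X) ++ candidateLabels Y
      ≡⟨ cong (candidateLabels (R₂ ++ map raise X) ++_) (candidateLabels-raise Y) ⟨
    candidateLabels (R₂ ++ map raise X) ++ candidateLabels (map raise Y)
      ≡⟨ List.map-++ proj₂ (R₂ ++ map raise X) (map raise Y) ⟨
    candidateLabels ((R₂ ++ map raise X) ++ map raise Y) ∎))
    where open ↭.PermutationReasoning

  length-candidates : ∀ {R S : List Candidate} {x m} → candidateLabels R ↭ x ∷ candidateLabels S →
                      length R ≡ suc m → length S ≡ m
  length-candidates {R} {S} p eq = ℕ.suc-injective (trans (cong suc (sym (List.length-map proj₂ S)))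
    (trans (sym (↭.↭-length p)) (trans (List.length-map proj₂ R) eq)))

histories-labels : ∀ m h R₁ R₂ {hh} → length (R₁ ++ R₂) ≡ m → hh ∈ histories m h R₁ R₂ →
                   labels hh ↭ candidateLabels (R₁ ++ R₂) ++ labels h
histories-labels zero    h []      []      eq (here refl) = ↭.refl
histories-labels (suc m) h R₁ R₂ eq hh∈ with ∈-concatMap⁻ _ (splits R₁) hh∈
... | (X , e , Y) , t∈ , hh∈′ with refl ← ∈-splits⁻ R₁ t∈ = case ∈.∈-++⁻ (histories m _ _ _) hh∈′ of λ where
    (inj₁ hh∈″) → step (decor-labels X e Y R₂)
      (histories-labels m _ Y (R₂ ++ map raise X) (length-candidates (decor-labels X e Y R₂) eq) hh∈″)
    (inj₂ hh∈″) → step (plain-labels X e Y R₂)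
      (histories-labels m _ (R₂ ++ map raise X) (map raise Y) (length-candidates (plain-labels X e Y R₂) eq) hh∈″)
  where
  step : ∀ {R S x hh} → candidateLabels R ↭ x ∷ candidateLabels S →
         labels hh ↭ candidateLabels S ++ x ∷ labels h → labels hh ↭ candidateLabels R ++ labels h
  step {R} {S} {x} p q = ↭.trans q (↭.trans (↭.shift x (candidateLabels S) (labels h))
    (↭.++⁺ʳ (labels h) (↭.↭-sym p)))

oddProduct-ʳ++ : ∀ rest h → oddProduct h ≡ 0ℤ → oddProduct (rest ʳ++ h) ≡ 0ℤ
oddProduct-ʳ++ []         h eq = eq
oddProduct-ʳ++ (e ∷ rest) h eq =
  oddProduct-ʳ++ rest (e ∷ h) (trans (oddProduct-∷ e h refl eq) (ℤ.*-zeroʳ (oddSpecials e (sentinel ∷ h))))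

AllPairs-ʳ++⁻ : ∀ {R : Cell → Cell → Set} rest {h} → AllPairs R (rest ʳ++ h) → AllPairs R h
AllPairs-ʳ++⁻ []         rs = rs
AllPairs-ʳ++⁻ (e ∷ rest) rs = AllPairs.tail (AllPairs-ʳ++⁻ rest rs)

-- `rest` is in order of insertion and `h` has the latest letter first, whence `ʳ++`. The label of
-- the next letter has a place on the current turn. With a smaller key than there, the letter lies
-- before `α`; with a larger key it lies beyond `shift α` and so beyond `β`; at a place of `R₂` it
-- lies beyond `β` as well. In all three cases the number of special letters is even, and the factor
-- 0 kills the product.
histories-complete : ∀ m h R₁ R₂ rest {α β} → Invariant h α β R₁ R₂ → length (R₁ ++ R₂) ≡ m →
  labels rest ↭ candidateLabels (R₁ ++ R₂) → AllPairs _≻_ (rest ʳ++ h) →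
  rest ʳ++ h ∈ histories m h R₁ R₂ ⊎ oddProduct (rest ʳ++ h) ≡ 0ℤ
histories-complete zero    h []      []      [] inv eq p s = inj₁ (here refl)
histories-complete zero    h []      []      (_ ∷ _) inv eq p s = contradiction p ↭.¬x∷xs↭[]
histories-complete (suc m) h R₁ R₂ [] inv eq p s =
  contradiction (trans (↭.↭-length p) (trans (List.length-map proj₂ (R₁ ++ R₂)) eq)) λ ()
histories-complete (suc m) h R₁ R₂ (f ∷ rest) {α} {β} inv eq p s
  with ∈.∈-map⁻ proj₂ (↭.∈-resp-↭ p (here refl))
... | c , c∈ , labelf with ℕ.<-cmp (key f) (suc (suc (proj₁ c)))
... | tri< key< _ _ = inj₂ (oddProduct-ʳ++ rest (f ∷ h)
        (oddProduct-∷ f h (Invariant.even′ inv {f} (AllPairs.head (AllPairs-ʳ++⁻ rest s)) f◁α) refl))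
  where
  c<α : place c ◁ shift α
  c<α = case ∈.∈-++⁻ R₁ c∈ of λ where
    (inj₁ c∈₁) → ◁-trans (All.lookup (Invariant.R₁<β inv) c∈₁) (Invariant.β◁shiftα inv)
    (inj₂ c∈₂) → All.lookup (Invariant.R₂<α inv) c∈₂
  -- With the same label and a smaller key, `f` lies at least a full period before `place c`, which
  -- in turn lies before `shift α`.
  f◁α : position f ◁ α
  f◁α = case c<α of λ where
    (inj₁ lt)       → inj₁ (ℕ.<-≤-trans key< (ℕ.≤-pred lt))
    (inj₂ (eq , lt)) → case ℕ.m≤n⇒m<n∨m≡n (ℕ.≤-pred (subst (key f <_) eq key<)) of λ where
      (inj₁ lt′) → inj₁ lt′
      (inj₂ eq′) → inj₂ (eq′ , subst (proj₂ α <_) (sym labelf) lt)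
... | tri> _ _ key> = inj₂ (oddProduct-ʳ++ rest (f ∷ h)
        (oddProduct-∷ f h (Invariant.even inv {f} (◁-trans (Invariant.β◁shiftα inv) α◁f)) refl))
  where
  α◁c : α ◁ place c
  α◁c = case ∈.∈-++⁻ R₁ c∈ of λ where
    (inj₁ c∈₁) → All.lookup (Invariant.R₁>α inv) c∈₁
    (inj₂ c∈₂) → ◁-trans (Invariant.α◁β inv) (All.lookup (Invariant.R₂>β inv) c∈₂)
  α◁f : shift α ◁ position f
  α◁f = case α◁c of λ where
    (inj₁ lt)       → inj₁ (ℕ.≤-<-trans lt key>)
    (inj₂ (eq , lt)) → case ℕ.m≤n⇒m<n∨m≡n (subst (λ k → suc k ≤ key f) (sym eq) key>) of λ where
      (inj₁ lt′) → inj₁ lt′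
      (inj₂ eq′) → inj₂ (eq′ , subst (_< proj₂ α) (sym labelf) lt)
... | tri≈ _ key≡ _ with ∈.∈-++⁻ R₁ c∈
... | inj₂ c∈₂ = inj₂ (oddProduct-ʳ++ rest (f ∷ h)
        (oddProduct-∷ f h (Invariant.even inv {f} β◁f) refl))
  where
  β◁f : β ◁ position f
  β◁f = subst (β ◁_) (cong₂ _,_ (sym key≡) (sym labelf)) (All.lookup (Invariant.R₂>β inv) c∈₂)
... | inj₁ c∈₁ with ∈.∈-∃++ c∈₁
... | X , Y , refl = generated f key≡ labelf p s
  where
  open Step {X = X} {Y = Y} inv
  continue : ∀ {f S} → labels (f ∷ rest) ↭ candidateLabels ((X ++ c ∷ Y) ++ R₂) → label f ≡ proj₂ c →
             candidateLabels ((X ++ c ∷ Y) ++ R₂) ↭ proj₂ c ∷ candidateLabels S → labels rest ↭ candidateLabels S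
  continue p refl q = ↭.drop-∷ (↭.trans p q)
  generated : ∀ f → key f ≡ suc (suc (proj₁ c)) → label f ≡ proj₂ c →
    labels (f ∷ rest) ↭ candidateLabels ((X ++ c ∷ Y) ++ R₂) → AllPairs _≻_ (rest ʳ++ (f ∷ h)) →
    rest ʳ++ (f ∷ h) ∈ histories (suc m) h (X ++ c ∷ Y) R₂ ⊎ oddProduct (rest ʳ++ (f ∷ h)) ≡ 0ℤ
  generated f@(cell _ _ false) refl refl p s =
    case histories-complete m (f ∷ h) (R₂ ++ map raise X) (map raise Y) rest undecorate
           (length-candidates (plain-labels X c Y R₂) eq) (continue {f} p refl (plain-labels X c Y R₂)) s of λ where
      (inj₁ hh∈) → inj₁ (∈-concatMap⁺ _ (∈-splits⁺ X) (∈.∈-++⁺ʳ (histories m _ _ _) hh∈))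
      (inj₂ z) → inj₂ z
  generated f@(cell _ _ true) refl refl p s =
    case histories-complete m (f ∷ h) Y (R₂ ++ map raise X) rest decorate
           (length-candidates (decor-labels X c Y R₂) eq) (continue {f} p refl (decor-labels X c Y R₂)) s of λ where
      (inj₁ hh∈) → inj₁ (∈-concatMap⁺ _ (∈-splits⁺ X) (∈.∈-++⁺ˡ hh∈))
      (inj₂ z) → inj₂ z

histories-extend : ∀ m h R₁ R₂ {hh} → hh ∈ histories m h R₁ R₂ → ∃ λ u → length u ≡ m × hh ≡ u ++ h
histories-extend zero    h R₁ R₂ (here refl) = [] , refl , refl
histories-extend (suc m) h R₁ R₂ hh∈ with ∈-concatMap⁻ _ (splits R₁) hh∈
... | (X , e , Y) , _ , hh∈′ = case ∈.∈-++⁻ (histories m _ _ _) hh∈′ of λ where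
    (inj₁ hh∈″) → snoc _ (histories-extend m _ _ _ hh∈″)
    (inj₂ hh∈″) → snoc _ (histories-extend m _ _ _ hh∈″)
  where
  snoc : ∀ c {hh} → (∃ λ u → length u ≡ m × hh ≡ u ++ c ∷ h) → ∃ λ u → length u ≡ suc m × hh ≡ u ++ h
  snoc c (u , eq , refl) = u ∷ʳ c , trans (List.length-++ u) (trans (ℕ.+-comm _ 1) (cong suc eq)) ,
                           sym (List.++-assoc u (c ∷ []) h)

-- Both runs put equally many letters in front, so the next letter sits at the same distance from
-- the end of the result.
histories-next : ∀ m m′ h {c c′ R₁ R₂ R₁′ R₂′ hh} → m ≡ m′ →
  hh ∈ histories m (c ∷ h) R₁ R₂ → hh ∈ histories m′ (c′ ∷ h) R₁′ R₂′ → c ≡ c′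
histories-next m m′ h refl hh∈ hh∈′
  with histories-extend m _ _ _ hh∈ | histories-extend m′ _ _ _ hh∈′
... | u , lu , refl | u′ , lu′ , eq = List.∷-injectiveˡ (drop-≡ u u′ (trans lu (sym lu′)) eq)
  where
  drop-≡ : ∀ (u u′ : List Cell) {v v′} → length u ≡ length u′ → u ++ v ≡ u′ ++ v′ → v ≡ v′
  drop-≡ []      []        _  eq = eq
  drop-≡ (_ ∷ u) (_ ∷ u′) le eq = drop-≡ u u′ (ℕ.suc-injective le) (List.∷-injectiveʳ eq)

Unique-histories : ∀ m h R₁ R₂ → Unique (candidateLabels (R₁ ++ R₂)) → Unique (histories m h R₁ R₂)
Unique-histories zero    h R₁ R₂ u = [] ∷ []
Unique-histories (suc m) h R₁ R₂ u = Unique-concatMap _ (Unique-splits unique₁)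
  (λ { {X , e , Y} t∈ → Unique.++⁺
    (Unique-histories m _ _ _ (reduce t∈ (λ { refl → decor-labels X e Y R₂ })))
    (Unique-histories m _ _ _ (reduce t∈ (λ { refl → plain-labels X e Y R₂ })))
    λ { (hh∈ , hh∈′) → case histories-next m m h refl hh∈ hh∈′ of λ () } })
  (λ { {X , e , Y} {X′ , e′ , Y′} t∈ t∈′ hh∈ hh∈′ → splits-injective unique₁ t∈ t∈′
    (case ∈.∈-++⁻ (histories m _ _ _) hh∈ , ∈.∈-++⁻ (histories m _ _ _) hh∈′ of λ where
      (inj₁ a , inj₁ b) → same-decor (histories-next m m h refl a b)
      (inj₁ a , inj₂ b) → case histories-next m m h refl a b of λ ()
      (inj₂ a , inj₁ b) → case histories-next m m h refl a b of λ ()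
      (inj₂ a , inj₂ b) → same-plain (histories-next m m h refl a b)) })
  where
  unique₁ : Unique R₁
  unique₁ = proj₁ (AllPairs-++⁻ R₁ (Unique.map⁻ u))
  reduce : ∀ {X e Y S} → (X , e , Y) ∈ splits R₁ →
           (R₁ ≡ X ++ e ∷ Y → candidateLabels (R₁ ++ R₂) ↭ proj₂ e ∷ candidateLabels S) → Unique (candidateLabels S)
  reduce t∈ p = AllPairs.tail (Unique-resp-↭ (p (∈-splits⁻ R₁ t∈)) u)
  same-decor : ∀ {e e′} → decor e ≡ decor e′ → e ≡ e′
  same-decor refl = refl
  same-plain : ∀ {e e′} → plain e ≡ plain e′ → e ≡ e′
  same-plain refl = refl

-- The common recursion

bump : ℕ × ℕ → ℕ × ℕ
bump (i , j) = suc i , j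

-- The pairs `(i , j)` with `i + j + 1 = a`: the possible sizes of the two sides of a pivot.
cuts : ℕ → List (ℕ × ℕ)
cuts zero    = []
cuts (suc a) = (0 , a) ∷ map bump (cuts a)

sizes : List A × A × List A → ℕ × ℕ
sizes (as , _ , bs) = length as , length bs

map-sizes-splits : ∀ (xs : List A) → map sizes (splits xs) ≡ cuts (length xs)
map-sizes-splits []       = refl
map-sizes-splits (x ∷ xs) = cong ((0 , length xs) ∷_) (begin
  map sizes (map (λ (as , y , bs) → x ∷ as , y , bs) (splits xs)) ≡⟨ List.map-∘ (splits xs) ⟨
  map (λ t → suc (proj₁ (sizes t)) , proj₂ (sizes t)) (splits xs) ≡⟨ List.map-∘ (splits xs) ⟩
  map bump (map sizes (splits xs))              ≡⟨ cong (map bump) (map-sizes-splits xs) ⟩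
  map bump (cuts (length xs))                   ∎)
  where open ≡-Reasoning

Σ-splits : ∀ (xs : List A) (g : List A × A × List A → ℤ) (f : ℕ × ℕ → ℤ) →
  (∀ {t} → t ∈ splits xs → g t ≡ f (sizes t)) → Σ[ splits xs ] g ≡ Σ[ cuts (length xs) ] f
Σ-splits xs g f g≗f = trans (Σ-cong (splits xs) g≗f)
  (trans (sym (Σ-map sizes (splits xs))) (cong (λ l → Σ[ l ] f) (map-sizes-splits xs)))

Σ-cuts-swap : ∀ a (f : ℕ × ℕ → ℤ) → Σ[ cuts a ] f ≡ Σ[ cuts a ] (λ (i , j) → f (j , i))
Σ-cuts-swap zero    f = refl
Σ-cuts-swap (suc a) f = begin
  f (0 , a) ℤ.+ Σ[ map bump (cuts a) ] f
    ≡⟨ snoc a f ⟩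
  Σ[ cuts a ] (λ (i , j) → f (i , suc j)) ℤ.+ f (a , 0)
    ≡⟨ cong (ℤ._+ f (a , 0)) (Σ-cuts-swap a (λ (i , j) → f (i , suc j))) ⟩
  Σ[ cuts a ] (λ (i , j) → f (j , suc i)) ℤ.+ f (a , 0)
    ≡⟨ ℤ.+-comm _ (f (a , 0)) ⟩
  f (a , 0) ℤ.+ Σ[ cuts a ] (λ (i , j) → f (j , suc i))
    ≡⟨ cong (ℤ._+_ (f (a , 0))) (Σ-map bump (cuts a)) ⟨
  f (a , 0) ℤ.+ Σ[ map bump (cuts a) ] (λ (i , j) → f (j , i)) ∎
  where
  open ≡-Reasoning
  snoc : ∀ a f → Σ[ cuts (suc a) ] f ≡ Σ[ cuts a ] (λ (i , j) → f (i , suc j)) ℤ.+ f (a , 0)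
  snoc zero    f = ℤ.+-comm (f (0 , 0)) 0ℤ
  snoc (suc a) f = begin
    f (0 , suc a) ℤ.+ Σ[ map bump (cuts (suc a)) ] f
      ≡⟨ cong (ℤ._+_ (f (0 , suc a))) (trans (Σ-map bump (cuts (suc a)) {f}) (snoc a (λ (i , j) → f (suc i , j)))) ⟩
    f (0 , suc a) ℤ.+ (Σ[ cuts a ] (λ (i , j) → f (suc i , suc j)) ℤ.+ f (suc a , 0))
      ≡⟨ ℤ.+-assoc (f (0 , suc a)) _ _ ⟨
    f (0 , suc a) ℤ.+ Σ[ cuts a ] (λ (i , j) → f (suc i , suc j)) ℤ.+ f (suc a , 0)
      ≡⟨ cong (λ x → f (0 , suc a) ℤ.+ x ℤ.+ f (suc a , 0)) (Σ-map bump (cuts a) {λ (i , j) → f (i , suc j)}) ⟨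
    Σ[ cuts (suc a) ] (λ (i , j) → f (i , suc j)) ℤ.+ f (suc a , 0) ∎

-- A polynomial is represented by the
-- functional sending ω to its value with each monomial tᵃ zᵇ replaced by ω a b.
Ψ : ℕ → ℕ → ℕ → (ℕ → ℕ → ℤ) → ℤ
Ψ zero    a b ω = ω 0 0
Ψ (suc m) a b ω = Σ[ cuts a ] λ (i , j) →
  Ψ m j (b + i) (λ p q → ω (i + p) (suc q)) ℤ.+ Ψ m (b + i) j (λ p q → ω (suc (i + j) + p) q)

Ψ-cong : ∀ m {a a′ b b′ ω ω′} → a ≡ a′ → b ≡ b′ → (∀ p q → ω p q ≡ ω′ p q) → Ψ m a b ω ≡ Ψ m a′ b′ ω′
Ψ-cong zero            refl refl ω≗ω′ = ω≗ω′ 0 0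
Ψ-cong (suc m) {a} {b = b} refl refl ω≗ω′ = Σ-cong (cuts a) λ _ → cong₂ ℤ._+_
  (Ψ-cong m refl refl (λ p q → ω≗ω′ _ _)) (Ψ-cong m refl refl (λ p q → ω≗ω′ _ _))

cellArea decorations : Cell → ℕ
cellArea c = ℕ.pred (height c)
decorations c = if decorated c then 1 else 0

totalArea totalDecorations : List Cell → ℕ
totalArea s        = ℕΣ.Σ[ s ] cellArea
totalDecorations s = ℕΣ.Σ[ s ] decorations

totalLevel : List Candidate → ℕ
totalLevel R = ℕΣ.Σ[ R ] proj₁

totalLevel-raise : ∀ X → totalLevel (map raise X) ≡ length X + totalLevel X
totalLevel-raise []            = refl
totalLevel-raise ((ℓ , _) ∷ X) = trans (cong (suc ℓ +_) (totalLevel-raise X)) (lemma ℓ (length X) (totalLevel X))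
  where
  lemma : ∀ a b c → suc a + (b + c) ≡ suc b + (a + c)
  lemma = ℕ-solve-∀

totalLevel-++ : ∀ X Y → totalLevel (X ++ Y) ≡ totalLevel X + totalLevel Y
totalLevel-++ X Y = ℕΣ.Σ-++ X Y

Σ-histories : ∀ m h R₁ R₂ (ω : ℕ → ℕ → ℤ) → length R₁ + length R₂ ≡ m →
  Σ[ histories m h R₁ R₂ ] (λ hh → ω (totalArea hh) (totalDecorations hh)) ≡
  Ψ m (length R₁) (length R₂)
    (λ p q → ω (p + (totalLevel R₁ + totalLevel R₂) + totalArea h) (q + totalDecorations h))
Σ-histories zero    h [] [] ω eq = ℤ.+-identityʳ _
Σ-histories (suc m) h R₁ R₂ ω eq = begin
  Σ[ histories (suc m) h R₁ R₂ ] (λ hh → ω (totalArea hh) (totalDecorations hh))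
    ≡⟨ Σ-concatMap _ (splits R₁) ⟩
  Σ[ splits R₁ ] (λ (X , e , Y) → Σ[ histories m (decor e ∷ h) Y (R₂ ++ map raise X) ++
                                     histories m (plain e ∷ h) (R₂ ++ map raise X) (map raise Y) ]
                                    (λ hh → ω (totalArea hh) (totalDecorations hh)))
    ≡⟨ Σ-splits R₁ _ _ (λ { {X , e , Y} t∈ → split X e Y (∈-splits⁻ R₁ t∈) }) ⟩
  Ψ (suc m) (length R₁) (length R₂)
    (λ p q → ω (p + (totalLevel R₁ + totalLevel R₂) + totalArea h) (q + totalDecorations h)) ∎
  where
  open ≡-Reasoning
  split : ∀ X e Y → R₁ ≡ X ++ e ∷ Y →
    Σ[ histories m (decor e ∷ h) Y (R₂ ++ map raise X) ++
       histories m (plain e ∷ h) (R₂ ++ map raise X) (map raise Y) ]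
      (λ hh → ω (totalArea hh) (totalDecorations hh)) ≡
    Ψ m (length Y) (length R₂ + length X)
      (λ p q → ω (length X + p + (totalLevel R₁ + totalLevel R₂) + totalArea h) (suc q + totalDecorations h)) ℤ.+
    Ψ m (length R₂ + length X) (length Y)
      (λ p q → ω (suc (length X + length Y) + p + (totalLevel R₁ + totalLevel R₂) + totalArea h)
                 (q + totalDecorations h))
  split X e Y refl = trans (Σ-++ (histories m _ Y _) _) (cong₂ ℤ._+_
    (trans (Σ-histories m _ Y _ ω (trans (cong (length Y +_) length-rest) (trans (lemma₁ (length Y) (length R₂) (length X)) size)))
      (Ψ-cong m refl length-rest (λ p q → cong₂ ω (decor-level p) (ℕ.+-suc q (totalDecorations h)))))
    (trans (Σ-histories m _ _ (map raise Y) ω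
             (trans (cong₂ _+_ length-rest (List.length-map raise Y)) (trans (lemma₂ (length Y) (length R₂) (length X)) size)))
      (Ψ-cong m length-rest (List.length-map raise Y)
        (λ p q → cong (λ x → ω x (q + totalDecorations h)) (plain-level p)))))
    where
    length-rest : length (R₂ ++ map raise X) ≡ length R₂ + length X
    length-rest = trans (List.length-++ R₂) (cong (length R₂ +_) (List.length-map raise X))
    size : length X + length Y + length R₂ ≡ m
    size = ℕ.suc-injective (trans (cong (_+ length R₂) (sym (ℕ.+-suc (length X) (length Y))))
      (trans (cong (_+ length R₂) (sym (List.length-++ X))) eq))
    lemma₁ : ∀ y r x → y + (r + x) ≡ x + y + r
    lemma₁ = ℕ-solve-∀
    lemma₂ : ∀ y r x → (r + x) + y ≡ x + y + r
    lemma₂ = ℕ-solve-∀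
    level-rest : totalLevel (R₂ ++ map raise X) ≡ totalLevel R₂ + (length X + totalLevel X)
    level-rest = trans (totalLevel-++ R₂ _) (cong (totalLevel R₂ +_) (totalLevel-raise X))
    decor-level : ∀ p → p + (totalLevel Y + totalLevel (R₂ ++ map raise X)) + (proj₁ e + totalArea h)
      ≡ length X + p + (totalLevel (X ++ e ∷ Y) + totalLevel R₂) + totalArea h
    decor-level p rewrite level-rest | totalLevel-++ X (e ∷ Y) =
      lemma p (totalLevel Y) (totalLevel R₂) (length X) (totalLevel X) (proj₁ e) (totalArea h)
      where
      lemma : ∀ p y r l x e h → p + (y + (r + (l + x))) + (e + h) ≡ l + p + (x + (e + y) + r) + h
      lemma = ℕ-solve-∀
    plain-level : ∀ p → p + (totalLevel (R₂ ++ map raise X) + totalLevel (map raise Y)) + (suc (proj₁ e) + totalArea h)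
      ≡ suc (length X + length Y) + p + (totalLevel (X ++ e ∷ Y) + totalLevel R₂) + totalArea h
    plain-level p rewrite level-rest | totalLevel-++ X (e ∷ Y) | totalLevel-raise Y =
      lemma p (totalLevel Y) (totalLevel R₂) (length X) (totalLevel X) (proj₁ e) (totalArea h) (length Y)
      where
      lemma : ∀ p y r l x e h k → p + ((r + (l + x)) + (k + y)) + (suc e + h) ≡ suc (l + k) + p + (x + (e + y) + r) + h
      lemma = ℕ-solve-∀

-- The signed count of valid words

-- Decreasing, since of two letters with equal keys the one with the larger label comes first.
standardLabels : ℕ → List ℕ
standardLabels = applyDownFrom suc

base : ℕ → Candidate
base x = 0 , x

bottom : ℕ → Cell
bottom x = cell 1 x false

startingWith : ℕ → List ℕ × ℕ × List ℕ → List (List Cell)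
startingWith m (X , x , Y) = histories m (bottom x ∷ []) (map base X) (map base Y)

allHistories : ℕ → List (List Cell)
allHistories m = concatMap (startingWith m) (splits (standardLabels (suc m)))

standardLabels-descending : ∀ n → AllPairs _>_ (standardLabels n)
standardLabels-descending n = AllPairs.applyDownFrom⁺₁ suc n (λ j<i _ → s≤s j<i)

standardLabels-positive : ∀ n → All (0 <_) (standardLabels n)
standardLabels-positive n = All.applyDownFrom⁺₂ suc n (λ _ → s≤s z≤n)

standardLabels-unique : ∀ n → Unique (standardLabels n)
standardLabels-unique n = AllPairs.map (λ gt eq → ℕ.<-irrefl (sym eq) gt) (standardLabels-descending n)

-- The two constants are the shifts of the positions `(0 , 0)` of the sentinel and `(1 , x)` of the
-- bottom letter. At key 2 the larger labels come before the period of `x` ends and the smaller ones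
-- after it, so `X` is the allowed arc.
bottom-invariant : ∀ {m} X x Y → standardLabels (suc m) ≡ X ++ x ∷ Y →
  Invariant (bottom x ∷ []) (1 , 0) (2 , x) (map base X) (map base Y)
bottom-invariant {m} X x Y eq with AllPairs-++⁻ X (subst (AllPairs _>_) eq (standardLabels-descending (suc m)))
... | X> , x>Y ∷ Y> , X>xY = record
  { α◁β      = inj₁ ℕ.≤-refl
  ; β◁shiftα = inj₂ (refl , All.head positive)
  ; R₁>α     = All.map⁺ (All.tabulate (λ _ → inj₁ ℕ.≤-refl))
  ; R₁<β     = All.map⁺ (All.map (λ gt → inj₂ (refl , All.head gt)) X>xY)
  ; R₂>β     = All.map⁺ (All.map (λ gt → inj₂ (refl , gt)) x>Y)
  ; R₂<α     = All.map⁺ (All.map (λ gt → inj₂ (refl , gt)) (All.tail positive))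
  ; sorted₁  = AllPairs.map⁺ (AllPairs.map (λ gt → inj₂ (refl , gt)) X>)
  ; sorted₂  = AllPairs.map⁺ (AllPairs.map (λ gt → inj₂ (refl , gt)) Y>)
  ; past     = λ { (inj₁ lt) → inj₁ lt ∷ [] }
  ; odd      = λ {f} → odd {f}
  ; even     = λ {f} → even {f}
  ; even′    = λ {f} → even′ {f}
  }
  where
  positive : All (0 <_) (x ∷ Y)
  positive = All.++⁻ʳ X (subst (All (0 <_)) eq (standardLabels-positive (suc m)))
  neither : ∀ {f} → ¬ Special sentinel f → ¬ Special (bottom x) f → oddSpecials f (sentinel ∷ bottom x ∷ []) ≡ 0ℤ
  neither {f} ¬s ¬b = oddSpecials-unspecial {sentinel} {f} {bottom x ∷ []} ¬s (oddSpecials-unspecial {bottom x} {f} {[]} ¬b refl)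
  odd : ∀ {f} → (1 , 0) ◁ position f → position f ◁ (2 , x) → oddSpecials f (sentinel ∷ bottom x ∷ []) ≡ 1ℤ
  odd (inj₁ lt) (inj₁ lt′) = ⊥-elim (ℕ.<-irrefl refl (ℕ.<-≤-trans lt (ℕ.≤-pred lt′)))
  odd {f} (inj₁ lt) (inj₂ (eq , gt)) = oddSpecials-unspecial {sentinel} {f} {bottom x ∷ []}
    (λ { (_ , inj₂ (eq′ , _)) → ℕ.<-irrefl eq′ lt })
    (oddSpecials-special {bottom x} {f} {[]} (refl , inj₂ (sym eq , gt)) refl)
  even : ∀ {f} → (2 , x) ◁ position f → oddSpecials f (sentinel ∷ bottom x ∷ []) ≡ 0ℤ
  even {f} (inj₁ lt) = neither {f} (λ { (_ , inj₂ (eq , _)) → ℕ.<-irrefl eq (ℕ.<-trans (ℕ.n<1+n 1) lt) }) (λ where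
    (_ , inj₁ (eq , _)) → ℕ.<-irrefl eq (ℕ.<-trans (ℕ.n<1+n 1) lt)
    (_ , inj₂ (eq , _)) → ℕ.<-irrefl eq lt)
  even {f} (inj₂ (eq , lt)) = neither {f} (λ { (_ , inj₂ (eq′ , _)) → contradiction (trans eq′ (sym eq)) (λ ()) }) (λ where
    (_ , inj₁ (eq′ , _)) → contradiction (trans eq′ (sym eq)) (λ ())
    (_ , inj₂ (_ , lt′)) → ℕ.<-asym lt lt′)
  even′ : ∀ {f} → All (_≺ f) (bottom x ∷ []) → position f ◁ (1 , 0) → oddSpecials f (sentinel ∷ bottom x ∷ []) ≡ 0ℤ
  even′ {f} (inj₁ lt ∷ []) (inj₁ lt′) = ⊥-elim (ℕ.<-asym lt lt′)
  even′ {f} (inj₁ lt ∷ []) (inj₂ (eq , _)) = ⊥-elim (ℕ.<-irrefl (sym eq) lt)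
  even′ {f} (inj₂ (eq , _) ∷ []) (inj₁ lt) = ⊥-elim (ℕ.<-irrefl (sym eq) lt)
  -- A second letter of key 1: the sentinel and the bottom letter are both special, so the number is
  -- even.
  even′ {f} (inj₂ (eq , lt) ∷ []) (inj₂ (_ , pos)) = oddSpecials-special {sentinel} {f} {bottom x ∷ []} (refl , inj₂ (eq , pos))
    (oddSpecials-special {bottom x} {f} {[]} (refl , inj₁ (eq , lt)) refl)

private
  pivot-labels : ∀ {n} X x Y → standardLabels n ≡ X ++ x ∷ Y →
                 x ∷ candidateLabels (map base X ++ map base Y) ↭ standardLabels n
  pivot-labels X x Y eq rewrite eq | List.map-++ proj₂ (map base X) (map base Y)
    | trans (sym (List.map-∘ {g = proj₂} {f = base} X)) (List.map-id X)
    | trans (sym (List.map-∘ {g = proj₂} {f = base} Y)) (List.map-id Y) = ↭.↭-sym (↭.shift x X Y)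

  pivot-length : ∀ {m} X x Y → standardLabels (suc m) ≡ X ++ x ∷ Y → length (map base X ++ map base Y) ≡ m
  pivot-length {m} X x Y eq = ℕ.suc-injective (trans (cong suc (sym (List.length-map proj₂ (map base X ++ map base Y))))
    (trans (↭.↭-length (pivot-labels X x Y eq)) (List.length-applyDownFrom suc (suc m))))

bottom-odd : ∀ {x} → 0 < x → oddSpecials (bottom x) (sentinel ∷ []) ≡ 1ℤ
bottom-odd {x} pos = oddSpecials-special {sentinel} {bottom x} {[]} (refl , inj₂ (refl , pos)) refl

allHistories-good : ∀ m {hh} → hh ∈ allHistories m →
  oddProduct hh ≡ 1ℤ × All Proper hh × AllPairs _≻_ hh × labels hh ↭ standardLabels (suc m)
allHistories-good m hh∈ with ∈-concatMap⁻ _ (splits (standardLabels (suc m))) hh∈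
... | (X , x , Y) , t∈ , hh∈′ with ∈-splits⁻ (standardLabels (suc m)) t∈
... | eq with histories-good m _ _ _ (bottom-invariant X x Y eq) hh∈′
                (oddProduct-∷ (bottom x) [] (bottom-odd x>0) refl) (s≤s z≤n ∷ []) ([] ∷ [])
  where
  x>0 : 0 < x
  x>0 = All.head (All.++⁻ʳ X (subst (All (0 <_)) eq (standardLabels-positive (suc m))))
... | o , p , s = o , p , s , ↭.trans (histories-labels m _ _ _ (pivot-length X x Y eq) hh∈′)
  (↭.trans (↭.++-comm (candidateLabels (map base X ++ map base Y)) (x ∷ [])) (pivot-labels X x Y eq))

allHistories-complete : ∀ m {h} → All Proper h → AllPairs _≻_ h → labels h ↭ standardLabels (suc m) →
  h ∈ allHistories m ⊎ oddProduct h ≡ 0ℤ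
allHistories-complete m {h} ph sh lh = subst (λ h → h ∈ allHistories m ⊎ oddProduct h ≡ 0ℤ) (List.reverse-involutive h)
  (complete (reverse h) (↭.All-resp-↭ (↭.↭-sym (↭.↭-reverse h)) ph)
    (subst (AllPairs _≻_) (sym (List.reverse-involutive h)) sh)
    (↭.trans (↭.map⁺ label (↭.↭-reverse h)) lh))
  where
  complete : ∀ rest → All Proper rest → AllPairs _≻_ (rest ʳ++ []) → labels rest ↭ standardLabels (suc m) →
             rest ʳ++ [] ∈ allHistories m ⊎ oddProduct (rest ʳ++ []) ≡ 0ℤ
  complete [] _ _ p = contradiction (↭.↭-sym p) ↭.¬x∷xs↭[]
  complete (f ∷ rest) (pf ∷ pr) s p with key f ℕ.≟ 1
  -- The first letter can only stand behind the sentinel, which is special at key 1 only.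
  ... | no key≢1 = inj₂ (oddProduct-ʳ++ rest (f ∷ []) (oddProduct-∷ f []
          (oddSpecials-unspecial {sentinel} {f} {[]} (λ { (_ , inj₂ (eq , _)) → key≢1 (sym eq) }) refl) refl))
  complete (cell .1 x false ∷ rest) (pf ∷ pr) s p | yes refl
    with ∈.∈-∃++ (↭.∈-resp-↭ p (here refl))
  ... | X , Y , eq = case histories-complete m (bottom x ∷ []) (map base X) (map base Y) rest
      (bottom-invariant X x Y eq) (pivot-length X x Y eq)
      (↭.drop-∷ (↭.trans p (↭.↭-sym (pivot-labels X x Y eq)))) s of λ where
        (inj₁ hh∈) → inj₁ (∈-concatMap⁺ _ (subst (λ l → (X , x , Y) ∈ splits l) (sym eq) (∈-splits⁺ X)) hh∈)
        (inj₂ z) → inj₂ z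
  complete (cell zero x true ∷ rest) (() ∷ pr) s p | yes refl

Unique-allHistories : ∀ m → Unique (allHistories m)
Unique-allHistories m = Unique-concatMap _ (Unique-splits uniqueLabels)
  (λ { {X , x , Y} t∈ → Unique-histories m _ _ _
    (AllPairs.tail (Unique-resp-↭ (↭.↭-sym (pivot-labels X x Y (∈-splits⁻ _ t∈))) uniqueLabels)) })
  (λ t∈ t∈′ hh∈ hh∈′ → splits-injective uniqueLabels t∈ t∈′ (cong label (histories-next m m [] refl hh∈ hh∈′)))
  where
  uniqueLabels : Unique (standardLabels (suc m))
  uniqueLabels = standardLabels-unique (suc m)

Σ-allHistories : ∀ m (ω : ℕ → ℕ → ℤ) →
  Σ[ allHistories m ] (λ h → ω (totalArea h) (totalDecorations h)) ≡ Σ[ cuts (suc m) ] (λ (i , j) → Ψ m i j ω)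
Σ-allHistories m ω = trans (Σ-concatMap (startingWith m) (splits (standardLabels (suc m))))
  (trans (Σ-splits (standardLabels (suc m)) _ (λ (i , j) → Ψ m i j ω) (λ { {X , x , Y} t∈ → piece X x Y (∈-splits⁻ _ t∈) }))
    (cong (λ l → Σ[ cuts l ] (λ (i , j) → Ψ m i j ω)) (List.length-applyDownFrom suc (suc m))))
  where
  totalLevel-base : ∀ X → totalLevel (map base X) ≡ 0
  totalLevel-base X = trans (ℕΣ.Σ-map base X) (ℕΣ.Σ-ε X)
  piece : ∀ X x Y → standardLabels (suc m) ≡ X ++ x ∷ Y →
    Σ[ histories m (bottom x ∷ []) (map base X) (map base Y) ] (λ h → ω (totalArea h) (totalDecorations h))
    ≡ Ψ m (length X) (length Y) ω
  piece X x Y eq = trans (Σ-histories m _ _ _ ω (trans (sym (List.length-++ (map base X))) (pivot-length X x Y eq)))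
    (Ψ-cong m (List.length-map base X) (List.length-map base Y) (λ p q → cong₂ ω (level p) (ℕ.+-identityʳ q)))
    where
    level : ∀ p → p + (totalLevel (map base X) + totalLevel (map base Y)) + 0 ≡ p
    level p rewrite totalLevel-base X | totalLevel-base Y = trans (ℕ.+-identityʳ _) (ℕ.+-identityʳ p)

-- Grouping words by their order of insertion

_≟-cell_ : DecidableEquality Cell
cell h x d ≟-cell cell h′ x′ d′ =
  map′ (λ { (refl , refl , refl) → refl }) (λ { refl → refl , refl , refl })
       ((h ℕ.≟ h′) ×-dec (x ℕ.≟ x′) ×-dec (d Bool.≟ d′))

_≟-history_ : DecidableEquality (List Cell)
_≟-history_ = List.≡-dec _≟-cell_

≺-trans : ∀ {p q r} → p ≺ q → q ≺ r → p ≺ r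
≺-trans {p} {q} {r} = ◁-trans {position p} {position q} {position r}

≺-total : ∀ p q → label p ≢ label q → p ≺ q ⊎ q ≺ p
≺-total p q x≢y with ℕ.<-cmp (key p) (key q)
... | tri< lt _ _ = inj₁ (inj₁ lt)
... | tri> _ _ gt = inj₂ (inj₁ gt)
... | tri≈ _ eq _ with ℕ.<-cmp (label p) (label q)
... | tri< lt _ _ = inj₂ (inj₂ (sym eq , lt))
... | tri≈ _ x≡y _ = contradiction x≡y x≢y
... | tri> _ _ gt = inj₁ (inj₂ (eq , gt))

-- A word determines its order of insertion, so different groups have no arrangement in common.
descending-↭⇒≡ : ∀ {s t} → AllPairs _≻_ s → AllPairs _≻_ t → s ↭ t → s ≡ t
descending-↭⇒≡ {[]}    {t}     _ _ s↭t = sym (↭.↭-empty-inv (↭.↭-sym s↭t))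
descending-↭⇒≡ {p ∷ s} {[]}    _ _ s↭t = contradiction s↭t ↭.¬x∷xs↭[]
descending-↭⇒≡ {p ∷ s} {q ∷ t} (p≻ ∷ ds) (q≻ ∷ dt) s↭t
  with ↭.∈-resp-↭ s↭t (here refl) | ↭.∈-resp-↭ (↭.↭-sym s↭t) (here refl)
... | here refl | _         = cong (p ∷_) (descending-↭⇒≡ ds dt (↭.drop-∷ s↭t))
... | there p∈  | here refl = cong (p ∷_) (descending-↭⇒≡ ds dt (↭.drop-∷ s↭t))
... | there p∈  | there q∈  =
  contradiction (≺-trans {p} {q} {p} (All.lookup q≻ p∈) (All.lookup p≻ q∈)) (≺-irrefl {p})

_≺?_ : ∀ p e → Dec (p ≺ e)
p ≺? e = (key p ℕ.<? key e) ⊎-dec ((key p ℕ.≟ key e) ×-dec (label e ℕ.<? label p))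

insert : Cell → List Cell → List Cell
insert e []      = e ∷ []
insert e (p ∷ s) with p ≺? e
... | yes _ = e ∷ p ∷ s
... | no _  = p ∷ insert e s

insert-↭ : ∀ e s → insert e s ↭ e ∷ s
insert-↭ e []      = ↭.refl
insert-↭ e (p ∷ s) with p ≺? e
... | yes _ = ↭.refl
... | no _  = ↭.trans (↭.prep p (insert-↭ e s)) (↭.swap _ _ ↭.refl)

insert-descending : ∀ e s → All (λ p → label e ≢ label p) s → AllPairs _≻_ s → AllPairs _≻_ (insert e s)
insert-descending e []      _           _         = [] ∷ []
insert-descending e (p ∷ s) (e≢p ∷ e≢s) (p≻ ∷ ds) with p ≺? e
... | yes p≺e = (p≺e ∷ All.map (λ {q} q≺p → ≺-trans {q} {p} {e} q≺p p≺e) p≻) ∷ p≻ ∷ ds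
... | no p⊀e  = ↭.All-resp-↭ (↭.↭-sym (insert-↭ e s)) (e≺p ∷ p≻) ∷ insert-descending e s e≢s ds
  where
  e≺p : e ≺ p
  e≺p = case ≺-total e p e≢p of λ where
    (inj₁ lt) → lt
    (inj₂ gt) → contradiction gt p⊀e

sort : List Cell → List Cell
sort []      = []
sort (e ∷ s) = insert e (sort s)

sort-↭ : ∀ s → sort s ↭ s
sort-↭ []      = ↭.refl
sort-↭ (e ∷ s) = ↭.trans (insert-↭ e (sort s)) (↭.prep e (sort-↭ s))

sort-descending : ∀ s → Unique (labels s) → AllPairs _≻_ (sort s)
sort-descending []      _        = []
sort-descending (e ∷ s) (e∉ ∷ u) =
  insert-descending e (sort s) (↭.All-resp-↭ (↭.↭-sym (sort-↭ s)) (All.map⁻ e∉)) (sort-descending s u)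

weight-unlinked : ∀ s → ¬ Linked Follows s → weight s ≡ 0ℤ
weight-unlinked []          ¬l = contradiction [] ¬l
weight-unlinked (p ∷ [])    ¬l = contradiction [-] ¬l
weight-unlinked (p ∷ q ∷ s) ¬l with follows? p q | weight-unlinked (q ∷ s)
... | yes f | vanishes = trans (cong ((1ℤ ℤ.* sign) ℤ.*_) (vanishes (λ l → ¬l (f ∷ l)))) (ℤ.*-zeroʳ (1ℤ ℤ.* sign))
  where
  sign : ℤ
  sign = decorationSign p ℤ.* Π.Σ[ q ∷ s ] (λ r → ε[ inverted? p r ])
... | no _  | _ = refl

-- Linking to the sentinel encodes the start of a path: together with `proper`, which excludes level
-- -1, it forces the first letter to be undecorated and of level 0.
record Valid (n : ℕ) (s : List Cell) : Set where
  field
    linked         : Linked Follows (sentinel ∷ s)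
    proper         : All Proper s
    labels-correct : labels s ↭ standardLabels n

-- The words of cells are grouped by their time-sorted rearrangement; only the
-- groups of the generated histories have a nonzero signed count, namely 1.
module _ (m : ℕ) (words : List (List Cell)) (unique : Unique words)
         (sound : ∀ {s} → s ∈ words → Valid (suc m) s)
         (complete : ∀ {s} → Valid (suc m) s → s ∈ words) where

  open DecMembership _≟-history_ using () renaming (_∈?_ to _∈?-histories_)

  private
    others : List (List Cell)
    others = filter (λ h → ¬? (h ∈?-histories allHistories m)) (deduplicate _≟-history_ (map sort words))

    groups : List (List Cell)
    groups = allHistories m ++ others

    sort-word : ∀ {s} → s ∈ words → All Proper (sort s) × AllPairs _≻_ (sort s) × labels (sort s) ↭ standardLabels (suc m)
    sort-word {s} s∈ =
      ↭.All-resp-↭ (↭.↭-sym (sort-↭ s)) proper ,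
      sort-descending s (Unique-resp-↭ (↭.↭-sym labels-correct) (standardLabels-unique (suc m))) ,
      ↭.trans (↭.map⁺ label (sort-↭ s)) labels-correct
      where open Valid (sound s∈)

    others⁻ : ∀ {h} → h ∈ others →
              h ∉ allHistories m × All Proper h × AllPairs _≻_ h × labels h ↭ standardLabels (suc m)
    others⁻ h∈ with ∈.∈-filter⁻ (λ h → ¬? (h ∈?-histories allHistories m)) h∈
    ... | h∈′ , h∉ with ∈.∈-map⁻ sort (∈.∈-deduplicate⁻ _≟-history_ (map sort words) h∈′)
    ... | s , s∈ , refl = h∉ , sort-word s∈

    groups⁻ : ∀ {h} → h ∈ groups → All Proper h × AllPairs _≻_ h × labels h ↭ standardLabels (suc m)
    groups⁻ h∈ = case ∈.∈-++⁻ (allHistories m) h∈ of λ where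
      (inj₁ h∈₁) → proj₂ (allHistories-good m h∈₁)
      (inj₂ h∈₂) → proj₂ (others⁻ h∈₂)

    sort∈groups : ∀ {s} → s ∈ words → sort s ∈ groups
    sort∈groups {s} s∈ with sort s ∈?-histories allHistories m
    ... | yes h∈ = ∈.∈-++⁺ˡ h∈
    ... | no h∉  = ∈.∈-++⁺ʳ (allHistories m) (∈.∈-filter⁺ (λ h → ¬? (h ∈?-histories allHistories m))
                     (∈.∈-deduplicate⁺ _≟-history_ (∈.∈-map⁺ sort s∈)) h∉)

    Unique-groups : Unique groups
    Unique-groups = Unique.++⁺ (Unique-allHistories m)
      (Unique.filter⁺ _ (DecUnique.deduplicate-! _≟-history_ (map sort words)))
      λ (h∈ , h∈′) → proj₁ (others⁻ h∈′) h∈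

    linked? : ∀ s → Dec (Linked Follows s)
    linked? = Linked.linked? follows?

    -- Unlinked arrangements have weight 0, so the filter changes no sum; what remains are the valid
    -- words behind a sentinel.
    arranged : List (List Cell)
    arranged = filter linked? (concatMap arrangements groups)

    Unique-arranged : Unique arranged
    Unique-arranged = Unique.filter⁺ linked? (Unique-concatMap arrangements Unique-groups
      (λ h∈ → let p , d , _ = groups⁻ h∈ in Unique-arrangements _ p d)
      λ {h} {h′} h∈ h′∈ s∈ s∈′ → case ∈-arrangements⁻ h s∈ , ∈-arrangements⁻ h′ s∈′ of λ where
        ((_ , refl , s↭h) , (_ , refl , s↭h′)) →
          descending-↭⇒≡ (proj₁ (proj₂ (groups⁻ h∈))) (proj₁ (proj₂ (groups⁻ h′∈))) (↭.trans (↭.↭-sym s↭h) s↭h′))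

    words⊆arranged : ∀ {s} → s ∈ map (sentinel ∷_) words → s ∈ arranged
    words⊆arranged s∈ with ∈.∈-map⁻ (sentinel ∷_) s∈
    ... | s₀ , s₀∈ , refl = ∈.∈-filter⁺ linked?
      (∈-concatMap⁺ arrangements (sort∈groups s₀∈) (∈-arrangements⁺ (sort s₀) (↭.↭-sym (sort-↭ s₀))))
      (Valid.linked (sound s₀∈))

    arranged⊆words : ∀ {s} → s ∈ arranged → s ∈ map (sentinel ∷_) words
    arranged⊆words s∈ with ∈.∈-filter⁻ linked? s∈
    ... | s∈′ , l with ∈-concatMap⁻ arrangements groups s∈′
    ... | h , h∈ , s∈h with ∈-arrangements⁻ h s∈h | groups⁻ h∈
    ... | s₀ , refl , s₀↭h | p , _ , lab = ∈.∈-map⁺ (sentinel ∷_) (complete (record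
      { linked         = l
      ; proper         = ↭.All-resp-↭ (↭.↭-sym s₀↭h) p
      ; labels-correct = ↭.trans (↭.map⁺ label s₀↭h) lab
      }))

  Σ-words : ∀ (ω : ℕ → ℕ → ℤ) →
    Σ[ words ] (λ s → weight (sentinel ∷ s) ℤ.* ω (totalArea s) (totalDecorations s)) ≡
    Σ[ cuts (suc m) ] (λ (i , j) → Ψ m i j ω)
  Σ-words ω = begin
    Σ[ words ] (f ∘ (sentinel ∷_))
      ≡⟨ Σ-map (sentinel ∷_) words ⟨
    Σ[ map (sentinel ∷_) words ] f
      ≡⟨ Σ-sameElements f (Unique.map⁺ List.∷-injectiveʳ unique) Unique-arranged words⊆arranged arranged⊆words ⟩
    Σ[ arranged ] f
      ≡⟨ Σ-filter linked? (concatMap arrangements groups)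
           (λ {s} _ ¬l → cong (ℤ._* ω (totalArea s) (totalDecorations s)) (weight-unlinked s ¬l)) ⟩
    Σ[ concatMap arrangements groups ] f
      ≡⟨ Σ-concatMap arrangements groups ⟩
    Σ[ groups ] (λ h → Σ[ arrangements h ] f)
      ≡⟨ Σ-cong groups group ⟩
    Σ[ groups ] (λ h → oddProduct h ℤ.* ωₕ h)
      ≡⟨ Σ-++ (allHistories m) others ⟩
    Σ[ allHistories m ] (λ h → oddProduct h ℤ.* ωₕ h) ℤ.+ Σ[ others ] (λ h → oddProduct h ℤ.* ωₕ h)
      ≡⟨ cong₂ ℤ._+_
           (Σ-cong (allHistories m) (λ {h} h∈ →
             trans (cong (ℤ._* ωₕ h) (proj₁ (allHistories-good m h∈))) (ℤ.*-identityˡ (ωₕ h))))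
           (trans (Σ-cong others (λ {h} h∈ → cong (ℤ._* ωₕ h) (vanish h∈))) (Σ-ε others)) ⟩
    Σ[ allHistories m ] ωₕ ℤ.+ 0ℤ
      ≡⟨ ℤ.+-identityʳ _ ⟩
    Σ[ allHistories m ] ωₕ
      ≡⟨ Σ-allHistories m ω ⟩
    Σ[ cuts (suc m) ] (λ (i , j) → Ψ m i j ω) ∎
    where
    open ≡-Reasoning
    ωₕ f : List Cell → ℤ
    ωₕ s = ω (totalArea s) (totalDecorations s)
    f s = weight s ℤ.* ωₕ s
    group : ∀ {h} → h ∈ groups → Σ[ arrangements h ] f ≡ oddProduct h ℤ.* ωₕ h
    group {h} h∈ = begin
      Σ[ arrangements h ] f
        ≡⟨ Σ-cong (arrangements h) (λ {s} s∈ → cong (weight s ℤ.*_) (constant s∈)) ⟩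
      Σ[ arrangements h ] (λ s → weight s ℤ.* ωₕ h)
        ≡⟨ Σ-*ʳ (ωₕ h) (arrangements h) weight ⟩
      Σ[ arrangements h ] weight ℤ.* ωₕ h
        ≡⟨ cong (ℤ._* ωₕ h) (let p , d , _ = groups⁻ h∈ in Σ-arrangements h p d) ⟩
      oddProduct h ℤ.* ωₕ h ∎
      where
      -- Apart from the sentinel, which adds nothing, an arrangement has the same cells as `h`,
      -- hence the same area and number of decorations.
      constant : ∀ {s} → s ∈ arrangements h → ωₕ s ≡ ωₕ h
      constant s∈ with ∈-arrangements⁻ h s∈
      ... | _ , refl , s₀↭h = cong₂ ω (ℕΣ.Σ-↭ cellArea s₀↭h) (ℕΣ.Σ-↭ decorations s₀↭h)
    vanish : ∀ {h} → h ∈ others → oddProduct h ≡ 0ℤ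
    vanish h∈ with others⁻ h∈
    ... | h∉ , p , d , lab = case allHistories-complete m p d lab of λ where
      (inj₁ h∈′) → contradiction h∈′ h∉
      (inj₂ z)   → z

-- Dyck paths and area words

private variable
  n x y : ℕ

lookup-∷ʳ-inject₁ : ∀ (v : Vec A n) a i → lookup (v Vec.∷ʳ a) (inject₁ i) ≡ lookup v i
lookup-∷ʳ-inject₁ (b ∷ v) a zero    = refl
lookup-∷ʳ-inject₁ (b ∷ v) a (suc i) = lookup-∷ʳ-inject₁ v a i

lookup-∷ʳ-fromℕ : ∀ (v : Vec A n) a → lookup (v Vec.∷ʳ a) (fromℕ n) ≡ a
lookup-∷ʳ-fromℕ []      a = refl
lookup-∷ʳ-fromℕ (b ∷ v) a = lookup-∷ʳ-fromℕ v a

path-≤ : Path x y → x ≤ y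
path-≤ start        = z≤n
path-≤ (north π)    = ℕ.m≤n⇒m≤1+n (path-≤ π)
path-≤ (east x<y _) = x<y

columns-≤ : ∀ (π : Path x y) i → lookup (columns π) i ≤ x
columns-≤ (east _ π) i = ℕ.m≤n⇒m≤1+n (columns-≤ π i)
columns-≤ (north {x} π) i with view i
... | ‵fromℕ     rewrite lookup-∷ʳ-fromℕ (columns π) x      = ℕ.≤-refl
... | ‵inject₁ j rewrite lookup-∷ʳ-inject₁ (columns π) x j = columns-≤ π j

-- Source of the facts on area words: together with monotone columns it bounds each rise by one and
-- identifies a rise by exactly one with staying in the same column.
area+column : ∀ (π : Path x y) i → lookup (areaWord π) i + lookup (columns π) i ≡ toℕ i
area+column (east _ π) i = area+column π i
area+column (north {x} {y} π) i with view i
... | ‵fromℕ rewrite lookup-∷ʳ-fromℕ (columns π) x | lookup-∷ʳ-fromℕ (areaWord π) (y ∸ x) =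
  trans (ℕ.m∸n+n≡m (path-≤ π)) (sym (Fin.toℕ-fromℕ y))
... | ‵inject₁ j rewrite lookup-∷ʳ-inject₁ (columns π) x j | lookup-∷ʳ-inject₁ (areaWord π) (y ∸ x) j =
  trans (area+column π j) (sym (Fin.toℕ-inject₁ j))

columns-mono : ∀ (π : Path x y) i j → toℕ i ≤ toℕ j → lookup (columns π) i ≤ lookup (columns π) j
columns-mono (east _ π) i j i≤j = columns-mono π i j i≤j
columns-mono (north {x} {y} π) i j i≤j with view i | view j
... | ‵fromℕ     | ‵fromℕ     = ℕ.≤-refl
... | ‵inject₁ k | ‵fromℕ     rewrite lookup-∷ʳ-inject₁ (columns π) x k | lookup-∷ʳ-fromℕ (columns π) x = columns-≤ π k
... | ‵fromℕ     | ‵inject₁ l rewrite Fin.toℕ-fromℕ y | Fin.toℕ-inject₁ l =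
  contradiction (Fin.toℕ<n l) (ℕ.≤⇒≯ i≤j)
... | ‵inject₁ k | ‵inject₁ l rewrite lookup-∷ʳ-inject₁ (columns π) x k | lookup-∷ʳ-inject₁ (columns π) x l
  | Fin.toℕ-inject₁ k | Fin.toℕ-inject₁ l = columns-mono π k l i≤j

module _ (π : Path x y) where
  private
    a c : Fin y → ℕ
    a = lookup (areaWord π)
    c = lookup (columns π)

  area-first : ∀ i → toℕ i ≡ 0 → a i ≡ 0
  area-first i i≡0 = ℕ.m+n≡0⇒m≡0 (a i) (trans (area+column π i) i≡0)

  area-step : ∀ i j → toℕ j ≡ suc (toℕ i) → a j + c j ≡ suc (a i) + c i
  area-step i j j≡1+i = trans (area+column π j) (trans j≡1+i (cong suc (sym (area+column π i))))

  area-step-≤ : ∀ i j → toℕ j ≡ suc (toℕ i) → a j ≤ suc (a i)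
  area-step-≤ i j j≡1+i = ℕ.+-cancelʳ-≤ (c j) (a j) (suc (a i)) (ℕ.≤-trans (ℕ.≤-reflexive (area-step i j j≡1+i))
    (ℕ.+-monoʳ-≤ (suc (a i)) (columns-mono π i j (ℕ.≤-trans (ℕ.n≤1+n _) (ℕ.≤-reflexive (sym j≡1+i))))))

  rise⇒sameColumn : ∀ i j → toℕ j ≡ suc (toℕ i) → a j ≡ suc (a i) → c i ≡ c j
  rise⇒sameColumn i j j≡1+i rise =
    sym (ℕ.+-cancelˡ-≡ (suc (a i)) (c j) (c i) (trans (cong (_+ c j) (sym rise)) (area-step i j j≡1+i)))

  sameColumn⇒rise : ∀ i j → toℕ j ≡ suc (toℕ i) → c i ≡ c j → a j ≡ suc (a i)
  sameColumn⇒rise i j j≡1+i same =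
    ℕ.+-cancelʳ-≡ (c j) (a j) (suc (a i)) (trans (area-step i j j≡1+i) (cong (suc (a i) +_) same))

areaWord-injective : ∀ (π π′ : Path x y) → (∀ i → lookup (areaWord π) i ≡ lookup (areaWord π′) i) → π ≡ π′
areaWord-injective start start _ = refl
areaWord-injective (east p π) (east p′ π′) eq = cong₂ east (ℕ.≤-irrelevant p p′) (areaWord-injective π π′ eq)
areaWord-injective (north {x} {y} π) (north π′) eq = cong north (areaWord-injective π π′ λ i → begin
  lookup (areaWord π) i                             ≡⟨ lookup-∷ʳ-inject₁ (areaWord π) (y ∸ x) i ⟨
  lookup (areaWord π Vec.∷ʳ (y ∸ x)) (inject₁ i)    ≡⟨ eq (inject₁ i) ⟩
  lookup (areaWord π′ Vec.∷ʳ (y ∸ x)) (inject₁ i)   ≡⟨ lookup-∷ʳ-inject₁ (areaWord π′) (y ∸ x) i ⟩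
  lookup (areaWord π′) i                            ∎)
  where open ≡-Reasoning
-- The last vertical step lies in column `suc x` on the left but in a column at most `x` on the
-- right, so the last letters of the area words differ.
areaWord-injective (north {suc x} {y} π) (east p π′) eq = contradiction
  (area+column (east p π′) (fromℕ y))
  (ℕ.<⇒≢ (ℕ.<-≤-trans (ℕ.+-monoʳ-< _ (s≤s (columns-≤ π′ (fromℕ y)))) (ℕ.≤-reflexive sum)))
  where
  sum : lookup (areaWord π′) (fromℕ y) + suc x ≡ toℕ (fromℕ y)
  sum = trans (cong (_+ suc x) (trans (sym (eq (fromℕ y))) (lookup-∷ʳ-fromℕ (areaWord π) (y ∸ suc x))))
          (trans (ℕ.m∸n+n≡m (path-≤ π)) (sym (Fin.toℕ-fromℕ y)))
areaWord-injective (east p π) (north {suc x} {y} π′) eq = sym (areaWord-injective (north π′) (east p π) (sym ∘ eq))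

∈-paths : ∀ (π : Path x y) → π ∈ paths x y
∈-paths {zero}  {zero}  start      = here refl
∈-paths {zero}  {suc y} (north π)  = ∈.∈-map⁺ north (∈-paths π)
∈-paths {suc x} {suc y} (north π)  = ∈.∈-++⁺ˡ (∈.∈-map⁺ north (∈-paths π))
∈-paths {suc x} {suc y} (east p π) = ∈.∈-++⁺ʳ (map north (paths (suc x) y)) (∈-easts (suc x ℕ.≤? suc y))
  where
  ∈-easts : ∀ d → east p π ∈ easts d (paths x (suc y))
  ∈-easts (yes q) rewrite ℕ.≤-irrelevant p q = ∈.∈-map⁺ (east q) (∈-paths π)
  ∈-easts (no ¬p) = contradiction p ¬p

Unique-paths : ∀ x y → Unique (paths x y)
Unique-paths zero    zero    = [] ∷ []
Unique-paths zero    (suc y) = Unique.map⁺ (λ { refl → refl }) (Unique-paths zero y)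
Unique-paths (suc x) zero    = []
Unique-paths (suc x) (suc y) = Unique.++⁺ (Unique.map⁺ (λ { refl → refl }) (Unique-paths (suc x) y))
  (Unique-easts (suc x ℕ.≤? suc y))
  (λ (π∈ , π∈′) → disjoint (suc x ℕ.≤? suc y) π∈ π∈′)
  where
  Unique-easts : ∀ d → Unique (easts d (paths x (suc y)))
  Unique-easts (yes p) = Unique.map⁺ (λ { refl → refl }) (Unique-paths x (suc y))
  Unique-easts (no _)  = []
  disjoint : ∀ d {π} → π ∈ map north (paths (suc x) y) → π ∈ easts d (paths x (suc y)) → ⊥
  disjoint (yes p) π∈ π∈′ with ∈.∈-map⁻ north π∈ | ∈.∈-map⁻ (east p) π∈′
  ... | _ , _ , refl | _ , _ , ()

eastwards : ∀ d → x + d ≤ y → Path x y → Path (x + d) y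
eastwards {x} {y} zero    le π = subst (λ z → Path z y) (sym (ℕ.+-identityʳ x)) π
eastwards {x} {y} (suc d) le π = subst (λ z → Path z y) (sym (ℕ.+-suc x d)) (east le′ (eastwards d (ℕ.<⇒≤ le′) π))
  where
  le′ : suc (x + d) ≤ y
  le′ = subst (_≤ y) (ℕ.+-suc x d) le

areaWord-subst : ∀ {x x′} (eq : x ≡ x′) (π : Path x y) → areaWord (subst (λ z → Path z y) eq π) ≡ areaWord π
areaWord-subst refl π = refl

areaWord-eastwards : ∀ d (le : x + d ≤ y) (π : Path x y) → areaWord (eastwards d le π) ≡ areaWord π
areaWord-eastwards {x} zero    le π = areaWord-subst (sym (ℕ.+-identityʳ x)) π
areaWord-eastwards {x} (suc d) le π = trans (areaWord-subst (sym (ℕ.+-suc x d)) _) (areaWord-eastwards d _ π)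

extendTo : ∀ {x x′} → x ≤ x′ → x′ ≤ y → (π : Path x y) → ∃ λ (π′ : Path x′ y) → areaWord π′ ≡ areaWord π
extendTo {y} {x} {x′} x≤x′ x′≤y π = subst (λ z → Path z y) eq π₁ ,
  trans (areaWord-subst eq π₁) (areaWord-eastwards (x′ ∸ x) _ π)
  where
  eq : x + (x′ ∸ x) ≡ x′
  eq = ℕ.m+[n∸m]≡n x≤x′
  π₁ : Path (x + (x′ ∸ x)) y
  π₁ = eastwards (x′ ∸ x) (subst (_≤ y) (sym eq) x′≤y) π

IsAreaWord : (Fin y → ℕ) → Set
IsAreaWord a = (∀ i → toℕ i ≡ 0 → a i ≡ 0) × (∀ i j → toℕ j ≡ suc (toℕ i) → a j ≤ suc (a i))

IsAreaWord-init : ∀ {a : Fin (suc y) → ℕ} → IsAreaWord a → IsAreaWord (a ∘ inject₁)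
IsAreaWord-init (first , step) =
  (λ i i≡0 → first _ (trans (Fin.toℕ-inject₁ i) i≡0)) ,
  λ i j j≡1+i → step _ _ (trans (Fin.toℕ-inject₁ j) (trans j≡1+i (cong suc (sym (Fin.toℕ-inject₁ i)))))

last-≤ : ∀ y (a : Fin (suc y) → ℕ) → IsAreaWord a → a (fromℕ y) ≤ y
last-≤ zero    a (first , _)        = ℕ.≤-reflexive (first zero refl)
last-≤ (suc y) a isA@(_ , step) = ℕ.≤-trans
  (step (inject₁ (fromℕ y)) (fromℕ (suc y)) (cong suc (sym (Fin.toℕ-inject₁ (fromℕ y)))))
  (s≤s (last-≤ y (a ∘ inject₁) (IsAreaWord-init isA)))

-- `pathTo` stops in the column of the last vertical step, because east steps taken too early could
-- not be undone for the next letter.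
lastColumn : ∀ y → (Fin y → ℕ) → ℕ
lastColumn zero    a = 0
lastColumn (suc y) a = y ∸ a (fromℕ y)

lastColumn-mono : ∀ y (a : Fin (suc y) → ℕ) → IsAreaWord a → lastColumn y (a ∘ inject₁) ≤ y ∸ a (fromℕ y)
lastColumn-mono zero    a isA        = z≤n
lastColumn-mono (suc y) a (_ , step) = ℕ.∸-monoʳ-≤ (suc y)
  (step (inject₁ (fromℕ y)) (fromℕ (suc y)) (cong suc (sym (Fin.toℕ-inject₁ (fromℕ y)))))

pathTo : ∀ y (a : Fin y → ℕ) → IsAreaWord a → ∃ λ (π : Path (lastColumn y a) y) → ∀ i → lookup (areaWord π) i ≡ a i
pathTo zero    a isA = start , λ ()
pathTo (suc y) a isA with pathTo y (a ∘ inject₁) (IsAreaWord-init isA)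
... | π , area-π with extendTo (lastColumn-mono y a isA) (ℕ.m∸n≤m y (a (fromℕ y))) π
... | π′ , same = north π′ , heights
  where
  heights : ∀ i → lookup (areaWord (north π′)) i ≡ a i
  heights i with view i
  ... | ‵fromℕ     = trans (lookup-∷ʳ-fromℕ (areaWord π′) _) (ℕ.m∸[m∸n]≡n (last-≤ y a isA))
  ... | ‵inject₁ j = trans (lookup-∷ʳ-inject₁ (areaWord π′) _ j) (trans (cong (λ v → lookup v j) same) (area-π j))

dyckPath : ∀ (a : Fin n → ℕ) → IsAreaWord a → ∃ λ (π : Dyck n) → ∀ i → lookup (areaWord π) i ≡ a i
dyckPath {n} a isA with pathTo n a isA
... | π , area-π with extendTo (path-≤ π) ℕ.≤-refl π
... | π′ , same = π′ , λ i → trans (cong (λ v → lookup v i) same) (area-π i)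

-- Enumerations without repetition

∈-allVecs : ∀ {xs : List A} (v : Vec A n) → (∀ i → lookup v i ∈ xs) → v ∈ allVecs xs n
∈-allVecs []      _  = here refl
∈-allVecs (a ∷ v) ∈xs = ∈.∈-cartesianProductWith⁺ _∷_ (∈xs zero) (∈-allVecs v (∈xs ∘ suc))

Unique-allVecs : ∀ {xs : List A} n → Unique xs → Unique (allVecs xs n)
Unique-allVecs zero    u = [] ∷ []
Unique-allVecs (suc n) u = Unique.cartesianProductWith⁺ _∷_ (λ { refl → refl , refl }) u (Unique-allVecs n u)

Unique-permutations : ∀ n → Unique (permutations n)
Unique-permutations n = Unique.filter⁺ _ (Unique-allVecs n (Unique.allFin⁺ n))

∈-permutations⁺ : ∀ (w : Word n) → (∀ i j → lookup w i ≡ lookup w j → i ≡ j) → w ∈ permutations n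
∈-permutations⁺ {n} w inj = ∈.∈-filter⁺ _ (∈-allVecs w (λ i → ∈.∈-allFin (lookup w i)))
  (subst (Vec.AllPairs _≢_) (Vec.tabulate∘lookup w) (VecAllPairs.tabulate⁺ λ i≢j eq → i≢j (inj _ _ eq)))

∈-permutations⁻ : ∀ {w : Word n} → w ∈ permutations n → ∀ i j → lookup w i ≡ lookup w j → i ≡ j
∈-permutations⁻ {n} w∈ = VecUnique.lookup-injective (proj₂ (∈.∈-filter⁻ _ {xs = allVecs (allFin n) n} w∈))

Unique-allSubsets : ∀ n → Unique (allSubsets n)
Unique-allSubsets n = Unique-allVecs n (((λ ()) ∷ []) ∷ [] ∷ [])

∈-allSubsets : ∀ (p : Subset n) → p ∈ allSubsets n
∈-allSubsets p = ∈-allVecs p (λ i → ∈-bool (lookup p i))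
  where
  ∈-bool : ∀ b → b ∈ false ∷ true ∷ []
  ∈-bool false = here refl
  ∈-bool true  = there (here refl)

Linked-tabulate⁻ : ∀ {R : A → A → Set} {x} (f : Fin n → A) → Linked R (x ∷ tabulate f) →
  (∀ i → toℕ i ≡ 0 → R x (f i)) × (∀ i j → toℕ j ≡ suc (toℕ i) → R (f i) (f j))
Linked-tabulate⁻ {n = zero}  f l = (λ ()) , (λ ())
Linked-tabulate⁻ {n = suc n} {R = R} f (r ∷ l) with Linked-tabulate⁻ (f ∘ suc) l
... | first , step = first′ , step′
  where
  first′ : ∀ i → toℕ i ≡ 0 → R _ (f i)
  first′ zero _ = r
  step′ : ∀ i j → toℕ j ≡ suc (toℕ i) → R (f i) (f j)
  step′ zero    (suc j) eq = first j (ℕ.suc-injective eq)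
  step′ (suc i) (suc j) eq = step i j (ℕ.suc-injective eq)

Linked-tabulate⁺ : ∀ {R : A → A → Set} {x} (f : Fin n → A) → (∀ i → toℕ i ≡ 0 → R x (f i)) →
  (∀ i j → toℕ j ≡ suc (toℕ i) → R (f i) (f j)) → Linked R (x ∷ tabulate f)
Linked-tabulate⁺ {n = zero}  f first step = [-]
Linked-tabulate⁺ {n = suc n} f first step = first zero refl ∷ Linked-tabulate⁺ (f ∘ suc)
  (λ i i≡0 → step zero (suc i) (cong suc i≡0)) (λ i j eq → step (suc i) (suc j) (cong suc eq))

-- Decorated labelled paths as words of cells

cellAt : Triple n → Fin n → Cell
cellAt (π , w , dv) i = cell (suc (lookup (areaWord π) i)) (suc (toℕ (lookup w i))) (lookup dv i)

word : Triple n → List Cell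
word P = tabulate (cellAt P)

triples : ∀ n → List (Triple n)
triples n = concatMap (stLD n) (upTo n)

tabulate-injective : ∀ {f g : Fin n → A} → tabulate f ≡ tabulate g → ∀ i → f i ≡ g i
tabulate-injective eq zero    = List.∷-injectiveˡ eq
tabulate-injective eq (suc i) = tabulate-injective (List.∷-injectiveʳ eq) i

lookup-ext : ∀ {v v′ : Vec A n} → (∀ i → lookup v i ≡ lookup v′ i) → v ≡ v′
lookup-ext {v = v} {v′} eq = trans (sym (Vec.tabulate∘lookup v)) (trans (Vec.tabulate-cong eq) (Vec.tabulate∘lookup v′))

word-injective : ∀ (P P′ : Triple n) → word P ≡ word P′ → P ≡ P′
word-injective (π , w , dv) (π′ , w′ , dv′) eq = cong₂ _,_
  (areaWord-injective π π′ λ i → ℕ.suc-injective (cong height (tabulate-injective eq i)))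
  (cong₂ _,_
    (lookup-ext λ i → Fin.toℕ-injective (ℕ.suc-injective (cong label (tabulate-injective eq i))))
    (lookup-ext λ i → cong decorated (tabulate-injective eq i)))

∈-stLD⁻ : ∀ {k} {P : Triple n} → P ∈ stLD n k → IsStLD k P × proj₁ (proj₂ P) ∈ permutations n
∈-stLD⁻ {n} {k} {P} P∈ with ∈.∈-filter⁻ (isStLD? k) {xs = cartesianProduct (paths n n) (cartesianProduct (permutations n) (allSubsets n))} P∈
... | P∈′ , isP = isP , proj₁ (∈.∈-cartesianProduct⁻ (permutations n) (allSubsets n)
  (proj₂ (∈.∈-cartesianProduct⁻ (paths n n) (cartesianProduct (permutations n) (allSubsets n)) P∈′)))

∈-triples⁻ : ∀ {P : Triple n} → P ∈ triples n → ∃ λ k → IsStLD k P × proj₁ (proj₂ P) ∈ permutations n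
∈-triples⁻ {n} P∈ with ∈-concatMap⁻ (stLD n) (upTo n) P∈
... | k , _ , P∈′ = k , ∈-stLD⁻ P∈′

∈-triples⁺ : ∀ {k} {P : Triple n} → k < n → IsStLD k P → proj₁ (proj₂ P) ∈ permutations n → P ∈ triples n
∈-triples⁺ {n} {k} {π , w , dv} k<n isP w∈ = ∈-concatMap⁺ (stLD n) (∈.∈-upTo⁺ k<n) (∈.∈-filter⁺ (isStLD? k)
  (∈.∈-cartesianProduct⁺ (∈-paths π) (∈.∈-cartesianProduct⁺ w∈ (∈-allSubsets dv))) isP)

Unique-triples : ∀ n → Unique (triples n)
Unique-triples n = Unique-concatMap (stLD n) (Unique.upTo⁺ n)
  (λ {k} _ → Unique.filter⁺ (isStLD? k) (Unique.cartesianProduct⁺ (Unique-paths n n)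
    (Unique.cartesianProduct⁺ (Unique-permutations n) (Unique-allSubsets n))))
  (λ {k} {k′} {P} _ _ P∈ P∈′ → trans (sym (proj₂ (proj₂ (proj₁ (∈-stLD⁻ {k = k} {P} P∈)))))
    (proj₂ (proj₂ (proj₁ (∈-stLD⁻ {k = k′} {P} P∈′)))))

permutation-labels : ∀ {w : Word n} → w ∈ permutations n →
                     tabulate (λ i → suc (toℕ (lookup w i))) ↭ standardLabels n
permutation-labels {n} {w} w∈ = unique-⊆-length⇒↭
  (Unique.tabulate⁺ (λ eq → ∈-permutations⁻ w∈ _ _ (Fin.toℕ-injective (ℕ.suc-injective eq))))
  (λ l∈ → case ∈.∈-tabulate⁻ l∈ of λ { (i , refl) → ∈.∈-applyDownFrom⁺ suc (Fin.toℕ<n (lookup w i)) })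
  (trans (List.length-tabulate _) (sym (List.length-applyDownFrom suc n)))

module _ (π : Dyck n) (w : Word n) (dv : Subset n) where
  private
    f : Fin n → Cell
    f = cellAt (π , w , dv)
    a c : Fin n → ℕ
    a = lookup (areaWord π)
    c = lookup (columns π)

  valley-adjacent : ∀ i j → toℕ j ≡ suc (toℕ i) → ContractibleValley π w j →
                    a j < a i ⊎ (a j ≡ a i × toℕ (lookup w i) < toℕ (lookup w j))
  valley-adjacent i (suc j) eq (_ , valley)
    with refl ← Fin.toℕ-injective {i = inject₁ j} {i} (trans (Fin.toℕ-inject₁ j) (ℕ.suc-injective eq)) = case valley of λ where
      (inj₁ lt)       → inj₁ lt
      (inj₂ (eq , lt)) → inj₂ (sym eq , lt)

  -- A rise stays in one column, where the labels increase and no contractible valley can be. On a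
  -- level step a decoration supplies the comparison of the labels, and a fall is always allowed.
  follows-adjacent : ColumnIncreasing π w → (∀ i → lookup dv i ≡ true → ContractibleValley π w i) →
                     ∀ i j → toℕ j ≡ suc (toℕ i) → Follows (f i) (f j)
  follows-adjacent increasing valleys i j eq with ℕ.m≤n⇒m<n∨m≡n (area-step-≤ π i j eq) | lookup dv j in dj
  ... | inj₂ rise | false = inj₂ (inj₂ (cong suc rise , refl ,
          s≤s (increasing i j (ℕ.≤-reflexive (sym eq)) (rise⇒sameColumn π i j eq rise))))
  ... | inj₂ rise | true = ⊥-elim (case valley-adjacent i j eq (valleys j dj) of λ where
          (inj₁ lt)        → ℕ.<-asym lt (ℕ.≤-reflexive (sym rise))
          (inj₂ (same , _)) → ℕ.1+n≢n (trans (sym rise) same))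
  ... | inj₁ lt | d with ℕ.m≤n⇒m<n∨m≡n (ℕ.≤-pred lt)
  ... | inj₁ lt′ = inj₁ (s≤s lt′)
  follows-adjacent increasing valleys i j eq | inj₁ lt | false | inj₂ same = inj₂ (inj₁ (cong suc same , inj₁ refl))
  follows-adjacent increasing valleys i j eq | inj₁ lt | true  | inj₂ same =
    inj₂ (inj₁ (cong suc same , inj₂ (case valley-adjacent i j eq (valleys j dj) of λ where
      (inj₁ lt′)       → ⊥-elim (ℕ.<-irrefl same lt′)
      (inj₂ (_ , lt′)) → s≤s lt′)))

  follows-sentinel : (∀ i → lookup dv i ≡ true → ContractibleValley π w i) →
                     ∀ i → toℕ i ≡ 0 → Follows sentinel (f i)
  follows-sentinel valleys i i≡0 with lookup dv i in di
  ... | false = inj₂ (inj₂ (cong suc (area-first π i i≡0) , refl , s≤s z≤n))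
  ... | true  = ⊥-elim (ℕ.<-irrefl (sym i≡0) (proj₁ (valleys i di)))

  -- Columns weakly increase along the path, so all steps between two steps of one column belong to
  -- it, and the comparisons of neighbours chain.
  columnIncreasing : (∀ i j → toℕ j ≡ suc (toℕ i) → Follows (f i) (f j)) → ColumnIncreasing π w
  columnIncreasing adjacent i j i<j same = climb (toℕ j ∸ suc (toℕ i)) i j (sym (ℕ.m∸n+n≡m i<j)) same
    where
    adjacent-increasing : ∀ i j → toℕ j ≡ suc (toℕ i) → c i ≡ c j → lookup w i Fin.< lookup w j
    adjacent-increasing i j eq same with sameColumn⇒rise π i j eq same | adjacent i j eq
    ... | rise | inj₁ lt = ⊥-elim (ℕ.<-asym (ℕ.≤-pred lt) (ℕ.≤-reflexive (sym rise)))
    ... | rise | inj₂ (inj₁ (level , _)) = ⊥-elim (ℕ.1+n≢n (trans (sym rise) (ℕ.suc-injective level)))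
    ... | rise | inj₂ (inj₂ (_ , _ , lt)) = ℕ.≤-pred lt
    climb : ∀ d i j → toℕ j ≡ d + suc (toℕ i) → c i ≡ c j → lookup w i Fin.< lookup w j
    climb zero    i j       eq same = adjacent-increasing i j eq same
    climb (suc d) i (suc j) eq same = ℕ.<-trans (climb d i k k≡ (ℕ.≤-antisym i≤k k≤i))
      (adjacent-increasing k (suc j) (cong suc (sym (Fin.toℕ-inject₁ j))) (trans (ℕ.≤-antisym k≤i i≤k) same))
      where
      k : Fin n
      k = inject₁ j
      k≡ : toℕ k ≡ d + suc (toℕ i)
      k≡ = trans (Fin.toℕ-inject₁ j) (ℕ.suc-injective eq)
      i≤k : c i ≤ c k
      i≤k = columns-mono π i k (ℕ.≤-trans (ℕ.n≤1+n _) (ℕ.≤-trans (ℕ.m≤n+m _ d) (ℕ.≤-reflexive (sym k≡))))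
      k≤i : c k ≤ c i
      k≤i = ℕ.≤-trans (columns-mono π k (suc j) (ℕ.≤-trans (ℕ.≤-reflexive (Fin.toℕ-inject₁ j)) (ℕ.n≤1+n _)))
                      (ℕ.≤-reflexive (sym same))

  contractibleValleys : (∀ i → toℕ i ≡ 0 → Follows sentinel (f i)) →
    (∀ i j → toℕ j ≡ suc (toℕ i) → Follows (f i) (f j)) → ∀ i → lookup dv i ≡ true → ContractibleValley π w i
  contractibleValleys first adjacent zero    di = case first zero refl of λ where
    (inj₂ (inj₂ (_ , d , _))) → contradiction (trans (sym di) d) λ ()
  contractibleValleys first adjacent (suc i) di = s≤s z≤n ,
    (case adjacent (inject₁ i) (suc i) (cong suc (sym (Fin.toℕ-inject₁ i))) of λ where
      (inj₁ lt)                       → inj₁ (ℕ.≤-pred lt)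
      (inj₂ (inj₁ (same , inj₁ d)))   → contradiction (trans (sym di) d) λ ()
      (inj₂ (inj₁ (same , inj₂ lt)))  → inj₂ (sym (ℕ.suc-injective same) , ℕ.≤-pred lt)
      (inj₂ (inj₂ (_ , d , _)))       → contradiction (trans (sym di) d) λ ())

word-valid : ∀ {P : Triple n} → P ∈ triples n → Valid n (word P)
word-valid {n} {P@(π , w , dv)} P∈ with ∈-triples⁻ P∈
... | k , (increasing , valleys , _) , w∈ = record
  { linked         = Linked-tabulate⁺ (cellAt P) (follows-sentinel π w dv valleys′) (follows-adjacent π w dv increasing valleys′)
  ; proper         = All.tabulate⁺ (λ i → s≤s z≤n)
  ; labels-correct = subst (_↭ standardLabels n) (sym (List.map-tabulate (cellAt P) label)) (permutation-labels w∈)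
  }
  where
  valleys′ : ∀ i → lookup dv i ≡ true → ContractibleValley π w i
  valleys′ i di = valleys i (Vec.lookup⇒[]= i dv di)

tabulate-surjective : ∀ (xs : List A) → length xs ≡ n → ∃ λ (f : Fin n → A) → tabulate f ≡ xs
tabulate-surjective xs refl = List.lookup xs , List.tabulate-lookup xs

Follows-≤ : ∀ {p q} → Follows p q → height q ≤ suc (height p)
Follows-≤ (inj₁ lt)                 = ℕ.<⇒≤ (ℕ.m<n⇒m<1+n lt)
Follows-≤ (inj₂ (inj₁ (eq , _)))    = ℕ.m≤n⇒m≤1+n (ℕ.≤-reflexive eq)
Follows-≤ (inj₂ (inj₂ (eq , _)))    = ℕ.≤-reflexive eq

-- The first vertical step is never decorated, so the range `k < n` of the outer sum loses no
-- triple.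
size-≤ : ∀ m (dv : Subset (suc m)) → lookup dv zero ≢ true → ∣ dv ∣ < suc m
size-≤ m (true ∷ dv)  d≢ = contradiction refl d≢
size-≤ m (false ∷ dv) d≢ = s≤s (Subset.∣p∣≤n dv)

Unique-tabulate⁻ : ∀ {f : Fin n → A} → Unique (tabulate f) → ∀ i j → f i ≡ f j → i ≡ j
Unique-tabulate⁻ (f∉ ∷ u) zero    zero    eq = refl
Unique-tabulate⁻ (f∉ ∷ u) zero    (suc j) eq = contradiction eq (All.lookup f∉ (∈.∈-tabulate⁺ j))
Unique-tabulate⁻ (f∉ ∷ u) (suc i) zero    eq = contradiction (sym eq) (All.lookup f∉ (∈.∈-tabulate⁺ i))
Unique-tabulate⁻ (f∉ ∷ u) (suc i) (suc j) eq = cong suc (Unique-tabulate⁻ u i j eq)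

valid⇒∈triples : ∀ {m} (P : Triple (suc m)) → Valid (suc m) (word P) → P ∈ triples (suc m)
valid⇒∈triples {m} P@(π , w , dv) valid = ∈-triples⁺ {k = ∣ dv ∣}
  (size-≤ m dv (λ d → case proj₁ (valleys zero d) of λ ()))
  (columnIncreasing π w dv (proj₂ steps) , (λ i i∈ → valleys i (Vec.[]=⇒lookup i∈)) , refl)
  (∈-permutations⁺ w (λ i j eq → Unique-tabulate⁻ unique i j (cong (suc ∘ toℕ) eq)))
  where
  open Valid valid
  steps : (∀ i → toℕ i ≡ 0 → Follows sentinel (cellAt P i)) ×
          (∀ i j → toℕ j ≡ suc (toℕ i) → Follows (cellAt P i) (cellAt P j))
  steps = Linked-tabulate⁻ (cellAt P) linked
  valleys : ∀ i → lookup dv i ≡ true → ContractibleValley π w i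
  valleys = contractibleValleys π w dv (proj₁ steps) (proj₂ steps)
  unique : Unique (tabulate (λ i → suc (toℕ (lookup w i))))
  unique = subst Unique (List.map-tabulate (cellAt P) label)
    (Unique-resp-↭ (↭.↭-sym labels-correct) (standardLabels-unique (suc m)))

cell-≡ : ∀ {p q} → height p ≡ height q → label p ≡ label q → decorated p ≡ decorated q → p ≡ q
cell-≡ refl refl refl = refl

tripleOf : ∀ (f : Fin n → Cell) → (∀ i → Proper (f i)) →
  (∀ i → toℕ i ≡ 0 → Follows sentinel (f i)) → (∀ i j → toℕ j ≡ suc (toℕ i) → Follows (f i) (f j)) →
  (∀ i → ∃ λ (x : Fin n) → label (f i) ≡ suc (toℕ x)) → ∃ λ (P : Triple n) → ∀ i → cellAt P i ≡ f i
tripleOf {n} f proper first adjacent letter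
  with dyckPath (λ i → ℕ.pred (height (f i)))
    ( (λ i i≡0 → ℕ.n≤0⇒n≡0 (ℕ.pred-mono-≤ (Follows-≤ {sentinel} {f i} (first i i≡0))))
    , (λ i j eq → ℕ.≤-trans (ℕ.pred-mono-≤ (Follows-≤ {f i} {f j} (adjacent i j eq)))
                            (ℕ.≤-reflexive (sym (ℕ.suc-pred (height (f i)) {{ℕ.>-nonZero (proper i)}})))) )
... | π , area-π = (π , Vec.tabulate (proj₁ ∘ letter) , Vec.tabulate (decorated ∘ f)) , λ i → cell-≡
  (trans (cong suc (area-π i)) (ℕ.suc-pred (height (f i)) {{ℕ.>-nonZero (proper i)}}))
  (trans (cong (suc ∘ toℕ) (Vec.lookup∘tabulate (proj₁ ∘ letter) i)) (sym (proj₂ (letter i))))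
  (Vec.lookup∘tabulate (decorated ∘ f) i)

valid⇒word : ∀ {s} → Valid n s → ∃ λ (P : Triple n) → word P ≡ s
valid⇒word {n} {s} valid with tabulate-surjective s (trans (sym (List.length-map label s))
  (trans (↭.↭-length (Valid.labels-correct valid)) (List.length-applyDownFrom suc n)))
... | f , refl = proj₁ P , List.tabulate-cong (proj₂ P)
  where
  open Valid valid
  letter : ∀ i → ∃ λ (x : Fin n) → label (f i) ≡ suc (toℕ x)
  letter i with ∈.∈-applyDownFrom⁻ suc (↭.∈-resp-↭ labels-correct (∈.∈-map⁺ label (∈.∈-tabulate⁺ {f = f} i)))
  ... | l , l<n , eq = Fin.fromℕ< l<n , trans eq (cong suc (sym (Fin.toℕ-fromℕ< l<n)))
  P : ∃ λ (P : Triple n) → ∀ i → cellAt P i ≡ f i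
  P = tripleOf f (All.tabulate⁻ proper) (proj₁ (Linked-tabulate⁻ f linked)) (proj₂ (Linked-tabulate⁻ f linked)) letter

words : ∀ n → List (List Cell)
words n = map word (triples n)

Unique-words : ∀ n → Unique (words n)
Unique-words n = Unique.map⁺ (word-injective _ _) (Unique-triples n)

words-sound : ∀ {n s} → s ∈ words n → Valid n s
words-sound s∈ with ∈.∈-map⁻ word s∈
... | P , P∈ , refl = word-valid P∈

words-complete : ∀ {m s} → Valid (suc m) s → s ∈ words (suc m)
words-complete valid with valid⇒word valid
... | P , refl = ∈.∈-map⁺ word (valid⇒∈triples P valid)

-- Signs and polynomials

signedInversions : List Cell → ℤ
signedInversions []      = 1ℤ
signedInversions (p ∷ s) = Π.Σ[ s ] (λ q → ε[ inverted? p q ]) ℤ.* signedInversions s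

decorationSigns : List Cell → ℤ
decorationSigns s = Π.Σ[ s ] decorationSign

weight-linked : ∀ s → Linked Follows s → weight s ≡ signedInversions s ℤ.* decorationSigns s
weight-linked []      l = refl
weight-linked (p ∷ s) l = trans
  (cong₂ (λ a w → a ℤ.* (decorationSign p ℤ.* Π.Σ[ s ] (λ q → ε[ inverted? p q ])) ℤ.* w)
    (linked⇒admissible s l) (weight-linked s (Linked.tail l)))
  (regroup (decorationSign p) _ (signedInversions s) (decorationSigns s))
  where
  linked⇒admissible : ∀ s → Linked Follows (p ∷ s) → admissible p s ≡ 1ℤ
  linked⇒admissible []      _       = refl
  linked⇒admissible (q ∷ s) (f ∷ _) = ⟦⟧-yes (follows? p q) f
  regroup : ∀ d π i ds → 1ℤ ℤ.* (d ℤ.* π) ℤ.* (i ℤ.* ds) ≡ π ℤ.* i ℤ.* (d ℤ.* ds)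
  regroup = solve-∀

-- All letters lie above the level -1 of the sentinel, so none is inverted with it and the sign is
-- that of the path alone.
weight-sentinel : ∀ {s} → Valid n s → weight (sentinel ∷ s) ≡ signedInversions s ℤ.* decorationSigns s
weight-sentinel {s = s} valid = trans (weight-linked (sentinel ∷ s) linked) (cong₂ ℤ._*_
  (trans (cong (ℤ._* signedInversions s) (trans (Π.Σ-cong s uninverted) (Π.Σ-ε s))) (ℤ.*-identityˡ _))
  (ℤ.*-identityˡ (decorationSigns s)))
  where
  open Valid valid
  uninverted : ∀ {q} → q ∈ s → ε[ inverted? sentinel q ] ≡ 1ℤ
  uninverted {q} q∈ = ε-no (inverted? sentinel q) λ where
    (_ , inj₁ (0≡h , _)) → ℕ.<-irrefl 0≡h (All.lookup proper q∈)

ordered : Dec A → ℤ → ℤ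
ordered (yes _) x = x
ordered (no  _) x = 1ℤ

ordered-cong : (P? : Dec A) (Q? : Dec B) → (A → B) → (B → A) → ∀ x → ordered P? x ≡ ordered Q? x
ordered-cong (yes p) (yes q) f g x = refl
ordered-cong (yes p) (no ¬q) f g x = contradiction (f p) ¬q
ordered-cong (no ¬p) (yes q) f g x = contradiction (g q) ¬p
ordered-cong (no ¬p) (no ¬q) f g x = refl

-- `pairs` runs over the whole square; `ordered` gives the factor 1 to pairs in the wrong order,
-- which leaves the triangle of `signedInversions`.
Π-pairs : ∀ n (f : Fin n → Cell) →
  Π.Σ[ pairs n ] (λ (i , j) → ordered (i Fin.<? j) ε[ inverted? (f i) (f j) ]) ≡ signedInversions (tabulate f)
Π-pairs n f = trans (Π.Σ-cartesianProduct (allFin n) (allFin n)) (rows n f)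
  where
  open ≡-Reasoning
  entry : ∀ {n} (f : Fin n → Cell) → Fin n → Fin n → ℤ
  entry f i j = ordered (i Fin.<? j) ε[ inverted? (f i) (f j) ]
  row : ∀ {n} (f : Fin n → Cell) → Fin n → ℤ
  row {n} f i = Π.Σ[ allFin n ] (entry f i)
  row-zero : ∀ {n} (f : Fin (suc n) → Cell) → row f zero ≡ Π.Σ[ tabulate (f ∘ suc) ] (λ q → ε[ inverted? (f zero) q ])
  row-zero {n} f = trans (Π.Σ-allFin-suc n (entry f zero))
    (trans (ℤ.*-identityˡ (Π.Σ[ allFin n ] (entry f zero ∘ suc))) (sym (Π.Σ-tabulate (f ∘ suc) (λ q → ε[ inverted? (f zero) q ]))))
  row-suc : ∀ {n} (f : Fin (suc n) → Cell) i → row f (suc i) ≡ row (f ∘ suc) i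
  row-suc {n} f i = trans (Π.Σ-allFin-suc n (entry f (suc i)))
    (trans (ℤ.*-identityˡ (Π.Σ[ allFin n ] (entry f (suc i) ∘ suc)))
      (Π.Σ-cong (allFin n) λ {j} _ → ordered-cong (suc i Fin.<? suc j) (i Fin.<? j) ℕ.≤-pred s≤s
        ε[ inverted? (f (suc i)) (f (suc j)) ]))
  rows : ∀ n (f : Fin n → Cell) → Π.Σ[ allFin n ] (row f) ≡ signedInversions (tabulate f)
  rows zero    f = refl
  rows (suc n) f = begin
    Π.Σ[ allFin (suc n) ] (row f)
      ≡⟨ Π.Σ-allFin-suc n (row f) ⟩
    row f zero ℤ.* Π.Σ[ allFin n ] (row f ∘ suc)
      ≡⟨ cong₂ ℤ._*_ (row-zero f) (trans (Π.Σ-cong (allFin n) (λ {i} _ → row-suc f i)) (rows n (f ∘ suc))) ⟩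
    signedInversions (tabulate f) ∎

sign-count : ∀ {P : A → Set} (P? : Decidable P) xs → -1ℤ ℤ.^ count P? xs ≡ Π.Σ[ xs ] (λ x → ε[ P? x ])
sign-count P? []       = refl
sign-count P? (x ∷ xs) with P? x
... | yes _ = cong (-1ℤ ℤ.*_) (sign-count P? xs)
... | no _  = trans (sign-count P? xs) (sym (ℤ.*-identityˡ _))

sign-⊖ : ∀ m n → [-1]^ (m ℤ.⊖ n) ≡ -1ℤ ℤ.^ m ℤ.* -1ℤ ℤ.^ n
sign-⊖ m       zero    = sym (ℤ.*-identityʳ _)
sign-⊖ zero    (suc n) = sym (ℤ.*-identityˡ _)
sign-⊖ (suc m) (suc n) rewrite ℤ.[1+m]⊖[1+n]≡m⊖n m n = trans (sign-⊖ m n) (lemma (-1ℤ ℤ.^ m) (-1ℤ ℤ.^ n))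
  where
  lemma : ∀ x y → x ℤ.* y ≡ (-1ℤ ℤ.* x) ℤ.* (-1ℤ ℤ.* y)
  lemma = solve-∀

sign-size : ∀ n (dv : Subset n) → -1ℤ ℤ.^ ∣ dv ∣ ≡ Π.Σ[ allFin n ] (λ i → if lookup dv i then -1ℤ else 1ℤ)
sign-size zero    []       = refl
sign-size (suc n) (d ∷ dv) = trans (step d) (sym (Π.Σ-allFin-suc n (λ i → if lookup (d ∷ dv) i then -1ℤ else 1ℤ)))
  where
  signs : ℤ
  signs = Π.Σ[ allFin n ] (λ i → if lookup dv i then -1ℤ else 1ℤ)
  step : ∀ d → -1ℤ ℤ.^ ∣ d ∷ dv ∣ ≡ (if d then -1ℤ else 1ℤ) ℤ.* signs
  step true  = cong (-1ℤ ℤ.*_) (sign-size n dv)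
  step false = trans (sign-size n dv) (sym (ℤ.*-identityˡ signs))

size-ℕΣ : ∀ n (dv : Subset n) → ∣ dv ∣ ≡ ℕΣ.Σ[ allFin n ] (λ i → if lookup dv i then 1 else 0)
size-ℕΣ zero    []       = refl
size-ℕΣ (suc n) (d ∷ dv) = trans (step d) (sym (ℕΣ.Σ-allFin-suc n (λ i → if lookup (d ∷ dv) i then 1 else 0)))
  where
  step : ∀ d → ∣ d ∷ dv ∣ ≡ (if d then 1 else 0) + ℕΣ.Σ[ allFin n ] (λ i → if lookup dv i then 1 else 0)
  step true  = cong suc (size-ℕΣ n dv)
  step false = size-ℕΣ n dv

sum-ℕΣ : ∀ n (v : Vec ℕ n) → Vec.sum v ≡ ℕΣ.Σ[ allFin n ] (lookup v)
sum-ℕΣ zero    []      = refl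
sum-ℕΣ (suc n) (k ∷ v) = trans (cong (k +_) (sum-ℕΣ n v)) (sym (ℕΣ.Σ-allFin-suc n (lookup (k ∷ v))))

word-area : ∀ (P : Triple n) → totalArea (word P) ≡ area P
word-area {n} P@(π , _ , _) = trans (ℕΣ.Σ-tabulate (cellAt P) cellArea) (sym (sum-ℕΣ n (areaWord π)))

word-decorations : ∀ (P : Triple n) → totalDecorations (word P) ≡ ∣ proj₂ (proj₂ P) ∣
word-decorations {n} P@(_ , _ , dv) = trans (ℕΣ.Σ-tabulate (cellAt P) decorations) (sym (size-ℕΣ n dv))

ε-⊎ : (P? : Dec A) (Q? : Dec B) (R? : Dec C) → (A → B → ⊥) → (A → C) → (B → C) → (C → A ⊎ B) →
      ε[ P? ] ℤ.* ε[ Q? ] ≡ ε[ R? ]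
ε-⊎ (yes p) (yes q) R?      disjoint f g h = ⊥-elim (disjoint p q)
ε-⊎ (yes p) (no ¬q) (yes r) disjoint f g h = refl
ε-⊎ (yes p) (no ¬q) (no ¬r) disjoint f g h = contradiction (f p) ¬r
ε-⊎ (no ¬p) (yes q) (yes r) disjoint f g h = refl
ε-⊎ (no ¬p) (yes q) (no ¬r) disjoint f g h = contradiction (g q) ¬r
ε-⊎ (no ¬p) (no ¬q) (yes r) disjoint f g h = case h r of λ where
  (inj₁ p) → contradiction p ¬p
  (inj₂ q) → contradiction q ¬q
ε-⊎ (no ¬p) (no ¬q) (no ¬r) disjoint f g h = refl

module _ (π : Dyck n) (w : Word n) (dv : Subset n) where
  private
    P : Triple n
    P = π , w , dv
    prim? : Decidable (PrimaryInv π w dv)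
    prim? = primaryInv? π w dv
    sec? : Decidable (SecondaryInv π w dv)
    sec? = secondaryInv? π w dv

    undecorated : ∀ i → ¬ (dv Vec.[ i ]= true) → lookup dv i ≡ false
    undecorated i i∉ with lookup dv i in di
    ... | true  = contradiction (Vec.lookup⇒[]= i dv di) i∉
    ... | false = refl

    undecorated⁻ : ∀ i → lookup dv i ≡ false → ¬ (dv Vec.[ i ]= true)
    undecorated⁻ i di i∈ = case trans (sym di) (Vec.[]=⇒lookup i∈) of λ ()

    pair-sign : ∀ i j (d : Dec (i Fin.< j)) → ε[ prim? (i , j) ] ℤ.* ε[ sec? (i , j) ] ≡
                ordered d ε[ inverted? (cellAt P i) (cellAt P j) ]
    pair-sign i j (no i≮j)  = cong₂ ℤ._*_ (ε-no (prim? (i , j)) (i≮j ∘ proj₁)) (ε-no (sec? (i , j)) (i≮j ∘ proj₁))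
    pair-sign i j (yes i<j) = ε-⊎ (prim? (i , j)) (sec? (i , j)) (inverted? (cellAt P i) (cellAt P j))
      (λ (_ , _ , lt , _) (_ , _ , gt , _) → ℕ.<-asym lt gt)
      (λ (_ , eq , lt , i∉) → undecorated i i∉ , inj₁ (cong suc eq , s≤s lt))
      (λ (_ , eq , gt , i∉) → undecorated i i∉ , inj₂ (cong suc eq , s≤s gt))
      λ where
        (di , inj₁ (eq , lt)) → inj₁ (i<j , ℕ.suc-injective eq , ℕ.≤-pred lt , undecorated⁻ i di)
        (di , inj₂ (eq , gt)) → inj₂ (i<j , ℕ.suc-injective eq , ℕ.≤-pred gt , undecorated⁻ i di)

  dinv-sign : [-1]^ (dinv P) ≡ signedInversions (word P) ℤ.* decorationSigns (word P)
  dinv-sign = trans (sign-⊖ (count prim? (pairs n) + count sec? (pairs n)) ∣ dv ∣) (cong₂ ℤ._*_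
    (begin
      -1ℤ ℤ.^ (count prim? (pairs n) + count sec? (pairs n))
        ≡⟨ ℤ.^-distribˡ-+-* -1ℤ (count prim? (pairs n)) (count sec? (pairs n)) ⟩
      -1ℤ ℤ.^ count prim? (pairs n) ℤ.* -1ℤ ℤ.^ count sec? (pairs n)
        ≡⟨ cong₂ ℤ._*_ (sign-count prim? (pairs n)) (sign-count sec? (pairs n)) ⟩
      Π.Σ[ pairs n ] (λ ij → ε[ prim? ij ]) ℤ.* Π.Σ[ pairs n ] (λ ij → ε[ sec? ij ])
        ≡⟨ Π.Σ-∙ (pairs n) _ _ ⟨
      Π.Σ[ pairs n ] (λ ij → ε[ prim? ij ] ℤ.* ε[ sec? ij ])
        ≡⟨ Π.Σ-cong (pairs n) (λ { {i , j} _ → pair-sign i j (i Fin.<? j) }) ⟩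
      Π.Σ[ pairs n ] (λ (i , j) → ordered (i Fin.<? j) ε[ inverted? (cellAt P i) (cellAt P j) ])
        ≡⟨ Π-pairs n (cellAt P) ⟩
      signedInversions (word P) ∎)
    (trans (sign-size n dv) (sym (Π.Σ-tabulate (cellAt P) decorationSign))))
    where open ≡-Reasoning

-- Coefficient extraction is the case `indicator a b`. Multiplication by a monomial becomes a shift
-- of the arguments of `ω`, which is how `Ψ` absorbs exponents.
evaluate : (ℕ → ℕ → ℤ) → Poly → ℤ
evaluate ω p = Σ[ p ] (λ (c , a , b) → c ℤ.* ω a b)

indicator : ℕ → ℕ → ℕ → ℕ → ℤ
indicator a b a′ b′ with a′ ℕ.≟ a | b′ ℕ.≟ b
... | yes _ | yes _ = 1ℤ
... | _     | _     = 0ℤ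

coeff≡evaluate : ∀ p a b → coeff p a b ≡ evaluate (indicator a b) p
coeff≡evaluate []                  a b = refl
coeff≡evaluate ((c , a′ , b′) ∷ p) a b with a′ ℕ.≟ a | b′ ℕ.≟ b
... | yes _ | yes _ = cong₂ ℤ._+_ (sym (ℤ.*-identityʳ c)) (coeff≡evaluate p a b)
... | yes _ | no  _ = trans (sym (ℤ.+-identityˡ _)) (cong₂ ℤ._+_ (sym (ℤ.*-zeroʳ c)) (coeff≡evaluate p a b))
... | no  _ | yes _ = trans (sym (ℤ.+-identityˡ _)) (cong₂ ℤ._+_ (sym (ℤ.*-zeroʳ c)) (coeff≡evaluate p a b))
... | no  _ | no  _ = trans (sym (ℤ.+-identityˡ _)) (cong₂ ℤ._+_ (sym (ℤ.*-zeroʳ c)) (coeff≡evaluate p a b))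

evaluate-∑ : ∀ ω (xs : List A) (f : A → Poly) → evaluate ω (∑ xs f) ≡ Σ[ xs ] (λ x → evaluate ω (f x))
evaluate-∑ ω xs f = Σ-concatMap f xs

evaluate-·z : ∀ ω p k → evaluate ω (p · z^ k) ≡ evaluate (λ a b → ω a (b + k)) p
evaluate-·z ω []                k = refl
evaluate-·z ω ((c , a , b) ∷ p) k = cong₂ ℤ._+_
  (cong₂ ℤ._*_ (ℤ.*-identityʳ c) (cong (λ x → ω x (b + k)) (ℕ.+-identityʳ a))) (evaluate-·z ω p k)

pathTerm : ∀ {n} → Triple n → Poly
pathTerm P = t^ (area P) · const ([-1]^ (dinv P))

pathPoly : ∀ n → ℕ → Poly
pathPoly n k = ∑ (stLD n k) pathTerm · z^ k

generatingFunction : ∀ n → Poly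
generatingFunction n = ∑ (upTo n) (pathPoly n)

evaluate-paths : ∀ m ω → evaluate ω (generatingFunction (suc m)) ≡ Σ[ cuts (suc m) ] (λ (i , j) → Ψ m i j ω)
evaluate-paths m ω = begin
  evaluate ω (generatingFunction N)
    ≡⟨ evaluate-∑ ω (upTo N) (pathPoly N) ⟩
  Σ[ upTo N ] (λ k → evaluate ω (pathPoly N k))
    ≡⟨ Σ-cong (upTo N) (λ {k} _ → trans (evaluate-·z ω (∑ (stLD N k) pathTerm) k)
         (trans (evaluate-∑ (λ a b → ω a (b + k)) (stLD N k) pathTerm)
         (Σ-cong (stLD N k) (λ {P} P∈ → term {k} {P} P∈)))) ⟩
  Σ[ upTo N ] (λ k → Σ[ stLD N k ] f)
    ≡⟨ Σ-concatMap (stLD N) (upTo N) ⟨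
  Σ[ triples N ] f
    ≡⟨ Σ-cong (triples N) (λ {P} P∈ → cong₂ ℤ._*_
         (trans (dinv-sign (proj₁ P) (proj₁ (proj₂ P)) (proj₂ (proj₂ P))) (sym (weight-sentinel (word-valid {P = P} P∈))))
         (cong₂ ω (sym (word-area P)) (sym (word-decorations P)))) ⟩
  Σ[ triples N ] (λ P → weight (sentinel ∷ word P) ℤ.* ω (totalArea (word P)) (totalDecorations (word P)))
    ≡⟨ Σ-map word (triples N) ⟨
  Σ[ words N ] (λ s → weight (sentinel ∷ s) ℤ.* ω (totalArea s) (totalDecorations s))
    ≡⟨ Σ-words m (words N) (Unique-words N) words-sound words-complete ω ⟩
  Σ[ cuts N ] (λ (i , j) → Ψ m i j ω) ∎
  where
  open ≡-Reasoning
  N : ℕ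
  N = suc m
  f : Triple N → ℤ
  f P = [-1]^ (dinv P) ℤ.* ω (area P) ∣ proj₂ (proj₂ P) ∣
  term : ∀ {k P} → P ∈ stLD N k → evaluate (λ a b → ω a (b + k)) (pathTerm P) ≡ f P
  term {k} {P} P∈ = trans (ℤ.+-identityʳ _) (cong₂ ℤ._*_ (ℤ.*-identityˡ ([-1]^ (dinv P)))
    (cong₂ ω (ℕ.+-identityʳ (area P)) (sym (proj₂ (proj₂ (proj₁ (∈-stLD⁻ {k = k} {P} P∈)))))))

-- Permutations read from right to left

#[_] : Dec A → ℕ
#[ yes _ ] = 1
#[ no  _ ] = 0

#-cong : (X? : Dec A) (Y? : Dec B) → (A → B) → (B → A) → #[ X? ] ≡ #[ Y? ]
#-cong (yes x) (yes y) f g = refl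
#-cong (yes x) (no ¬y) f g = contradiction (f x) ¬y
#-cong (no ¬x) (yes y) f g = contradiction (g y) ¬x
#-cong (no ¬x) (no ¬y) f g = refl

#-yes : (X? : Dec A) → A → #[ X? ] ≡ 1
#-yes (yes _) x = refl
#-yes (no ¬x) x = contradiction x ¬x

#-no : (X? : Dec A) → ¬ A → #[ X? ] ≡ 0
#-no (yes x) ¬x = contradiction x ¬x
#-no (no _)  ¬x = refl

count-Σ : ∀ {P : A → Set} (P? : Decidable P) xs → count P? xs ≡ ℕΣ.Σ[ xs ] (λ x → #[ P? x ])
count-Σ P? []       = refl
count-Σ P? (x ∷ xs) with P? x
... | yes _ = cong suc (count-Σ P? xs)
... | no _  = count-Σ P? xs

Monotone : ℕ → ℕ → ℕ → Set
Monotone a b c = (a < b × b < c) ⊎ (b < a × c < b)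

monotone? : ∀ a b c → Dec (Monotone a b c)
monotone? a b c = ((a ℕ.<? b) ×-dec (b ℕ.<? c)) ⊎-dec ((b ℕ.<? a) ×-dec (c ℕ.<? b))

-- With a, b, c in the roles of σ_{j-2}, σ_{j-1}, σ_j and y in that of σ_i.
Inversion₃ : ℕ → ℕ → ℕ → ℕ → Set
Inversion₃ a b c y = ((a < b × b < c) × b < y × y < c)
                   ⊎ ((b < a × c < b) × y < b × c < y)
                   ⊎ ((a < b × c < b) × c < y)
                   ⊎ ((b < a × b < c) × y < c)

inversion₃? : ∀ a b c y → Dec (Inversion₃ a b c y)
inversion₃? a b c y = (((a ℕ.<? b) ×-dec (b ℕ.<? c)) ×-dec (b ℕ.<? y) ×-dec (y ℕ.<? c))
  ⊎-dec (((b ℕ.<? a) ×-dec (c ℕ.<? b)) ×-dec (y ℕ.<? b) ×-dec (c ℕ.<? y))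
  ⊎-dec (((a ℕ.<? b) ×-dec (c ℕ.<? b)) ×-dec (c ℕ.<? y))
  ⊎-dec (((b ℕ.<? a) ×-dec (b ℕ.<? c)) ×-dec (y ℕ.<? c))

-- The convention σ₀ = 0 is the value on the empty list.
head₀ : List ℕ → ℕ
head₀ []      = 0
head₀ (x ∷ _) = x

-- The statistics on the reversed word σₙ ∷ … ∷ σ₁ ∷ [].
monotᵣ : List ℕ → ℕ
monotᵣ (c ∷ l@(b ∷ l′)) = #[ monotone? (head₀ l′) b c ] + monotᵣ l
monotᵣ _                = 0

inv₃ᵣ : List ℕ → ℕ
inv₃ᵣ (c ∷ l@(b ∷ l′)) = ℕΣ.Σ[ l ] (λ y → #[ inversion₃? (head₀ l′) b c y ]) + inv₃ᵣ l
inv₃ᵣ _                = 0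

-- The direction lets one argument serve for double ascents and double descents, and one for peaks
-- and valleys.
Before : Bool → ℕ → ℕ → Set
Before true  x y = x < y
Before false x y = y < x

before-not : ∀ d {x y} → Before d x y → Before (not d) y x
before-not true  lt = lt
before-not false lt = lt

before-asym : ∀ d {x y} → Before d x y → ¬ Before d y x
before-asym true  = ℕ.<-asym
before-asym false = ℕ.<-asym

before-trans : ∀ d {x y z} → Before d x y → Before d y z → Before d x z
before-trans true  p q = ℕ.<-trans p q
before-trans false p q = ℕ.<-trans q p

-- Read from the right, `c` is followed by `b` and then by `a`. Continuing in direction `d` is a
-- double ascent (`true`) or a double descent (`false`); turning is a valley (`true`) or a peak
-- (`false`).
module _ {a b c : ℕ} where
  continue-monotone : ∀ d → Before d a b → Before d b c → Monotone a b c
  continue-monotone true  p q = inj₁ (p , q)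
  continue-monotone false p q = inj₂ (p , q)

  turn-monotone : ∀ d → Before d b a → Before d b c → ¬ Monotone a b c
  turn-monotone true  p q (inj₁ (p′ , _)) = ℕ.<-asym p p′
  turn-monotone true  p q (inj₂ (_ , q′)) = ℕ.<-asym q q′
  turn-monotone false p q (inj₁ (_ , q′)) = ℕ.<-asym q q′
  turn-monotone false p q (inj₂ (p′ , _)) = ℕ.<-asym p p′

  continue-inversion⁺ : ∀ d {y} → Before d a b → Before d b c → Before d b y → Before d y c → Inversion₃ a b c y
  continue-inversion⁺ true  p q r s = inj₁ ((p , q) , r , s)
  continue-inversion⁺ false p q r s = inj₂ (inj₁ ((p , q) , r , s))

  continue-inversion⁻ : ∀ d {y} → Before d a b → Before d b c → Inversion₃ a b c y → Before d b y × Before d y c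
  continue-inversion⁻ true  p q (inj₁ (_ , r , s)) = r , s
  continue-inversion⁻ true  p q (inj₂ (inj₁ ((p′ , _) , _))) = ⊥-elim (ℕ.<-asym p p′)
  continue-inversion⁻ true  p q (inj₂ (inj₂ (inj₁ ((_ , q′) , _)))) = ⊥-elim (ℕ.<-asym q q′)
  continue-inversion⁻ true  p q (inj₂ (inj₂ (inj₂ ((p′ , _) , _)))) = ⊥-elim (ℕ.<-asym p p′)
  continue-inversion⁻ false p q (inj₁ ((p′ , _) , _)) = ⊥-elim (ℕ.<-asym p p′)
  continue-inversion⁻ false p q (inj₂ (inj₁ (_ , r , s))) = r , s
  continue-inversion⁻ false p q (inj₂ (inj₂ (inj₁ ((p′ , _) , _)))) = ⊥-elim (ℕ.<-asym p p′)
  continue-inversion⁻ false p q (inj₂ (inj₂ (inj₂ ((_ , q′) , _)))) = ⊥-elim (ℕ.<-asym q q′)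

  turn-inversion⁺ : ∀ d {y} → Before d b a → Before d b c → Before d y c → Inversion₃ a b c y
  turn-inversion⁺ true  p q r = inj₂ (inj₂ (inj₂ ((p , q) , r)))
  turn-inversion⁺ false p q r = inj₂ (inj₂ (inj₁ ((p , q) , r)))

  turn-inversion⁻ : ∀ d {y} → Before d b a → Before d b c → Inversion₃ a b c y → Before d y c
  turn-inversion⁻ true  p q (inj₁ ((p′ , _) , _)) = ⊥-elim (ℕ.<-asym p p′)
  turn-inversion⁻ true  p q (inj₂ (inj₁ ((_ , q′) , _))) = ⊥-elim (ℕ.<-asym q q′)
  turn-inversion⁻ true  p q (inj₂ (inj₂ (inj₁ ((_ , q′) , _)))) = ⊥-elim (ℕ.<-asym q q′)
  turn-inversion⁻ true  p q (inj₂ (inj₂ (inj₂ (_ , r)))) = r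
  turn-inversion⁻ false p q (inj₁ ((_ , q′) , _)) = ⊥-elim (ℕ.<-asym q q′)
  turn-inversion⁻ false p q (inj₂ (inj₁ ((p′ , _) , _))) = ⊥-elim (ℕ.<-asym p p′)
  turn-inversion⁻ false p q (inj₂ (inj₂ (inj₁ (_ , r)))) = r
  turn-inversion⁻ false p q (inj₂ (inj₂ (inj₂ ((_ , q′) , _)))) = ⊥-elim (ℕ.<-asym q q′)

-- The reversed words that extend a last letter v.  The direction d is true if
-- the next letter is smaller than v; R₁ are the unused letters on that side
-- and R₂ those on the other side, each sorted by distance from v.
orders : Bool → ℕ → List ℕ → List ℕ → List (List ℕ)
ordersFrom : Bool → ℕ → List ℕ → List ℕ × ℕ × List ℕ → List (List ℕ)

orders d zero    R₁ R₂ = if d then [] ∷ [] else []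
orders d (suc m) R₁ R₂ = concatMap (ordersFrom d m R₂) (splits R₁)

ordersFrom d m R₂ (X , e , Y) =
  map (e ∷_) (orders d m Y (reverse X ++ R₂) ++ orders (not d) m (reverse X ++ R₂) Y)

-- `Ψ` refined by the direction: what is read after σ₁ is σ₀ = 0, so only the direction `true` may
-- be left at the end.
Ψ± : Bool → ℕ → ℕ → ℕ → (ℕ → ℕ → ℤ) → ℤ
Ψ± d zero    a b ω = if d then ω 0 0 else 0ℤ
Ψ± d (suc m) a b ω = Σ[ cuts a ] λ (i , j) →
  Ψ± d m j (b + i) (λ p q → ω (i + p) (suc q)) ℤ.+ Ψ± (not d) m (b + i) j (λ p q → ω (suc (i + j) + p) q)

Ψ±-cong : ∀ d m {a a′ b b′} ω → a ≡ a′ → b ≡ b′ → Ψ± d m a b ω ≡ Ψ± d m a′ b′ ω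
Ψ±-cong d m ω refl refl = refl

-- At the end exactly one of the two directions survives, and before that a turn merely exchanges
-- them; so adding both removes the direction from the recursion.
Ψ±-sum : ∀ m a b ω → Ψ± true m a b ω ℤ.+ Ψ± false m a b ω ≡ Ψ m a b ω
Ψ±-sum zero    a b ω = ℤ.+-identityʳ (ω 0 0)
Ψ±-sum (suc m) a b ω = trans (sym (Σ-∙ (cuts a) (term true) (term false)))
  (Σ-cong (cuts a) λ { {i , j} _ → trans
    (rearrange (Ψ± true m j (b + i) (λ p q → ω (i + p) (suc q))) (Ψ± false m (b + i) j (λ p q → ω (suc (i + j) + p) q))
               (Ψ± false m j (b + i) (λ p q → ω (i + p) (suc q))) (Ψ± true m (b + i) j (λ p q → ω (suc (i + j) + p) q)))
    (cong₂ ℤ._+_ (Ψ±-sum m j (b + i) _) (Ψ±-sum m (b + i) j _)) })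
  where
  term : Bool → ℕ × ℕ → ℤ
  term d (i , j) = Ψ± d m j (b + i) (λ p q → ω (i + p) (suc q)) ℤ.+ Ψ± (not d) m (b + i) j (λ p q → ω (suc (i + j) + p) q)
  rearrange : ∀ w x y z → (w ℤ.+ x) ℤ.+ (y ℤ.+ z) ≡ (w ℤ.+ y) ℤ.+ (z ℤ.+ x)
  rearrange = solve-∀

private
  continue-↭ : ∀ X (e : ℕ) Y R₂ → e ∷ Y ++ (reverse X ++ R₂) ↭ (X ++ e ∷ Y) ++ R₂
  continue-↭ X e Y R₂ = begin
    (e ∷ Y) ++ (reverse X ++ R₂) ↭⟨ ↭.++⁺ˡ (e ∷ Y) (↭.++⁺ʳ R₂ (↭.↭-reverse X)) ⟩
    (e ∷ Y) ++ (X ++ R₂)         ↭⟨ ↭.shifts (e ∷ Y) X ⟩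
    X ++ (e ∷ Y) ++ R₂           ≡⟨ List.++-assoc X (e ∷ Y) R₂ ⟨
    (X ++ e ∷ Y) ++ R₂           ∎
    where open ↭.PermutationReasoning

  turn-↭ : ∀ X (e : ℕ) Y R₂ → e ∷ (reverse X ++ R₂) ++ Y ↭ (X ++ e ∷ Y) ++ R₂
  turn-↭ X e Y R₂ = ↭.trans (↭.prep e (↭.++-comm (reverse X ++ R₂) Y)) (continue-↭ X e Y R₂)

  continue-length : ∀ {m} X (e : ℕ) Y R₂ → length ((X ++ e ∷ Y) ++ R₂) ≡ suc m → length (Y ++ (reverse X ++ R₂)) ≡ m
  continue-length X e Y R₂ eq = ℕ.suc-injective (trans (↭.↭-length (continue-↭ X e Y R₂)) eq)

  turn-length : ∀ {m} X (e : ℕ) Y R₂ → length ((X ++ e ∷ Y) ++ R₂) ≡ suc m → length ((reverse X ++ R₂) ++ Y) ≡ m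
  turn-length X e Y R₂ eq = ℕ.suc-injective (trans (↭.↭-length (turn-↭ X e Y R₂)) eq)

orders-↭ : ∀ d m R₁ R₂ {l} → length (R₁ ++ R₂) ≡ m → l ∈ orders d m R₁ R₂ → l ↭ R₁ ++ R₂
orders-↭ true  zero [] [] eq (here refl) = ↭.refl
orders-↭ d (suc m) R₁ R₂ eq l∈ with ∈-concatMap⁻ (ordersFrom d m R₂) (splits R₁) l∈
... | (X , e , Y) , t∈ , l∈′ with refl ← ∈-splits⁻ R₁ t∈ | ∈.∈-map⁻ (e ∷_) l∈′
... | l′ , l′∈ , refl = case ∈.∈-++⁻ (orders d m _ _) l′∈ of λ where
  (inj₁ ∈₁) → ↭.trans (↭.prep e (orders-↭ d m _ _ (continue-length X e Y R₂ eq) ∈₁)) (continue-↭ X e Y R₂)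
  (inj₂ ∈₂) → ↭.trans (↭.prep e (orders-↭ (not d) m _ _ (turn-length X e Y R₂ eq) ∈₂)) (turn-↭ X e Y R₂)

-- When the letters are used up, the next value read is σ₀ = 0; here `d` is `true` and `0 < v`
-- enters.
orders-head : ∀ d m R₁ R₂ {v l} → 0 < v → All (λ x → Before d x v) R₁ → l ∈ orders d m R₁ R₂ → Before d (head₀ l) v
orders-head true zero R₁ R₂ v>0 _ (here refl) = v>0
orders-head d (suc m) R₁ R₂ v>0 before l∈ with ∈-concatMap⁻ (ordersFrom d m R₂) (splits R₁) l∈
... | (X , e , Y) , t∈ , l∈′ with refl ← ∈-splits⁻ R₁ t∈ | ∈.∈-map⁻ (e ∷_) l∈′
... | l′ , _ , refl = All.head (All.++⁻ʳ X before)

orders-complete : ∀ m L U l → l ↭ L ++ U → length l ≡ m → l ∈ orders true m L U ++ orders false m U L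
orders-complete zero    L U []      p eq = here refl
orders-complete (suc m) L U (e ∷ l) p eq with ∈.∈-++⁻ L (↭.∈-resp-↭ p (here refl))
... | inj₁ e∈L with ∈.∈-∃++ e∈L
... | X , Y , refl = ∈.∈-++⁺ˡ (∈-concatMap⁺ (ordersFrom true m U) (∈-splits⁺ X) (∈.∈-map⁺ (e ∷_)
  (orders-complete m Y (reverse X ++ U) l (↭.drop-∷ (↭.trans p (↭.↭-sym (continue-↭ X e Y U)))) (ℕ.suc-injective eq))))
orders-complete (suc m) L U (e ∷ l) p eq | inj₂ e∈U with ∈.∈-∃++ e∈U
... | X , Y , refl = ∈.∈-++⁺ʳ (orders true (suc m) L _) (∈-concatMap⁺ (ordersFrom false m L) (∈-splits⁺ X) (∈.∈-map⁺ (e ∷_)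
  (↭.∈-resp-↭ (↭.++-comm (orders true m (reverse X ++ L) Y) (orders false m Y (reverse X ++ L))) (orders-complete m (reverse X ++ L) Y l
    (↭.drop-∷ (↭.trans p (↭.trans (↭.++-comm L (X ++ e ∷ Y)) (↭.↭-sym (turn-↭ X e Y L))))) (ℕ.suc-injective eq)))))

Unique-++⁻ : ∀ {xs ys : List A} → Unique (xs ++ ys) → Unique xs × Unique ys × (∀ {x} → x ∈ xs → x ∈ ys → ⊥)
Unique-++⁻ {xs = xs} u with AllPairs-++⁻ xs u
... | u₁ , u₂ , cross = u₁ , u₂ , λ x∈ x∈′ → All.lookup (All.lookup cross x∈) x∈′ refl

orders-disjoint : ∀ d m R₁ R₂ {l} → Unique (R₁ ++ R₂) → l ∈ orders d m R₁ R₂ → l ∈ orders (not d) m R₂ R₁ → ⊥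
orders-disjoint true  zero R₁ R₂ u _ ()
orders-disjoint d (suc m) R₁ R₂ u l∈ l∈′
  with ∈-concatMap⁻ (ordersFrom d m R₂) (splits R₁) l∈ | ∈-concatMap⁻ (ordersFrom (not d) m R₁) (splits R₂) l∈′
... | (X , e , Y) , t∈ , l∈₁ | (X′ , e′ , Y′) , t∈′ , l∈₂
  with refl ← ∈-splits⁻ R₁ t∈ | refl ← ∈-splits⁻ R₂ t∈′ | ∈.∈-map⁻ (e ∷_) l∈₁ | ∈.∈-map⁻ (e′ ∷_) l∈₂
... | _ , _ , refl | _ , _ , refl = proj₂ (proj₂ (Unique-++⁻ {xs = X ++ e ∷ Y} u)) (∈.∈-insert X) (∈.∈-insert X′)

Unique-orders : ∀ d m R₁ R₂ → Unique (R₁ ++ R₂) → Unique (orders d m R₁ R₂)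
Unique-orders true  zero    R₁ R₂ u = [] ∷ []
Unique-orders false zero    R₁ R₂ u = []
Unique-orders d     (suc m) R₁ R₂ u = Unique-concatMap (ordersFrom d m R₂) (Unique-splits unique₁) pieces
  (λ { {X , e , Y} {X′ , e′ , Y′} t∈ t∈′ l∈ l∈′ → splits-injective unique₁ t∈ t∈′ (heads e e′ l∈ l∈′) })
  where
  unique₁ : Unique R₁
  unique₁ = proj₁ (Unique-++⁻ u)
  heads : ∀ e e′ {l ls ls′} → l ∈ map (e ∷_) ls → l ∈ map (e′ ∷_) ls′ → e ≡ e′
  heads e e′ l∈ l∈′ with ∈.∈-map⁻ (e ∷_) l∈ | ∈.∈-map⁻ (e′ ∷_) l∈′
  ... | _ , _ , refl | _ , _ , refl = refl
  pieces : ∀ {t} → t ∈ splits R₁ → Unique (ordersFrom d m R₂ t)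
  pieces {X , e , Y} t∈ with refl ← ∈-splits⁻ R₁ t∈ = Unique.map⁺ List.∷-injectiveʳ (Unique.++⁺
    (Unique-orders d m _ _ rest)
    (Unique-orders (not d) m _ _ (AllPairs.tail (Unique-resp-↭ (↭.↭-sym (turn-↭ X e Y R₂)) u)))
    (λ (l∈ , l∈′) → orders-disjoint d m Y (reverse X ++ R₂) rest l∈ l∈′))
    where
    rest : Unique (Y ++ (reverse X ++ R₂))
    rest = AllPairs.tail (Unique-resp-↭ (↭.↭-sym (continue-↭ X e Y R₂)) u)

Σ-# : ∀ {P : A → Set} (P? : Decidable P) xs → All P xs → ℕΣ.Σ[ xs ] (λ x → #[ P? x ]) ≡ length xs
Σ-# P? []       []       = refl
Σ-# P? (x ∷ xs) (p ∷ ps) = cong₂ _+_ (#-yes (P? x) p) (Σ-# P? xs ps)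

Σ-#-none : ∀ {P : A → Set} (P? : Decidable P) xs → All (¬_ ∘ P) xs → ℕΣ.Σ[ xs ] (λ x → #[ P? x ]) ≡ 0
Σ-#-none P? []       []        = refl
Σ-#-none P? (x ∷ xs) (¬p ∷ ps) = cong₂ _+_ (#-no (P? x) ¬p) (Σ-#-none P? xs ps)

AllPairs-reverse : ∀ {R : A → A → Set} {xs} → AllPairs R xs → AllPairs (λ x y → R y x) (reverse xs)
AllPairs-reverse {xs = []}     []       = []
AllPairs-reverse {R = R} {x ∷ xs} (r ∷ rs) = subst (AllPairs (λ x y → R y x)) (sym (List.unfold-reverse x xs))
  (AllPairs.++⁺ (AllPairs-reverse rs) ([] ∷ []) (↭.All-resp-↭ (↭.↭-sym (↭.↭-reverse xs)) (All.map (_∷ []) r)))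

record Around (d : Bool) (v : ℕ) (R₁ R₂ : List ℕ) : Set where
  field
    v>0     : 0 < v
    R₁>0    : All (0 <_) R₁
    R₂>0    : All (0 <_) R₂
    sorted₁ : AllPairs (λ x y → Before d y x) (v ∷ R₁)
    sorted₂ : AllPairs (Before d) (v ∷ R₂)

module _ {d v X e Y R₂} (around : Around d v (X ++ e ∷ Y) R₂) where
  open Around around
  private
    parts : AllPairs (λ x y → Before d y x) X × AllPairs (λ x y → Before d y x) (e ∷ Y) ×
            All (λ x → All (λ y → Before d y x) (e ∷ Y)) X
    parts = AllPairs-++⁻ X (AllPairs.tail sorted₁)
    before-v : All (λ x → Before d x v) (X ++ e ∷ Y)
    before-v = AllPairs.head sorted₁
    e-before-v : Before d e v
    e-before-v = All.head (All.++⁻ʳ X before-v)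
    e-before-X : All (Before d e) X
    e-before-X = All.map All.head (proj₂ (proj₂ parts))
    after-e : All (Before d e) (reverse X ++ R₂)
    after-e = All.++⁺ (↭.All-resp-↭ (↭.↭-sym (↭.↭-reverse X)) e-before-X)
                      (All.map (before-trans d e-before-v) (AllPairs.head sorted₂))
    sorted-after : AllPairs (Before d) (reverse X ++ R₂)
    sorted-after = AllPairs.++⁺ (AllPairs-reverse (proj₁ parts)) (AllPairs.tail sorted₂)
      (↭.All-resp-↭ (↭.↭-sym (↭.↭-reverse X)) (All.map (λ x<v → All.map (before-trans d x<v) (AllPairs.head sorted₂))
        (All.++⁻ˡ X before-v)))
    rest>0 : All (0 <_) (reverse X ++ R₂)
    rest>0 = All.++⁺ (↭.All-resp-↭ (↭.↭-sym (↭.↭-reverse X)) (All.++⁻ˡ X R₁>0)) R₂>0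

  e>0 : 0 < e
  e>0 = All.head (All.++⁻ʳ X R₁>0)

  Y-before-e : All (λ y → Before d y e) Y
  Y-before-e = AllPairs.head (proj₁ (proj₂ parts))

  rest-after-e : All (λ y → Before (not d) y e) (reverse X ++ R₂)
  rest-after-e = All.map (before-not d) after-e

  around-continue : Around d e Y (reverse X ++ R₂)
  around-continue = record
    { v>0     = e>0
    ; R₁>0    = All.tail (All.++⁻ʳ X R₁>0)
    ; R₂>0    = rest>0
    ; sorted₁ = proj₁ (proj₂ parts)
    ; sorted₂ = after-e ∷ sorted-after
    }

  around-turn : Around (not d) e (reverse X ++ R₂) Y
  around-turn = record
    { v>0     = e>0
    ; R₁>0    = rest>0
    ; R₂>0    = All.tail (All.++⁻ʳ X R₁>0)
    ; sorted₁ = AllPairs.map (before-not d) (after-e ∷ sorted-after)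
    ; sorted₂ = AllPairs.map (before-not d) (proj₁ (proj₂ parts))
    }

  private
    count-parts : ∀ {a l} → e ∷ l ↭ (X ++ e ∷ Y) ++ R₂ →
      ℕΣ.Σ[ e ∷ l ] (λ y → #[ inversion₃? a e v y ]) ≡
      (ℕΣ.Σ[ X ] (λ y → #[ inversion₃? a e v y ]) + ℕΣ.Σ[ e ∷ Y ] (λ y → #[ inversion₃? a e v y ])) +
      ℕΣ.Σ[ R₂ ] (λ y → #[ inversion₃? a e v y ])
    count-parts p = trans (ℕΣ.Σ-↭ _ p) (trans (ℕΣ.Σ-++ (X ++ e ∷ Y) R₂) (cong (_+ _) (ℕΣ.Σ-++ X (e ∷ Y))))

  -- `R₁` is sorted by distance from `v`, so the letters strictly between `e` and `v` are those of
  -- `X`.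
  count-continue : ∀ {a l} → Before d a e → e ∷ l ↭ (X ++ e ∷ Y) ++ R₂ →
    ℕΣ.Σ[ e ∷ l ] (λ y → #[ inversion₃? a e v y ]) ≡ length X
  count-continue {a} a<e p = trans (count-parts p) (trans (cong₂ _+_ (cong₂ _+_
    (Σ-# (inversion₃? a e v) X (All.zipWith (λ (e<x , x<v) → continue-inversion⁺ d a<e e-before-v e<x x<v)
      (e-before-X , All.++⁻ˡ X before-v)))
    (Σ-#-none (inversion₃? a e v) (e ∷ Y) (All.map (λ (y≮e) inv → y≮e (proj₁ (continue-inversion⁻ d a<e e-before-v inv)))
      ((λ lt → before-asym d lt lt) ∷ All.map (before-asym d) Y-before-e))))
    (Σ-#-none (inversion₃? a e v) R₂ (All.map (λ v<y inv → before-asym d v<y (proj₂ (continue-inversion⁻ d a<e e-before-v inv)))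
      (AllPairs.head sorted₂))))
    (trans (ℕ.+-identityʳ _) (ℕ.+-identityʳ _)))

  count-turn : ∀ {a l} → Before (not d) a e → e ∷ l ↭ (X ++ e ∷ Y) ++ R₂ →
    ℕΣ.Σ[ e ∷ l ] (λ y → #[ inversion₃? a e v y ]) ≡ suc (length X + length Y)
  count-turn {a} e<a p = trans (count-parts p) (trans (cong₂ _+_ (cong₂ _+_
    (Σ-# (inversion₃? a e v) X (All.map (turn-inversion⁺ d e<a′ e-before-v) (All.++⁻ˡ X before-v)))
    (Σ-# (inversion₃? a e v) (e ∷ Y) (All.map (turn-inversion⁺ d e<a′ e-before-v) (All.++⁻ʳ X before-v))))
    (Σ-#-none (inversion₃? a e v) R₂ (All.map (λ v<y inv → before-asym d v<y (turn-inversion⁻ d e<a′ e-before-v inv))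
      (AllPairs.head sorted₂))))
    (trans (ℕ.+-identityʳ _) (ℕ.+-suc (length X) (length Y))))
    where
    e<a′ : Before d e a
    e<a′ = before-not⁻ d e<a
      where
      before-not⁻ : ∀ d {x y} → Before (not d) x y → Before d y x
      before-not⁻ true  lt = lt
      before-not⁻ false lt = lt

  monot-continue : ∀ {a} → Before d a e → #[ monotone? a e v ] ≡ 1
  monot-continue {a} a<e = #-yes (monotone? a e v) (continue-monotone d a<e e-before-v)

  monot-turn : ∀ {a} → Before (not d) a e → #[ monotone? a e v ] ≡ 0
  monot-turn {a} = go d e-before-v
    where
    go : ∀ d → Before d e v → Before (not d) a e → #[ monotone? a e v ] ≡ 0
    go true  e<v e<a = #-no (monotone? a e v) (turn-monotone true e<a e<v)
    go false e<v e<a = #-no (monotone? a e v) (turn-monotone false e<a e<v)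

-- Seen from `e`, the skipped letters `X` join the far side and are the nearest there, hence
-- `reverse X ++ R₂`, where the paths have `R₂ ++ map raise X`. Only the sizes enter the recursion,
-- so the difference disappears.
Σ-orders : ∀ d m v R₁ R₂ (ω : ℕ → ℕ → ℤ) → Around d v R₁ R₂ → length (R₁ ++ R₂) ≡ m →
  Σ[ orders d m R₁ R₂ ] (λ l → ω (inv₃ᵣ (v ∷ l)) (monotᵣ (v ∷ l))) ≡ Ψ± d m (length R₁) (length R₂) ω
Σ-orders true  zero    v R₁ R₂ ω around eq = ℤ.+-identityʳ (ω 0 0)
Σ-orders false zero    v R₁ R₂ ω around eq = refl
Σ-orders d     (suc m) v R₁ R₂ ω around eq =
  trans (Σ-concatMap (ordersFrom d m R₂) (splits R₁)) (Σ-splits R₁ _ term λ { {X , e , Y} t∈ → piece X e Y (∈-splits⁻ R₁ t∈) })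
  where
  term : ℕ × ℕ → ℤ
  term (i , j) = Ψ± d m j (length R₂ + i) (λ p q → ω (i + p) (suc q)) ℤ.+
                 Ψ± (not d) m (length R₂ + i) j (λ p q → ω (suc (i + j) + p) q)
  f : List ℕ → ℤ
  f l = ω (inv₃ᵣ (v ∷ l)) (monotᵣ (v ∷ l))
  piece : ∀ X e Y → R₁ ≡ X ++ e ∷ Y → Σ[ ordersFrom d m R₂ (X , e , Y) ] f ≡ term (length X , length Y)
  piece X e Y refl = begin
    Σ[ map (e ∷_) (continuing ++ turning) ] f
      ≡⟨ trans (Σ-map (e ∷_) (continuing ++ turning)) (Σ-++ continuing turning) ⟩
    Σ[ continuing ] (f ∘ (e ∷_)) ℤ.+ Σ[ turning ] (f ∘ (e ∷_))
      ≡⟨ cong₂ ℤ._+_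
           (Σ-cong continuing λ {l} l∈ → let a<e = orders-head d m Y (reverse X ++ R₂) (e>0 around) (Y-before-e around) l∈ in
             cong₂ ω (cong (_+ inv₃ᵣ (e ∷ l)) (count-continue around a<e (↭.trans
                       (↭.prep e (orders-↭ d m Y (reverse X ++ R₂) (continue-length X e Y R₂ eq) l∈)) (continue-↭ X e Y R₂))))
                     (cong (_+ monotᵣ (e ∷ l)) (monot-continue around a<e)))
           (Σ-cong turning λ {l} l∈ → let a<e = orders-head (not d) m (reverse X ++ R₂) Y (e>0 around) (rest-after-e around) l∈ in
             cong₂ ω (cong (_+ inv₃ᵣ (e ∷ l)) (count-turn around a<e (↭.trans
                       (↭.prep e (orders-↭ (not d) m (reverse X ++ R₂) Y (turn-length X e Y R₂ eq) l∈)) (turn-↭ X e Y R₂))))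
                     (cong (_+ monotᵣ (e ∷ l)) (monot-turn around a<e))) ⟩
    Σ[ continuing ] (λ l → ω (length X + inv₃ᵣ (e ∷ l)) (suc (monotᵣ (e ∷ l)))) ℤ.+
    Σ[ turning ] (λ l → ω (suc (length X + length Y) + inv₃ᵣ (e ∷ l)) (monotᵣ (e ∷ l)))
      ≡⟨ cong₂ ℤ._+_
           (trans (Σ-orders d m e Y (reverse X ++ R₂) (λ p q → ω (length X + p) (suc q))
                    (around-continue around) (continue-length X e Y R₂ eq))
                  (Ψ±-cong d m _ refl rest-length))
           (trans (Σ-orders (not d) m e (reverse X ++ R₂) Y (λ p q → ω (suc (length X + length Y) + p) q)
                    (around-turn around) (turn-length X e Y R₂ eq))
                  (Ψ±-cong (not d) m _ rest-length refl)) ⟩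
    term (length X , length Y) ∎
    where
    open ≡-Reasoning
    continuing turning : List (List ℕ)
    continuing = orders d m Y (reverse X ++ R₂)
    turning    = orders (not d) m (reverse X ++ R₂) Y
    rest-length : length (reverse X ++ R₂) ≡ length R₂ + length X
    rest-length = trans (List.length-++ (reverse X)) (trans (cong (_+ length R₂) (List.length-reverse X)) (ℕ.+-comm (length X) _))

-- In the decreasing list of labels, `X` holds the letters above `v`, farthest first, and `Y` those
-- below, nearest first; hence the reversal. Both directions are possible after the last letter `v`
-- of the permutation.
startingOrders : ℕ → List ℕ × ℕ × List ℕ → List (List ℕ)
startingOrders m (X , v , Y) = map (v ∷_) (orders true m Y (reverse X) ++ orders false m (reverse X) Y)

allOrders : ℕ → List (List ℕ)
allOrders m = concatMap (startingOrders m) (splits (standardLabels (suc m)))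

private
  start-↭ : ∀ (X : List ℕ) v Y → v ∷ Y ++ reverse X ↭ X ++ v ∷ Y
  start-↭ X v Y = ↭.trans (↭.++⁺ˡ (v ∷ Y) (↭.↭-reverse X)) (↭.++-comm (v ∷ Y) X)

  start-length : ∀ {m} X v Y → standardLabels (suc m) ≡ X ++ v ∷ Y → length (Y ++ reverse X) ≡ m
  start-length {m} X v Y eq = ℕ.suc-injective (trans (↭.↭-length (start-↭ X v Y))
    (trans (cong length (sym eq)) (List.length-applyDownFrom suc (suc m))))

  start-length′ : ∀ {m} X v Y → standardLabels (suc m) ≡ X ++ v ∷ Y → length (reverse X ++ Y) ≡ m
  start-length′ X v Y eq = trans (↭.↭-length (↭.++-comm (reverse X) Y)) (start-length X v Y eq)

  start-unique : ∀ {m} X v Y → standardLabels (suc m) ≡ X ++ v ∷ Y → Unique (Y ++ reverse X)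
  start-unique {m} X v Y eq = AllPairs.tail (Unique-resp-↭ (↭.↭-sym (start-↭ X v Y))
    (subst Unique eq (standardLabels-unique (suc m))))

allOrders-↭ : ∀ m {l} → l ∈ allOrders m → l ↭ standardLabels (suc m)
allOrders-↭ m l∈ with ∈-concatMap⁻ (startingOrders m) (splits (standardLabels (suc m))) l∈
... | (X , v , Y) , t∈ , l∈′ with ∈-splits⁻ (standardLabels (suc m)) t∈ | ∈.∈-map⁻ (v ∷_) l∈′
... | eq | l′ , l′∈ , refl = subst (v ∷ l′ ↭_) (sym eq) (↭.trans (↭.prep v rest) (start-↭ X v Y))
  where
  rest : l′ ↭ Y ++ reverse X
  rest = case ∈.∈-++⁻ (orders true m Y (reverse X)) l′∈ of λ where
    (inj₁ ∈₁) → orders-↭ true m Y (reverse X) (start-length X v Y eq) ∈₁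
    (inj₂ ∈₂) → ↭.trans (orders-↭ false m (reverse X) Y (start-length′ X v Y eq) ∈₂) (↭.++-comm (reverse X) Y)

allOrders-complete : ∀ m {l} → l ↭ standardLabels (suc m) → l ∈ allOrders m
allOrders-complete m {[]}    p = contradiction (↭.↭-sym p) ↭.¬x∷xs↭[]
allOrders-complete m {v ∷ l} p with ∈.∈-∃++ (↭.∈-resp-↭ p (here refl))
... | X , Y , eq = ∈-concatMap⁺ (startingOrders m) (subst (λ s → (X , v , Y) ∈ splits s) (sym eq) (∈-splits⁺ X))
  (∈.∈-map⁺ (v ∷_) (orders-complete m Y (reverse X) l rest (trans (↭.↭-length rest) (start-length X v Y eq))))
  where
  rest : l ↭ Y ++ reverse X
  rest = ↭.drop-∷ (↭.trans (subst (v ∷ l ↭_) eq p) (↭.↭-sym (start-↭ X v Y)))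

Unique-allOrders : ∀ m → Unique (allOrders m)
Unique-allOrders m = Unique-concatMap (startingOrders m) (Unique-splits labels-unique)
  (λ { {X , v , Y} t∈ → let u = start-unique X v Y (∈-splits⁻ _ t∈) in
    Unique.map⁺ List.∷-injectiveʳ (Unique.++⁺ (Unique-orders true m Y (reverse X) u)
      (Unique-orders false m (reverse X) Y (Unique-resp-↭ (↭.++-comm Y (reverse X)) u))
      (λ (l∈ , l∈′) → orders-disjoint true m Y (reverse X) u l∈ l∈′)) })
  (λ { {X , v , Y} {X′ , v′ , Y′} t∈ t∈′ l∈ l∈′ → splits-injective labels-unique t∈ t∈′ (heads v v′ l∈ l∈′) })
  where
  labels-unique : Unique (standardLabels (suc m))
  labels-unique = standardLabels-unique (suc m)
  heads : ∀ v v′ {l ls ls′} → l ∈ map (v ∷_) ls → l ∈ map (v′ ∷_) ls′ → v ≡ v′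
  heads v v′ l∈ l∈′ with ∈.∈-map⁻ (v ∷_) l∈ | ∈.∈-map⁻ (v′ ∷_) l∈′
  ... | _ , _ , refl | _ , _ , refl = refl

start-around : ∀ {m} X v Y → standardLabels (suc m) ≡ X ++ v ∷ Y →
               Around true v Y (reverse X) × Around false v (reverse X) Y
start-around {m} X v Y eq with AllPairs-++⁻ X (subst (AllPairs _>_) eq (standardLabels-descending (suc m)))
                             | subst (All (0 <_)) eq (standardLabels-positive (suc m))
... | X> , Y> , X>vY | positive =
  record { v>0 = v>0 ; R₁>0 = Y>0 ; R₂>0 = X>0 ; sorted₁ = Y> ; sorted₂ = X↑ } ,
  record { v>0 = v>0 ; R₁>0 = X>0 ; R₂>0 = Y>0 ; sorted₁ = X↑ ; sorted₂ = Y> }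
  where
  v>0 : 0 < v
  v>0 = All.head (All.++⁻ʳ X positive)
  Y>0 : All (0 <_) Y
  Y>0 = All.tail (All.++⁻ʳ X positive)
  X>0 : All (0 <_) (reverse X)
  X>0 = ↭.All-resp-↭ (↭.↭-sym (↭.↭-reverse X)) (All.++⁻ˡ X positive)
  X↑ : AllPairs _<_ (v ∷ reverse X)
  X↑ = ↭.All-resp-↭ (↭.↭-sym (↭.↭-reverse X)) (All.map All.head X>vY) ∷ AllPairs-reverse X>

Σ-allOrders : ∀ m (ω : ℕ → ℕ → ℤ) →
  Σ[ allOrders m ] (λ l → ω (inv₃ᵣ l) (monotᵣ l)) ≡ Σ[ cuts (suc m) ] (λ (i , j) → Ψ m i j ω)
Σ-allOrders m ω = begin
  Σ[ allOrders m ] f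
    ≡⟨ Σ-concatMap (startingOrders m) (splits (standardLabels (suc m))) ⟩
  Σ[ splits (standardLabels (suc m)) ] (λ t → Σ[ startingOrders m t ] f)
    ≡⟨ Σ-splits (standardLabels (suc m)) (λ t → Σ[ startingOrders m t ] f)
         (λ (i , j) → Ψ± true m j i ω ℤ.+ Ψ± false m i j ω)
         (λ { {X , v , Y} t∈ → piece X v Y (∈-splits⁻ _ t∈) }) ⟩
  Σ[ cuts (length (standardLabels (suc m))) ] (λ (i , j) → Ψ± true m j i ω ℤ.+ Ψ± false m i j ω)
    ≡⟨ cong (λ k → Σ[ cuts k ] (λ (i , j) → Ψ± true m j i ω ℤ.+ Ψ± false m i j ω)) (List.length-applyDownFrom suc (suc m)) ⟩
  Σ[ cuts (suc m) ] (λ (i , j) → Ψ± true m j i ω ℤ.+ Ψ± false m i j ω)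
    ≡⟨ Σ-∙ (cuts (suc m)) (λ (i , j) → Ψ± true m j i ω) (λ (i , j) → Ψ± false m i j ω) ⟩
  Σ[ cuts (suc m) ] (λ (i , j) → Ψ± true m j i ω) ℤ.+ Σ[ cuts (suc m) ] (λ (i , j) → Ψ± false m i j ω)
    -- Exchanging the numbers of larger and of smaller letters gives both directions the same sizes,
    -- so that `Ψ±-sum` applies.
    ≡⟨ cong (ℤ._+ Σ[ cuts (suc m) ] (λ (i , j) → Ψ± false m i j ω)) (Σ-cuts-swap (suc m) (λ (i , j) → Ψ± true m j i ω)) ⟩
  Σ[ cuts (suc m) ] (λ (i , j) → Ψ± true m i j ω) ℤ.+ Σ[ cuts (suc m) ] (λ (i , j) → Ψ± false m i j ω)
    ≡⟨ Σ-∙ (cuts (suc m)) (λ (i , j) → Ψ± true m i j ω) (λ (i , j) → Ψ± false m i j ω) ⟨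
  Σ[ cuts (suc m) ] (λ (i , j) → Ψ± true m i j ω ℤ.+ Ψ± false m i j ω)
    ≡⟨ Σ-cong (cuts (suc m)) (λ { {i , j} _ → Ψ±-sum m i j ω }) ⟩
  Σ[ cuts (suc m) ] (λ (i , j) → Ψ m i j ω) ∎
  where
  open ≡-Reasoning
  f : List ℕ → ℤ
  f l = ω (inv₃ᵣ l) (monotᵣ l)
  piece : ∀ X v Y → standardLabels (suc m) ≡ X ++ v ∷ Y →
          Σ[ startingOrders m (X , v , Y) ] f ≡ Ψ± true m (length Y) (length X) ω ℤ.+ Ψ± false m (length X) (length Y) ω
  piece X v Y eq = trans (Σ-map (v ∷_) (orders true m Y (reverse X) ++ orders false m (reverse X) Y))
    (trans (Σ-++ (orders true m Y (reverse X)) (orders false m (reverse X) Y)) (cong₂ ℤ._+_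
      (trans (Σ-orders true m v Y (reverse X) ω (proj₁ (start-around X v Y eq)) (start-length X v Y eq))
             (Ψ±-cong true m ω refl (List.length-reverse X)))
      (trans (Σ-orders false m v (reverse X) Y ω (proj₂ (start-around X v Y eq)) (start-length′ X v Y eq))
             (Ψ±-cong false m ω (List.length-reverse X) refl))))

-- Permutations and their reversed words

reversedWord : Word n → List ℕ
reversedWord σ = reverse (tabulate (λ i → suc (toℕ (lookup σ i))))

reversedWord-injective : ∀ {σ τ : Word n} → reversedWord σ ≡ reversedWord τ → σ ≡ τ
reversedWord-injective eq = lookup-ext λ i →
  Fin.toℕ-injective (ℕ.suc-injective (tabulate-injective (List.reverse-injective eq) i))

reversedWord-sound : ∀ {σ : Word n} → σ ∈ permutations n → reversedWord σ ↭ standardLabels n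
reversedWord-sound σ∈ = ↭.trans (↭.↭-reverse _) (permutation-labels σ∈)

reversedWord-complete : ∀ {l} → l ↭ standardLabels n → ∃ λ (σ : Word n) → σ ∈ permutations n × reversedWord σ ≡ l
reversedWord-complete {n} {l} p with tabulate-surjective (reverse l)
    (trans (List.length-reverse l) (trans (↭.↭-length p) (List.length-applyDownFrom suc n)))
... | f , eq = σ , ∈-permutations⁺ σ injective , trans (cong reverse letters) (List.reverse-involutive l)
  where
  tabulate↭ : tabulate f ↭ standardLabels n
  tabulate↭ = ↭.trans (↭.↭-reflexive eq) (↭.trans (↭.↭-reverse l) p)
  letter : ∀ i → ∃ λ (x : Fin n) → f i ≡ suc (toℕ x)
  letter i with ∈.∈-applyDownFrom⁻ suc (↭.∈-resp-↭ tabulate↭ (∈.∈-tabulate⁺ {f = f} i))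
  ... | l , l<n , eq = Fin.fromℕ< l<n , trans eq (cong suc (sym (Fin.toℕ-fromℕ< l<n)))
  σ : Word n
  σ = Vec.tabulate (proj₁ ∘ letter)
  σ-letter : ∀ i → suc (toℕ (lookup σ i)) ≡ f i
  σ-letter i = trans (cong (suc ∘ toℕ) (Vec.lookup∘tabulate (proj₁ ∘ letter) i)) (sym (proj₂ (letter i)))
  letters : tabulate (λ i → suc (toℕ (lookup σ i))) ≡ reverse l
  letters = trans (List.tabulate-cong σ-letter) eq
  injective : ∀ i j → lookup σ i ≡ lookup σ j → i ≡ j
  injective i j same = Unique-tabulate⁻ (Unique-resp-↭ (↭.↭-sym tabulate↭) (standardLabels-unique n)) i j
    (trans (sym (σ-letter i)) (trans (cong (suc ∘ toℕ) same) (σ-letter j)))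

-- Indices in ℕ make the predecessors in the statistics compute; the default 0 lies beyond all
-- positions in use.
nth : Vec ℕ n → ℕ → ℕ
nth []      _       = 0
nth (x ∷ v) zero    = x
nth (x ∷ v) (suc j) = nth v j

nth-lookup : ∀ (v : Vec ℕ n) i → lookup v i ≡ nth v (toℕ i)
nth-lookup (x ∷ v) zero    = refl
nth-lookup (x ∷ v) (suc i) = nth-lookup v i

toℕ-pred : ∀ (i : Fin n) → toℕ (Fin.pred i) ≡ ℕ.pred (toℕ i)
toℕ-pred zero    = refl
toℕ-pred (suc i) = Fin.toℕ-inject₁ i

Σ-downFrom-suc : ∀ k (g : ℕ → ℕ) → ℕΣ.Σ[ downFrom (suc k) ] g ≡ g 0 + ℕΣ.Σ[ downFrom k ] (g ∘ suc)
Σ-downFrom-suc zero    g = refl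
Σ-downFrom-suc (suc k) g = trans (cong (g (suc k) +_) (Σ-downFrom-suc k g)) (lemma (g (suc k)) (g 0) _)
  where
  lemma : ∀ a b c → a + (b + c) ≡ b + (a + c)
  lemma = ℕ-solve-∀

Σ-allFin-toℕ : ∀ k (g : ℕ → ℕ) → ℕΣ.Σ[ allFin k ] (g ∘ toℕ) ≡ ℕΣ.Σ[ downFrom k ] g
Σ-allFin-toℕ zero    g = refl
Σ-allFin-toℕ (suc k) g = trans (ℕΣ.Σ-allFin-suc k (g ∘ toℕ))
  (trans (cong (g 0 +_) (Σ-allFin-toℕ k (g ∘ suc))) (sym (Σ-downFrom-suc k g)))

Σ-applyDownFrom : ∀ (f : ℕ → ℕ) k (g : ℕ → ℕ) → ℕΣ.Σ[ applyDownFrom f k ] g ≡ ℕΣ.Σ[ downFrom k ] (g ∘ f)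
Σ-applyDownFrom f zero    g = refl
Σ-applyDownFrom f (suc k) g = cong (g (f k) +_) (Σ-applyDownFrom f k g)

module _ (s : ℕ → ℕ) (s0≡0 : s 0 ≡ 0) where
  private
    letters : ℕ → List ℕ
    letters = applyDownFrom (s ∘ suc)

    head₀-letters : ∀ k → head₀ (letters k) ≡ s k
    head₀-letters zero    = sym s0≡0
    head₀-letters (suc k) = refl

  monotTerm : ℕ → ℕ
  monotTerm j = #[ (2 ℕ.≤? j) ×-dec monotone? (s (ℕ.pred (ℕ.pred j))) (s (ℕ.pred j)) (s j) ]

  inv₃Term : ℕ → ℕ → ℕ
  inv₃Term i j = #[ (1 ℕ.≤? i) ×-dec (i ℕ.<? j) ×-dec (2 ℕ.≤? j) ×-dec
                    inversion₃? (s (ℕ.pred (ℕ.pred j))) (s (ℕ.pred j)) (s j) (s i) ]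

  Σ-monotTerm : ∀ k → ℕΣ.Σ[ downFrom (suc k) ] monotTerm ≡ monotᵣ (letters k)
  Σ-monotTerm zero          = refl
  Σ-monotTerm (suc zero)    = refl
  Σ-monotTerm (suc (suc k)) = cong₂ _+_ term (Σ-monotTerm (suc k))
    where
    term : monotTerm (suc (suc k)) ≡ #[ monotone? (head₀ (letters k)) (s (suc k)) (s (suc (suc k))) ]
    term rewrite head₀-letters k = #-cong ((2 ℕ.≤? suc (suc k)) ×-dec monotone? (s k) (s (suc k)) (s (suc (suc k))))
      (monotone? (s k) (s (suc k)) (s (suc (suc k)))) proj₂ (λ mono → s≤s (s≤s z≤n) , mono)

  -- Enlarging the square of index pairs by the index `k` adds a row that vanishes, as `i < j` fails
  -- in it, and the column of the 3-inversions that end at position `k`.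
  Σ-inv₃Term : ∀ k → ℕΣ.Σ[ downFrom (suc k) ] (λ i → ℕΣ.Σ[ downFrom (suc k) ] (inv₃Term i)) ≡ inv₃ᵣ (letters k)
  Σ-inv₃Term k = trans (square k) (column k)
    where
    open ≡-Reasoning
    triangle : ℕ → ℕ
    triangle k = ℕΣ.Σ[ downFrom k ] (λ i → ℕΣ.Σ[ downFrom k ] (inv₃Term i))
    below-diagonal : ∀ k → ℕΣ.Σ[ downFrom (suc k) ] (inv₃Term k) ≡ 0
    below-diagonal k = trans (ℕΣ.Σ-cong (downFrom (suc k)) {g = λ _ → 0} λ {j} j∈ → #-no
        ((1 ℕ.≤? k) ×-dec (k ℕ.<? j) ×-dec (2 ℕ.≤? j) ×-dec
          inversion₃? (s (ℕ.pred (ℕ.pred j))) (s (ℕ.pred j)) (s j) (s k))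
        (λ (_ , k<j , _) → ℕ.<⇒≱ (∈.∈-downFrom⁻ j∈) k<j))
      (ℕΣ.Σ-ε (downFrom (suc k)))
    square : ∀ k → triangle (suc k) ≡ ℕΣ.Σ[ downFrom k ] (λ i → inv₃Term i k) + triangle k
    square k = cong₂ _+_ (below-diagonal k)
      (ℕΣ.Σ-∙ (downFrom k) (λ i → inv₃Term i k) (λ i → ℕΣ.Σ[ downFrom k ] (inv₃Term i)))
    column : ∀ k → ℕΣ.Σ[ downFrom k ] (λ i → inv₃Term i k) + triangle k ≡ inv₃ᵣ (letters k)
    column zero          = refl
    column (suc zero)    = refl
    column (suc (suc k)) = cong₂ _+_ (begin
        ℕΣ.Σ[ downFrom (suc (suc k)) ] (λ i → inv₃Term i (suc (suc k)))
          -- The term of index 0 computes to 0 because of the guard `1 ≤ i`.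
          ≡⟨ Σ-downFrom-suc (suc k) (λ i → inv₃Term i (suc (suc k))) ⟩
        ℕΣ.Σ[ downFrom (suc k) ] (λ i → inv₃Term (suc i) (suc (suc k)))
          ≡⟨ ℕΣ.Σ-cong (downFrom (suc k)) (λ {i} i∈ → term i (∈.∈-downFrom⁻ i∈)) ⟩
        ℕΣ.Σ[ downFrom (suc k) ] (λ i → #[ inversion₃? (head₀ (letters k)) (s (suc k)) (s (suc (suc k))) (s (suc i)) ])
          ≡⟨ Σ-applyDownFrom (s ∘ suc) (suc k) _ ⟨
        ℕΣ.Σ[ letters (suc k) ] (λ y → #[ inversion₃? (head₀ (letters k)) (s (suc k)) (s (suc (suc k))) y ]) ∎)
      (trans (square (suc k)) (column (suc k)))
      where
      term : ∀ i → i < suc k → inv₃Term (suc i) (suc (suc k)) ≡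
                               #[ inversion₃? (head₀ (letters k)) (s (suc k)) (s (suc (suc k))) (s (suc i)) ]
      term i i<k rewrite head₀-letters k = #-cong
        ((1 ℕ.≤? suc i) ×-dec (suc i ℕ.<? suc (suc k)) ×-dec (2 ℕ.≤? suc (suc k)) ×-dec
          inversion₃? (s k) (s (suc k)) (s (suc (suc k))) (s (suc i)))
        (inversion₃? (s k) (s (suc k)) (s (suc (suc k))) (s (suc i)))
        (λ (_ , _ , _ , inv) → inv) (λ inv → s≤s z≤n , s≤s i<k , s≤s (s≤s z≤n) , inv)

tabulate-toℕ : ∀ n (g : ℕ → A) → tabulate {n = n} (g ∘ toℕ) ≡ applyUpTo g n
tabulate-toℕ zero    g = refl
tabulate-toℕ (suc n) g = cong (g 0 ∷_) (tabulate-toℕ n (g ∘ suc))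

module _ (σ : Word n) where
  private
    s : ℕ → ℕ
    s = nth (extended σ)

    σ₀ σ₁ σ₂ : Fin (suc n) → ℕ
    σ₀ i = lookup (extended σ) i
    σ₁ i = lookup (extended σ) (Fin.pred i)
    σ₂ i = lookup (extended σ) (Fin.pred (Fin.pred i))

    σ₀≡ : ∀ i → σ₀ i ≡ s (toℕ i)
    σ₀≡ = nth-lookup (extended σ)

    σ₁≡ : ∀ i → σ₁ i ≡ s (ℕ.pred (toℕ i))
    σ₁≡ i = trans (σ₀≡ (Fin.pred i)) (cong s (toℕ-pred i))

    σ₂≡ : ∀ i → σ₂ i ≡ s (ℕ.pred (ℕ.pred (toℕ i)))
    σ₂≡ i = trans (σ₁≡ (Fin.pred i)) (cong (s ∘ ℕ.pred) (toℕ-pred i))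

    reversedWord-letters : reversedWord σ ≡ applyDownFrom (s ∘ suc) n
    reversedWord-letters = begin
      reverse (tabulate (λ i → suc (toℕ (lookup σ i))))
        ≡⟨ cong reverse (List.tabulate-cong (λ i → trans (sym (Vec.lookup-map i (λ l → suc (toℕ l)) σ)) (σ₀≡ (suc i)))) ⟩
      reverse (tabulate {n = n} (λ i → s (suc (toℕ i))))
        ≡⟨ cong reverse (tabulate-toℕ n (s ∘ suc)) ⟩
      reverse (applyUpTo (s ∘ suc) n)
        ≡⟨ List.reverse-applyUpTo (s ∘ suc) n ⟩
      applyDownFrom (s ∘ suc) n ∎
      where open ≡-Reasoning

    cong₄ : ∀ (f : ℕ → ℕ → ℕ → ℕ → ℕ) {a a′ b b′ c c′ y y′} →
            a ≡ a′ → b ≡ b′ → c ≡ c′ → y ≡ y′ → f a b c y ≡ f a′ b′ c′ y′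
    cong₄ f refl refl refl refl = refl

    monot-term : ∀ i → #[ doubleAscent? σ i ⊎-dec doubleDescent? σ i ] ≡ monotTerm s refl (toℕ i)
    monot-term i = trans
      (#-cong (doubleAscent? σ i ⊎-dec doubleDescent? σ i) ((2 ℕ.≤? toℕ i) ×-dec monotone? (σ₂ i) (σ₁ i) (σ₀ i))
        (λ { (inj₁ (2≤i , asc)) → 2≤i , inj₁ asc ; (inj₂ (2≤i , desc)) → 2≤i , inj₂ desc })
        (λ { (2≤i , inj₁ asc) → inj₁ (2≤i , asc) ; (2≤i , inj₂ desc) → inj₂ (2≤i , desc) }))
      (cong₄ (λ a b c _ → #[ (2 ℕ.≤? toℕ i) ×-dec monotone? a b c ]) (σ₂≡ i) (σ₁≡ i) (σ₀≡ i) (refl {x = 0}))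

    inv₃-term : ∀ i j → #[ threeInv? σ (i , j) ] ≡ inv₃Term s refl (toℕ i) (toℕ j)
    inv₃-term i j = trans
      (#-cong (threeInv? σ (i , j))
        ((1 ℕ.≤? toℕ i) ×-dec (toℕ i ℕ.<? toℕ j) ×-dec (2 ℕ.≤? toℕ j) ×-dec inversion₃? (σ₂ j) (σ₁ j) (σ₀ j) (σ₀ i))
        (λ where
          (p , q , inj₁ ((2≤j , type) , r))               → p , q , 2≤j , inj₁ (type , r)
          (p , q , inj₂ (inj₁ ((2≤j , type) , r)))        → p , q , 2≤j , inj₂ (inj₁ (type , r))
          (p , q , inj₂ (inj₂ (inj₁ ((2≤j , type) , r)))) → p , q , 2≤j , inj₂ (inj₂ (inj₁ (type , r)))
          (p , q , inj₂ (inj₂ (inj₂ ((2≤j , type) , r)))) → p , q , 2≤j , inj₂ (inj₂ (inj₂ (type , r))))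
        (λ where
          (p , q , 2≤j , inj₁ (type , r))               → p , q , inj₁ ((2≤j , type) , r)
          (p , q , 2≤j , inj₂ (inj₁ (type , r)))        → p , q , inj₂ (inj₁ ((2≤j , type) , r))
          (p , q , 2≤j , inj₂ (inj₂ (inj₁ (type , r)))) → p , q , inj₂ (inj₂ (inj₁ ((2≤j , type) , r)))
          (p , q , 2≤j , inj₂ (inj₂ (inj₂ (type , r)))) → p , q , inj₂ (inj₂ (inj₂ ((2≤j , type) , r)))))
      (cong₄ (λ a b c y → #[ (1 ℕ.≤? toℕ i) ×-dec (toℕ i ℕ.<? toℕ j) ×-dec (2 ℕ.≤? toℕ j) ×-dec inversion₃? a b c y ])
        (σ₂≡ j) (σ₁≡ j) (σ₀≡ j) (σ₀≡ i))

  monot-reversed : monot σ ≡ monotᵣ (reversedWord σ)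
  monot-reversed = begin
    monot σ
      ≡⟨ count-Σ (λ i → doubleAscent? σ i ⊎-dec doubleDescent? σ i) (allFin (suc n)) ⟩
    ℕΣ.Σ[ allFin (suc n) ] (λ i → #[ doubleAscent? σ i ⊎-dec doubleDescent? σ i ])
      ≡⟨ ℕΣ.Σ-cong (allFin (suc n)) (λ {i} _ → monot-term i) ⟩
    ℕΣ.Σ[ allFin (suc n) ] (monotTerm s refl ∘ toℕ)
      ≡⟨ Σ-allFin-toℕ (suc n) (monotTerm s refl) ⟩
    ℕΣ.Σ[ downFrom (suc n) ] (monotTerm s refl)
      ≡⟨ Σ-monotTerm s refl n ⟩
    monotᵣ (applyDownFrom (s ∘ suc) n)
      ≡⟨ cong monotᵣ reversedWord-letters ⟨
    monotᵣ (reversedWord σ) ∎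
    where open ≡-Reasoning

  inv₃-reversed : inv₃ σ ≡ inv₃ᵣ (reversedWord σ)
  inv₃-reversed = begin
    inv₃ σ
      ≡⟨ count-Σ (threeInv? σ) (pairs (suc n)) ⟩
    ℕΣ.Σ[ pairs (suc n) ] (λ ij → #[ threeInv? σ ij ])
      ≡⟨ ℕΣ.Σ-cartesianProduct (allFin (suc n)) (allFin (suc n)) ⟩
    ℕΣ.Σ[ allFin (suc n) ] (λ i → ℕΣ.Σ[ allFin (suc n) ] (λ j → #[ threeInv? σ (i , j) ]))
      ≡⟨ ℕΣ.Σ-cong (allFin (suc n)) (λ {i} _ → trans
           (ℕΣ.Σ-cong (allFin (suc n)) (λ {j} _ → inv₃-term i j))
           (Σ-allFin-toℕ (suc n) (inv₃Term s refl (toℕ i)))) ⟩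
    ℕΣ.Σ[ allFin (suc n) ] (λ i → ℕΣ.Σ[ downFrom (suc n) ] (inv₃Term s refl (toℕ i)))
      ≡⟨ Σ-allFin-toℕ (suc n) (λ i → ℕΣ.Σ[ downFrom (suc n) ] (inv₃Term s refl i)) ⟩
    ℕΣ.Σ[ downFrom (suc n) ] (λ i → ℕΣ.Σ[ downFrom (suc n) ] (inv₃Term s refl i))
      ≡⟨ Σ-inv₃Term s refl n ⟩
    inv₃ᵣ (applyDownFrom (s ∘ suc) n)
      ≡⟨ cong inv₃ᵣ reversedWord-letters ⟨
    inv₃ᵣ (reversedWord σ) ∎
    where open ≡-Reasoning

-- The permutation side and the comparison of coefficients

permutationTerm : Word n → Poly
permutationTerm σ = t^ (inv₃ σ) · z^ (monot σ)

evaluate-permutations : ∀ m ω →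
  evaluate ω (∑ (permutations (suc m)) permutationTerm) ≡ Σ[ cuts (suc m) ] (λ (i , j) → Ψ m i j ω)
evaluate-permutations m ω = begin
  evaluate ω (∑ (permutations (suc m)) permutationTerm)
    ≡⟨ evaluate-∑ ω (permutations (suc m)) permutationTerm ⟩
  Σ[ permutations (suc m) ] (λ σ → evaluate ω (permutationTerm σ))
    ≡⟨ Σ-cong (permutations (suc m)) (λ {σ} _ → term σ) ⟩
  Σ[ permutations (suc m) ] (f ∘ reversedWord)
    ≡⟨ Σ-map reversedWord (permutations (suc m)) ⟨
  Σ[ map reversedWord (permutations (suc m)) ] f
    ≡⟨ Σ-sameElements f (Unique.map⁺ reversedWord-injective (Unique-permutations (suc m))) (Unique-allOrders m)
         (λ l∈ → case ∈.∈-map⁻ reversedWord l∈ of λ { (σ , σ∈ , refl) → allOrders-complete m (reversedWord-sound σ∈) })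
         (λ l∈ → case reversedWord-complete (allOrders-↭ m l∈) of λ { (σ , σ∈ , refl) → ∈.∈-map⁺ reversedWord σ∈ }) ⟩
  Σ[ allOrders m ] f
    ≡⟨ Σ-allOrders m ω ⟩
  Σ[ cuts (suc m) ] (λ (i , j) → Ψ m i j ω) ∎
  where
  open ≡-Reasoning
  f : List ℕ → ℤ
  f l = ω (inv₃ᵣ l) (monotᵣ l)
  term : ∀ σ → evaluate ω (permutationTerm σ) ≡ f (reversedWord σ)
  term σ = trans (ℤ.+-identityʳ _) (trans (ℤ.*-identityˡ _)
    (cong₂ ω (trans (ℕ.+-identityʳ (inv₃ σ)) (inv₃-reversed σ)) (monot-reversed σ)))

theorem1p1 : (n : ℕ) → 1 ≤ n →
    ∑ (upTo n) (λ k → ∑ (stLD n k) (λ P → t^ (area P) · const ([-1]^ (dinv P))) · z^ k)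
    ≈ ∑ (permutations n) (λ σ → t^ (inv₃ σ) · z^ (monot σ))
theorem1p1 (suc m) _ a b = begin
  coeff (generatingFunction (suc m)) a b
    ≡⟨ coeff≡evaluate (generatingFunction (suc m)) a b ⟩
  evaluate (indicator a b) (generatingFunction (suc m))
    ≡⟨ evaluate-paths m (indicator a b) ⟩
  Σ[ cuts (suc m) ] (λ (i , j) → Ψ m i j (indicator a b))
    ≡⟨ evaluate-permutations m (indicator a b) ⟨
  evaluate (indicator a b) (∑ (permutations (suc m)) permutationTerm)
    ≡⟨ coeff≡evaluate (∑ (permutations (suc m)) permutationTerm) a b ⟨
  coeff (∑ (permutations (suc m)) permutationTerm) a b ∎
  where open ≡-Reasoning
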